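{- There exists a constant $c>0$ such that for every $\xi$ with $0<\xi<c$ there is $n_0(\xi)$ such that every graph $G$ of order $n\geq n_0(\xi)$ satisfies at least one of the following: (i) $bk\left(\overline{G}\right)>n/2$; (ii) $bk\left(G\right)>\left(1/12-10^{ -6}\xi^{6}\right)n$; (iii) $G$ contains an induced subgraph $G_{0}$ which is bipartite, has at least $\left(1-\xi\right)n$ vertices, and has minimum degree \[ \delta\left(G_{0}\right)>\left(\frac{1}{2}-2\xi\right)n. \]
   Context: For a graph $G$, $\Gamma_G(u)$ denotes the set of neighbours of a vertex $u$. The booksize $bk(G)$ is the largest $m$ such that $G$ contains $m$ triangles sharing a common edge, i.e. $bk(G)=\max_{uv\in E(G)}|\Gamma_G(u)\cap\Gamma_G(v)|$ (and $0$ if $G$ has no edges). $\overline{G}$ denotes the complement of $G$, and $\delta(G_0)$ the minimum degree of $G_0$. -}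

module Defs where

open import Data.Bool using (Bool; true; false; T; not; _∧_)
open import Data.Nat using (ℕ; _⊔_)
open import Data.Fin using (Fin)
open import Data.List using (List; length; filterᵇ; allFin; map; foldr; concatMap)
open import Data.Integer using (+_)
open import Data.Rational using (ℚ; _/_)
open import Relation.Binary.PropositionalEquality using (_≡_)
open import Relation.Nullary using (¬_)

record Graph (n : ℕ) : Set where
  field
    adj   : Fin n → Fin n → Bool
    sym   : ∀ u v → adj u v ≡ adj v u
    irref : ∀ u → adj u u ≡ false
open Graph public

open import Data.Fin using (_≟_)
open import Relation.Nullary using (does)

_==_ : ∀ {n} → Fin n → Fin n → Bool
u == v = does (u ≟ v)

compAdj : ∀ {n} → Graph n → Fin n → Fin n → Bool
compAdj G u v = not (u == v) ∧ not (adj G u v)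

card : ∀ {n} → (Fin n → Bool) → ℕ
card {n} S = length (filterᵇ S (allFin n))

commonNbrs : ∀ {n} → (Fin n → Fin n → Bool) → Fin n → Fin n → ℕ
commonNbrs a u v = card (λ w → a u w ∧ a v w)

-- booksize of a graph given by its adjacency: max over edges uv of |Γ(u) ∩ Γ(v)|, 0 if no edges
bkAdj : ∀ {n} → (Fin n → Fin n → Bool) → ℕ
bkAdj {n} a =
  foldr _⊔_ 0
    (concatMap (λ u → map (λ v → val u v (a u v)) (allFin n)) (allFin n))
  where
    val : Fin n → Fin n → Bool → ℕ
    val u v true  = commonNbrs a u v
    val u v false = 0

bk : ∀ {n} → Graph n → ℕ
bk G = bkAdj (adj G)

bkComp : ∀ {n} → Graph n → ℕ
bkComp G = bkAdj (compAdj G)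

ℕ→ℚ : ℕ → ℚ
ℕ→ℚ k = (+ k) / 1

InducedBipartite : ∀ {n} → Graph n → (Fin n → Bool) → Set
InducedBipartite {n} G S =
  Σ' (Fin n → Bool) (λ col → ∀ u v → T (S u) → T (S v) → T (adj G u v) → ¬ (col u ≡ col v))
  where
    open import Data.Product using (Σ)
    Σ' : (A : Set) → (A → Set) → Set
    Σ' = Σ

degIn : ∀ {n} → Graph n → (Fin n → Bool) → Fin n → ℕ
degIn G S u = card (λ w → S w ∧ adj G u w)

{-# OPTIONS --safe #-}
-- A homogeneous list P of k vertices yields the [0,k]-valued functions W_P (number of neighbours
-- in P) and V_P = k − W_P. If P is independent then ‖V_P‖² ≤ (1/2 + o(1)) k² n, since
-- nonadjacent vertices have at most n/2 common nonneighbours; if P is a clique then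
-- ‖W_P‖² ≤ (1/12 + o(1)) k² n; and ⟨W_P , W_Q⟩ < k² n / 12 if P and Q are completely joined.
-- For three pairwise joined independent lists, ‖W₁ + W₂ + W₃ − k‖² < 0 would follow, so by
-- Kővári–Sós–Turán and Ramsey there are few triangles among the vertices of degree > 7n/24
-- ("high"), which contain no large clique; the others ("low") contain no large independent
-- set, hence almost form a clique. For two joined independent lists of high vertices,
-- ‖W₁ + W₂ − k‖² is small outside the low vertices; applied to lists having as few low neighbours
-- as possible, this forces more edges between low and high vertices than the low degrees allow,
-- unless the low vertices are negligible. Then W₁ + W₂ ≈ k and W₁ W₂ ≈ 0 force almost all
-- degrees up to about n/2, and the two neighbourhoods of a typical edge give the bipartition.
module Submission where

open import Defs

-- The value 1/12 is where three lists balance: up to lower order, ‖W₁ + W₂ + W₃ - k‖² is at most 3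
-- k² n / 2 + 6 k² b - 2 k² n, which vanishes at b = n / 12. The gap 1 / N in `b-bound` is spent
-- there and nowhere else; all other estimates run on 12 b ≤ n. The obstacle is the set of ℓ low
-- vertices. Let τ be a value such that boundedly many high vertices have fewer than τ low
-- neighbours, yet enough have at most τ. Either τ > 26 ℓ / 89, or at least half of the high
-- vertices have more than 24 ℓ / 41 - τ low neighbours. Both push the average above 7 ℓ / 24, more
-- than the low degrees can pay for. This works because 7/24 < 26/89 < 12/41 < 1 - 1/√2, with room
-- of order 1/1000. Lists have bounded size k, so each norm carries errors of order k n (the
-- diagonal) and k² (endpoints counted in `C̄`). Against k² n these vanish for large k and n.
-- Against k² ℓ they vanish only if k is a large multiple of n / ℓ, so the list size for the low
-- vertices is chosen after the desired bound on ℓ.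

module BooklessGraphs where

  open import Data.Bool using (Bool; true; false; T; not; _∧_)
  open import Data.Bool.Properties using (T?)
  open import Data.Empty using (⊥; ⊥-elim)
  open import Data.Fin using (Fin)
  import Data.Fin as Fin
  open import Data.List using (List; []; _∷_; length; filter; map; _++_; foldr; concatMap; cartesianProduct; allFin)
  open import Data.List.Membership.Propositional using (_∈_)
  open import Data.List.Membership.Propositional.Properties using (∈-concat⁺′; ∈-map⁺; ∈-allFin)
  open import Data.List.Properties using (length-filter; length-tabulate)
  open import Data.List.Relation.Binary.Sublist.Propositional using (_⊆_; []; _∷_; _∷ʳ_; ⊆-trans; minimum)
  open import Data.List.Relation.Binary.Sublist.Propositional.Properties using (All-resp-⊆; filter-⊆)
  open import Data.List.Relation.Unary.All using (All; []; _∷_; all?)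
  import Data.List.Relation.Unary.All as All
  open import Data.List.Relation.Unary.All.Properties using (all-filter)
  open import Data.List.Relation.Unary.AllPairs using (AllPairs; []; _∷_)
  import Data.List.Relation.Unary.AllPairs as AllPairs
  open import Data.List.Relation.Unary.Any using (here; there)
  open import Data.List.Relation.Unary.Unique.Propositional using (Unique)
  open import Data.List.Relation.Unary.Unique.Propositional.Properties using (allFin⁺)
  open import Data.Nat using (ℕ; zero; suc; _+_; _*_; _^_; _⊔_; _≤_; _<_; z≤n; s≤s; _≤?_; _<?_; NonZero; >-nonZero)
  open import Data.Nat.Properties
  open import Data.Nat.Tactic.RingSolver using (solve-∀)
  open import Data.Product using (Σ; _×_; _,_; proj₁; proj₂)
  open import Data.Sum using (_⊎_; inj₁; inj₂)
  open import Data.Unit using (tt)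
  open import Function using (id)
  open import Level using (0ℓ)
  open import Relation.Binary.PropositionalEquality using (_≡_; _≢_; refl; trans; cong; cong₂; subst) renaming (sym to ≡-sym)
  open import Relation.Nullary using (¬_; Dec; yes; no; does; contradiction)
  open import Relation.Nullary.Decidable using (¬?; _×-dec_; _⊎-dec_)
  open import Relation.Unary using (Pred; Decidable)

  private
    variable
      X Y Z : Set

  -- Linear arithmetic by certificate: the identity exhibits y ∸ x as a
  -- nonnegative multiple of the hypothesis plus the slack s.
  from : ∀ {a b} x y s → a ≤ b → x + b + s ≡ y + a → x ≤ y
  from {a} {b} x y s a≤b eq = +-cancelʳ-≤ b x y (≤-trans (m≤m+n (x + b) s) (≤-trans (≤-reflexive eq) (+-monoʳ-≤ y a≤b)))

  infixr 5 _⊕_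
  infixr 6 _⊗_

  _⊕_ : ∀ {a b c d} → a ≤ b → c ≤ d → a + c ≤ b + d
  _⊕_ = +-mono-≤

  _⊗_ : ∀ {a b} c → a ≤ b → c * a ≤ c * b
  c ⊗ h = *-monoʳ-≤ c h

  2xy≤x²+y² : ∀ x y → 2 * (x * y) ≤ x * x + y * y
  2xy≤x²+y² x y with ≤-total x y
  ... | inj₁ x≤y with m≤n⇒∃[o]m+o≡n x≤y
  ...   | t , refl = from (2 * (x * (x + t))) (x * x + (x + t) * (x + t)) (t * t) (z≤n {0}) (eq x t)
    where
    eq : ∀ x t → 2 * (x * (x + t)) + 0 + t * t ≡ x * x + (x + t) * (x + t) + 0
    eq = solve-∀
  2xy≤x²+y² x y | inj₂ y≤x with m≤n⇒∃[o]m+o≡n y≤x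
  ...   | t , refl = from (2 * ((y + t) * y)) ((y + t) * (y + t) + y * y) (t * t) (z≤n {0}) (eq y t)
    where
    eq : ∀ y t → 2 * ((y + t) * y) + 0 + t * t ≡ (y + t) * (y + t) + y * y + 0
    eq = solve-∀

  -- Sums and counts over lists

  ∑ : List X → (X → ℕ) → ℕ
  ∑ []       f = 0
  ∑ (x ∷ xs) f = f x + ∑ xs f

  infix 9 #_∣_
  #_∣_ : {P : Pred X 0ℓ} → Decidable P → List X → ℕ
  # P? ∣ xs = length (filter P? xs)

  ind : Bool → ℕ
  ind true  = 1
  ind false = 0

  ind≤1 : ∀ b → ind b ≤ 1
  ind≤1 true  = ≤-refl
  ind≤1 false = z≤n

  ∑-cong : ∀ (xs : List X) {f g : X → ℕ} → (∀ x → f x ≡ g x) → ∑ xs f ≡ ∑ xs g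
  ∑-cong []       eq = refl
  ∑-cong (x ∷ xs) eq = cong₂ _+_ (eq x) (∑-cong xs eq)

  ∑-monoᴬ : ∀ {xs : List X} {f g : X → ℕ} → All (λ x → f x ≤ g x) xs → ∑ xs f ≤ ∑ xs g
  ∑-monoᴬ []       = z≤n
  ∑-monoᴬ (h ∷ hs) = +-mono-≤ h (∑-monoᴬ hs)

  ∑-mono : ∀ (xs : List X) {f g : X → ℕ} → (∀ x → f x ≤ g x) → ∑ xs f ≤ ∑ xs g
  ∑-mono xs h = ∑-monoᴬ (All.universal h xs)

  ∑-const : ∀ (xs : List X) c → ∑ xs (λ _ → c) ≡ length xs * c
  ∑-const []       c = refl
  ∑-const (x ∷ xs) c = cong (c +_) (∑-const xs c)

  ∑-+ : ∀ (xs : List X) (f g : X → ℕ) → ∑ xs (λ x → f x + g x) ≡ ∑ xs f + ∑ xs g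
  ∑-+ []       f g = refl
  ∑-+ (x ∷ xs) f g rewrite ∑-+ xs f g = eq (f x) (g x) (∑ xs f) (∑ xs g)
    where
    eq : ∀ a b c d → a + b + (c + d) ≡ a + c + (b + d)
    eq = solve-∀

  ∑-* : ∀ (xs : List X) c (f : X → ℕ) → ∑ xs (λ x → c * f x) ≡ c * ∑ xs f
  ∑-* []       c f = ≡-sym (*-zeroʳ c)
  ∑-* (x ∷ xs) c f rewrite ∑-* xs c f = ≡-sym (*-distribˡ-+ c (f x) (∑ xs f))

  ∑-*ʳ : ∀ (xs : List X) (f : X → ℕ) c → ∑ xs (λ x → f x * c) ≡ ∑ xs f * c
  ∑-*ʳ []       f c = refl
  ∑-*ʳ (x ∷ xs) f c rewrite ∑-*ʳ xs f c = ≡-sym (*-distribʳ-+ c (f x) (∑ xs f))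

  ∑-swap : ∀ (xs : List X) (ys : List Y) (f : X → Y → ℕ) →
           ∑ xs (λ x → ∑ ys (f x)) ≡ ∑ ys (λ y → ∑ xs (λ x → f x y))
  ∑-swap []       ys f = ≡-sym (trans (∑-const ys 0) (*-zeroʳ (length ys)))
  ∑-swap (x ∷ xs) ys f rewrite ∑-swap xs ys f = ≡-sym (∑-+ ys (f x) (λ y → ∑ xs (λ x′ → f x′ y)))

  ∑-lower : ∀ {xs : List X} {f : X → ℕ} c → All (λ x → c ≤ f x) xs → length xs * c ≤ ∑ xs f
  ∑-lower {xs = xs} c h = ≤-trans (≤-reflexive (≡-sym (∑-const xs c))) (∑-monoᴬ h)

  ∑-upper : ∀ {xs : List X} {f : X → ℕ} c → All (λ x → f x ≤ c) xs → ∑ xs f ≤ length xs * c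
  ∑-upper {xs = xs} c h = ≤-trans (∑-monoᴬ h) (≤-reflexive (∑-const xs c))

  ∑-filter : {P : Pred X 0ℓ} (P? : Decidable P) (xs : List X) (f : X → ℕ) →
             ∑ (filter P? xs) f + ∑ (filter (λ x → ¬? (P? x)) xs) f ≡ ∑ xs f
  ∑-filter P? []       f = refl
  ∑-filter P? (x ∷ xs) f with does (P? x)
  ... | true  = trans (+-assoc (f x) _ _) (cong (f x +_) (∑-filter P? xs f))
  ... | false = trans (eq (∑ (filter P? xs) f) (f x) _) (cong (f x +_) (∑-filter P? xs f))
    where
    eq : ∀ a b c → a + (b + c) ≡ b + (a + c)
    eq = solve-∀

  ∑-filter-≤ : {P : Pred X 0ℓ} (P? : Decidable P) (xs : List X) (f : X → ℕ) → ∑ (filter P? xs) f ≤ ∑ xs f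
  ∑-filter-≤ P? xs f = ≤-trans (m≤m+n _ _) (≤-reflexive (∑-filter P? xs f))

  #-split : {P : Pred X 0ℓ} (P? : Decidable P) (xs : List X) → # P? ∣ xs + # (λ x → ¬? (P? x)) ∣ xs ≡ length xs
  #-split P? []       = refl
  #-split P? (x ∷ xs) with does (P? x)
  ... | true  = cong suc (#-split P? xs)
  ... | false = trans (+-suc _ _) (cong suc (#-split P? xs))

  ∑-ind : {P : Pred X 0ℓ} (P? : Decidable P) (xs : List X) → ∑ xs (λ x → ind (does (P? x))) ≡ # P? ∣ xs
  ∑-ind P? []       = refl
  ∑-ind P? (x ∷ xs) with does (P? x)
  ... | true  = cong suc (∑-ind P? xs)
  ... | false = ∑-ind P? xs

  #-mono : {P Q : Pred X 0ℓ} (P? : Decidable P) (Q? : Decidable Q) {xs : List X} →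
           All (λ x → P x → Q x) xs → # P? ∣ xs ≤ # Q? ∣ xs
  #-mono P? Q? []       = z≤n
  #-mono P? Q? {x ∷ xs} (h ∷ hs) with P? x | Q? x
  ... | yes p | yes q = s≤s (#-mono P? Q? hs)
  ... | yes p | no ¬q = contradiction (h p) ¬q
  ... | no ¬p | yes q = m≤n⇒m≤1+n (#-mono P? Q? hs)
  ... | no ¬p | no ¬q = #-mono P? Q? hs

  #-∪ : {P Q R : Pred X 0ℓ} (P? : Decidable P) (Q? : Decidable Q) (R? : Decidable R) {xs : List X} →
        All (λ x → P x → Q x ⊎ R x) xs → # P? ∣ xs ≤ # Q? ∣ xs + # R? ∣ xs
  #-∪ P? Q? R? []       = z≤n
  #-∪ P? Q? R? {x ∷ xs} (h ∷ hs) with P? x | Q? x | R? x | #-∪ P? Q? R? hs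
  ... | no ¬p | yes q | yes r | ih = m≤n⇒m≤1+n (≤-trans ih (+-monoʳ-≤ _ (n≤1+n _)))
  ... | no ¬p | yes q | no ¬r | ih = m≤n⇒m≤1+n ih
  ... | no ¬p | no ¬q | yes r | ih = ≤-trans ih (+-monoʳ-≤ _ (n≤1+n _))
  ... | no ¬p | no ¬q | no ¬r | ih = ih
  ... | yes p | yes q | yes r | ih = s≤s (≤-trans ih (+-monoʳ-≤ _ (n≤1+n _)))
  ... | yes p | yes q | no ¬r | ih = s≤s ih
  ... | yes p | no ¬q | yes r | ih = ≤-trans (s≤s ih) (≤-reflexive (≡-sym (+-suc _ _)))
  ... | yes p | no ¬q | no ¬r | ih with h p
  ...   | inj₁ q = contradiction q ¬q
  ...   | inj₂ r = contradiction r ¬r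

  #-all : {P : Pred X 0ℓ} (P? : Decidable P) {xs : List X} → All P xs → # P? ∣ xs ≡ length xs
  #-all P? []       = refl
  #-all P? {x ∷ xs} (p ∷ ps) with P? x
  ... | yes _ = cong suc (#-all P? ps)
  ... | no ¬p = contradiction p ¬p

  #-filter : {P Q R : Pred X 0ℓ} (P? : Decidable P) (Q? : Decidable Q) (R? : Decidable R) (xs : List X) →
             (∀ x → P x → Q x → R x) → # Q? ∣ (filter P? xs) ≤ # R? ∣ xs
  #-filter P? Q? R? []       h = z≤n
  #-filter P? Q? R? (x ∷ xs) h with P? x
  ... | no ¬p with R? x
  ...   | yes r = m≤n⇒m≤1+n (#-filter P? Q? R? xs h)
  ...   | no ¬r = #-filter P? Q? R? xs h
  #-filter P? Q? R? (x ∷ xs) h | yes p with Q? x | R? x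
  ...   | yes q | yes r = s≤s (#-filter P? Q? R? xs h)
  ...   | yes q | no ¬r = contradiction (h x p q) ¬r
  ...   | no ¬q | yes r = m≤n⇒m≤1+n (#-filter P? Q? R? xs h)
  ...   | no ¬q | no ¬r = #-filter P? Q? R? xs h

  AllPairs-resp-⊆ : ∀ {R : X → X → Set} {xs ys : List X} → xs ⊆ ys → AllPairs R ys → AllPairs R xs
  AllPairs-resp-⊆ []         []       = []
  AllPairs-resp-⊆ (_ ∷ʳ s)   (_ ∷ rs) = AllPairs-resp-⊆ s rs
  AllPairs-resp-⊆ (refl ∷ s) (r ∷ rs) = All-resp-⊆ s r ∷ AllPairs-resp-⊆ s rs

  -- Ramsey's theorem and the Kővári–Sós–Turán pigeonhole

  ramsey : ℕ → ℕ → ℕ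
  ramsey zero    b       = 0
  ramsey (suc a) zero    = 0
  ramsey (suc a) (suc b) = suc (ramsey a (suc b) + ramsey (suc a) b)

  Homogeneous : (X → X → Set) → List X → ℕ → Set
  Homogeneous R xs k = Σ (List _) λ ys → ys ⊆ xs × length ys ≡ k × AllPairs R ys

  -- The usual neighbourhood induction, run along the list: the head is compared only with later
  -- elements, which is exactly what `AllPairs` records, so an arbitrary decidable relation is
  -- allowed.
  ramsey-sublist : ∀ {R : X → X → Set} (R? : ∀ x y → Dec (R x y)) a b xs → ramsey a b ≤ length xs →
                   Homogeneous R xs a ⊎ Homogeneous (λ x y → ¬ R x y) xs b
  ramsey-sublist R? zero    b       xs h = inj₁ ([] , minimum xs , refl , [])
  ramsey-sublist R? (suc a) zero    xs h = inj₂ ([] , minimum xs , refl , [])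
  ramsey-sublist {R = R} R? (suc a) (suc b) (x ∷ xs) (s≤s h) with ramsey a (suc b) ≤? # R? x ∣ xs
  ... | yes h₁ with ramsey-sublist R? a (suc b) (filter (R? x) xs) h₁
  ...   | inj₁ (ys , s , l , p) = inj₁ (x ∷ ys , refl ∷ ⊆-trans s (filter-⊆ (R? x) xs) , cong suc l , All-resp-⊆ s (all-filter (R? x) xs) ∷ p)
  ...   | inj₂ (ys , s , l , p) = inj₂ (ys , x ∷ʳ ⊆-trans s (filter-⊆ (R? x) xs) , l , p)
  ramsey-sublist {R = R} R? (suc a) (suc b) (x ∷ xs) (s≤s h) | no ¬h₁
    with ramsey-sublist R? (suc a) b (filter (λ y → ¬? (R? x y)) xs) rest
    where
    rest : ramsey (suc a) b ≤ # (λ y → ¬? (R? x y)) ∣ xs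
    rest = +-cancelˡ-≤ (ramsey a (suc b)) _ _ (≤-trans h (≤-trans (≤-reflexive (≡-sym (#-split (R? x) xs))) (+-monoˡ-≤ _ (<⇒≤ (≰⇒> ¬h₁)))))
  ... | inj₁ (ys , s , l , p) = inj₁ (ys , x ∷ʳ ⊆-trans s (filter-⊆ _ xs) , l , p)
  ... | inj₂ (ys , s , l , p) = inj₂ (x ∷ ys , refl ∷ ⊆-trans s (filter-⊆ _ xs) , cong suc l , All-resp-⊆ s (all-filter _ xs) ∷ p)

  kst-factor : ℕ → ℕ → ℕ
  kst-factor k e = 2 * e * 2 ^ (2 * (k * e))

  kst-factor≥1 : ∀ k {e} → 1 ≤ e → 1 ≤ kst-factor k e
  kst-factor≥1 k {e} e≥1 = *-mono-≤ (*-mono-≤ {1} {2} (s≤s z≤n) e≥1) (m^n>0 2 (2 * (k * e)))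

  module _ {Rel : X → Y → Set} (Rel? : ∀ x y → Dec (Rel x y)) where

    Common? : ∀ S → Decidable (λ y → All (λ s → Rel s y) S)
    Common? S y = all? (λ s → Rel? s y) S

    -- Pigeonhole one element of `U` at a time: split `ys` by their relation to `u` and keep the
    -- larger half, taking `u` into `S` if that half is the related one. Each step costs a factor 2.
    -- Nonemptiness of `ys` is carried along because any single `y` refutes the branch in which `U`
    -- runs out before `k` elements are chosen.
    common-sublist : ∀ U k ys → 1 ≤ length ys → All (λ y → k ≤ # (λ u → Rel? u y) ∣ U) ys →
                     Σ (List X) λ S → S ⊆ U × length S ≡ k × length ys ≤ 2 ^ length U * # Common? S ∣ ys
    common-sublist U zero ys h₁ h = [] , minimum U , refl ,
      ≤-trans (≤-reflexive (≡-sym (trans (*-identityˡ _) (#-all (Common? []) (All.universal (λ _ → []) ys)))))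
              (*-monoˡ-≤ (# Common? [] ∣ ys) (m^n>0 2 (length U)))
    common-sublist [] (suc k) (y ∷ ys) h₁ (() ∷ _)
    common-sublist (u ∷ U) (suc k) ys h₁ h = byHalf (#-split (Rel? u) ys)
      where
      Y₁ Y₀ : List Y
      Y₁ = filter (Rel? u) ys
      Y₀ = filter (λ y → ¬? (Rel? u y)) ys

      in₁ : All (λ y → k ≤ # (λ u′ → Rel? u′ y) ∣ U) Y₁
      in₁ = All.map step (All.zip (all-filter (Rel? u) ys , All-resp-⊆ (filter-⊆ (Rel? u) ys) h))
        where
        step : ∀ {y} → Rel u y × suc k ≤ # (λ u′ → Rel? u′ y) ∣ (u ∷ U) → k ≤ # (λ u′ → Rel? u′ y) ∣ U
        step {y} (r , q) with Rel? u y
        ... | yes _ = ≤-pred q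
        ... | no ¬r = contradiction r ¬r

      in₀ : All (λ y → suc k ≤ # (λ u′ → Rel? u′ y) ∣ U) Y₀
      in₀ = All.map step (All.zip (all-filter (λ y → ¬? (Rel? u y)) ys , All-resp-⊆ (filter-⊆ (λ y → ¬? (Rel? u y)) ys) h))
        where
        step : ∀ {y} → ¬ Rel u y × suc k ≤ # (λ u′ → Rel? u′ y) ∣ (u ∷ U) → suc k ≤ # (λ u′ → Rel? u′ y) ∣ U
        step {y} (¬r , q) with Rel? u y
        ... | yes r = contradiction r ¬r
        ... | no _  = q

      double : ∀ {c c′} z → length ys ≤ 2 * c → c ≤ z * c′ → length ys ≤ 2 * z * c′
      double {c} {c′} z p q = ≤-trans p (≤-trans (*-monoʳ-≤ 2 q) (≤-reflexive (≡-sym (*-assoc 2 z c′))))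

      positive : ∀ {c} → length ys ≤ 2 * c → 1 ≤ c
      positive {zero}  p = ⊥-elim (<-irrefl refl (≤-trans h₁ p))
      positive {suc c} p = s≤s z≤n

      Goal : Set
      Goal = Σ (List X) λ S → S ⊆ (u ∷ U) × length S ≡ suc k × length ys ≤ 2 ^ length (u ∷ U) * # Common? S ∣ ys

      case₁ : length ys ≤ 2 * length Y₁ → Goal
      case₁ p with common-sublist U k Y₁ (positive p) in₁
      ... | S , s , l , q = u ∷ S , refl ∷ s , cong suc l ,
        ≤-trans (double (2 ^ length U) p q) (*-monoʳ-≤ (2 ^ length (u ∷ U)) (#-filter (Rel? u) (Common? S) (Common? (u ∷ S)) ys (λ _ → _∷_)))

      case₀ : length ys ≤ 2 * length Y₀ → Goal
      case₀ p with common-sublist U (suc k) Y₀ (positive p) in₀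
      ... | S , s , l , q = S , u ∷ʳ s , l ,
        ≤-trans (double (2 ^ length U) p q) (*-monoʳ-≤ (2 ^ length (u ∷ U)) (#-filter (λ y → ¬? (Rel? u y)) (Common? S) (Common? S) ys (λ _ _ z → z)))

      byHalf : length Y₁ + length Y₀ ≡ length ys → Goal
      byHalf eq with ≤-total (length Y₀) (length Y₁)
      ... | inj₁ p = case₁ (≤-trans (≤-reflexive (≡-sym eq)) (≤-trans (+-monoʳ-≤ _ p) (≤-reflexive (cong (length Y₁ +_) (≡-sym (+-identityʳ _))))))
      ... | inj₂ p = case₀ (≤-trans (≤-reflexive (≡-sym eq)) (≤-trans (+-monoˡ-≤ _ p) (≤-reflexive (cong (length Y₀ +_) (≡-sym (+-identityʳ _))))))

    -- Double counting: on average a `y` is related to at least 2 k of the 2 k e members of `U`, so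
    -- those related to at least k of them make up a fraction 1 / (2 e) of `ys`. The pigeonhole on
    -- these costs another 2 ^ (2 k e).
    kst : ∀ U ys k e → 1 ≤ k → 1 ≤ e → length U ≡ 2 * (k * e) → 1 ≤ length ys →
          All (λ u → length ys ≤ e * # Rel? u ∣ ys) U →
          Σ (List X) λ S → S ⊆ U × length S ≡ k × length ys ≤ kst-factor k e * # Common? S ∣ ys
    kst U ys k e k≥1 e≥1 lenU ys≥1 h = finish (common-sublist U k rich rich≥1 (all-filter rich? ys))
      where
      deg : Y → ℕ
      deg y = # (λ u → Rel? u y) ∣ U

      rich? : Decidable (λ y → k ≤ deg y)
      rich? y = k ≤? deg y

      rich : List Y
      rich = filter rich? ys

      degrees : length U * length ys ≤ e * ∑ ys deg
      degrees = begin
        length U * length ys                         ≤⟨ ∑-lower (length ys) h ⟩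
        ∑ U (λ u → e * # Rel? u ∣ ys)                ≡⟨ ∑-* U e _ ⟩
        e * ∑ U (λ u → # Rel? u ∣ ys)                ≡⟨ cong (e *_) (∑-cong U (λ u → ≡-sym (∑-ind (Rel? u) ys))) ⟩
        e * ∑ U (λ u → ∑ ys (λ y → ind (does (Rel? u y)))) ≡⟨ cong (e *_) (∑-swap U ys _) ⟩
        e * ∑ ys (λ y → ∑ U (λ u → ind (does (Rel? u y)))) ≡⟨ cong (e *_) (∑-cong ys (λ y → ∑-ind (λ u → Rel? u y) U)) ⟩
        e * ∑ ys deg                                 ∎
        where open ≤-Reasoning

      split : ∑ ys deg ≤ length rich * length U + length ys * k
      split = begin
        ∑ ys deg                                     ≡⟨ ≡-sym (∑-filter rich? ys deg) ⟩
        ∑ rich deg + ∑ (filter (λ y → ¬? (rich? y)) ys) deg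
          ≤⟨ +-mono-≤ (∑-upper (length U) (All.universal (λ y → length-filter (λ u → Rel? u y) U) rich))
                      (≤-trans (∑-upper k (All.map (λ ¬p → <⇒≤ (≰⇒> ¬p)) (all-filter (λ y → ¬? (rich? y)) ys)))
                               (*-monoˡ-≤ k (length-filter (λ y → ¬? (rich? y)) ys))) ⟩
        length rich * length U + length ys * k       ∎
        where open ≤-Reasoning

      arith : ∀ N r → 2 * (k * e) * N ≤ e * (r * (2 * (k * e)) + N * k) → N ≤ 2 * e * r
      arith N r q = *-cancelˡ-≤ (k * e) {{>-nonZero (*-mono-≤ k≥1 e≥1)}} (from (k * e * N) (k * e * (2 * e * r)) 0 q (eq k e N r))
        where
        eq : ∀ k e N r → k * e * N + e * (r * (2 * (k * e)) + N * k) + 0 ≡ k * e * (2 * e * r) + 2 * (k * e) * N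
        eq = solve-∀

      N≤2er : length ys ≤ 2 * e * length rich
      N≤2er = arith (length ys) (length rich)
        (subst (λ z → z * length ys ≤ e * (length rich * z + length ys * k)) lenU (≤-trans degrees (*-monoʳ-≤ e split)))

      rich≥1 : 1 ≤ length rich
      rich≥1 with length rich | N≤2er
      ... | zero  | q = ⊥-elim (<-irrefl refl (≤-trans ys≥1 (≤-trans q (≤-reflexive (*-zeroʳ (2 * e))))))
      ... | suc _ | _ = s≤s z≤n

      finish : (Σ (List X) λ S → S ⊆ U × length S ≡ k × length rich ≤ 2 ^ length U * # Common? S ∣ rich) →
               Σ (List X) λ S → S ⊆ U × length S ≡ k × length ys ≤ kst-factor k e * # Common? S ∣ ys
      finish (S , s , l , q) = S , s , l , (begin
        length ys                                            ≤⟨ N≤2er ⟩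
        2 * e * length rich                                  ≤⟨ *-monoʳ-≤ (2 * e) q ⟩
        2 * e * (2 ^ length U * # Common? S ∣ rich)          ≡⟨ ≡-sym (*-assoc (2 * e) (2 ^ length U) _) ⟩
        2 * e * 2 ^ length U * # Common? S ∣ rich            ≡⟨ cong (λ z → 2 * e * 2 ^ z * # Common? S ∣ rich) lenU ⟩
        kst-factor k e * # Common? S ∣ rich
          ≤⟨ *-monoʳ-≤ (kst-factor k e) (#-filter rich? (Common? S) (Common? S) ys (λ _ _ z → z)) ⟩
        kst-factor k e * # Common? S ∣ ys                    ∎)
        where open ≤-Reasoning

  All-transpose : ∀ {Rel : X → Y → Set} {xs ys} → All (λ y → All (λ x → Rel x y) xs) ys → All (λ x → All (Rel x) ys) xs
  All-transpose {xs = []}     h = []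
  All-transpose {xs = x ∷ xs} h = All.map All.head h ∷ All-transpose (All.map All.tail h)

  -- Completely joined pairs of homogeneous lists

  HasHomogeneous : (X → Set) → (X → X → Set) → (ℕ → ℕ) → Set
  HasHomogeneous Cls H ρ = ∀ k xs → Unique xs → All Cls xs → ρ k ≤ length xs → Homogeneous H xs k

  record Joined (H Rel : X → X → Set) (xs ys : List X) (k : ℕ) : Set where
    field
      left right   : List X
      left⊆        : left ⊆ xs
      right⊆       : right ⊆ ys
      left-length  : length left ≡ k
      right-length : length right ≡ k
      left-hom     : AllPairs H left
      right-hom    : AllPairs H right
      complete     : All (λ p → All (Rel p) right) left

  *-cancelˡ-bound : ∀ f {a b c} → 1 ≤ f → f * a ≤ c → c ≤ f * b → a ≤ b
  *-cancelˡ-bound f f≥1 p q = *-cancelˡ-≤ f {{>-nonZero f≥1}} (≤-trans p q)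

  -- Ramsey, then Kővári-Sós-Turán, then Ramsey again inside the common neighbourhood. Each
  -- application refutes the resulting pair of lists and so bounds the number of vertices related to
  -- a fraction 1 / e of `ys`. The `suc` keeps `ys` nonempty even if `ρ k` is 0.
  join : ∀ {Cls : X → Set} {H Rel : X → X → Set} {ρ} → HasHomogeneous Cls H ρ → (Rel? : ∀ x y → Dec (Rel x y)) →
         ∀ xs ys k e → 1 ≤ k → 1 ≤ e → Unique xs → All Cls xs → Unique ys → All Cls ys →
         ρ (2 * (k * e)) ≤ length xs → kst-factor k e * suc (ρ k) ≤ length ys →
         All (λ x → length ys ≤ e * # Rel? x ∣ ys) xs → Joined H Rel xs ys k
  join {X = X} {Cls} {H} {Rel} {ρ} hom Rel? xs ys k e k≥1 e≥1 xs! xsC ys! ysC xs≥ ys≥ rich = fromU (hom (2 * (k * e)) xs xs! xsC xs≥)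
    where
    fromS : ∀ {U} → U ⊆ xs → AllPairs H U →
            (Σ (List X) λ S → S ⊆ U × length S ≡ k × length ys ≤ kst-factor k e * # Common? Rel? S ∣ ys) → Joined H Rel xs ys k
    fromS U⊆ UH (S , S⊆ , lS , bound)
      with hom k (filter (Common? Rel? S) ys) (AllPairs-resp-⊆ (filter-⊆ (Common? Rel? S) ys) ys!)
               (All-resp-⊆ (filter-⊆ (Common? Rel? S) ys) ysC)
               (≤-trans (n≤1+n _) (*-cancelˡ-bound (kst-factor k e) (kst-factor≥1 k e≥1) ys≥ bound))
    ... | T , T⊆ , lT , TH = record
      { left = S ; right = T ; left⊆ = ⊆-trans S⊆ U⊆ ; right⊆ = ⊆-trans T⊆ (filter-⊆ (Common? Rel? S) ys)
      ; left-length = lS ; right-length = lT ; left-hom = AllPairs-resp-⊆ S⊆ UH ; right-hom = TH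
      ; complete = All-transpose (All-resp-⊆ T⊆ (all-filter (Common? Rel? S) ys)) }

    fromU : Homogeneous H xs (2 * (k * e)) → Joined H Rel xs ys k
    fromU (U , U⊆ , lU , UH) = fromS U⊆ UH
      (kst Rel? U ys k e k≥1 e≥1 lU (≤-trans (*-mono-≤ (kst-factor≥1 k e≥1) (s≤s z≤n)) ys≥) (All-resp-⊆ U⊆ rich))

  -- Counting pairs

  ∑-++ : ∀ (xs ys : List X) (f : X → ℕ) → ∑ (xs ++ ys) f ≡ ∑ xs f + ∑ ys f
  ∑-++ []       ys f = refl
  ∑-++ (x ∷ xs) ys f = trans (cong (f x +_) (∑-++ xs ys f)) (≡-sym (+-assoc (f x) _ _))

  ∑-map : ∀ (g : X → Y) (xs : List X) (f : Y → ℕ) → ∑ (map g xs) f ≡ ∑ xs (λ x → f (g x))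
  ∑-map g []       f = refl
  ∑-map g (x ∷ xs) f = cong (f (g x) +_) (∑-map g xs f)

  ∑-product : ∀ (xs : List X) (ys : List Y) (f : X × Y → ℕ) → ∑ (cartesianProduct xs ys) f ≡ ∑ xs (λ x → ∑ ys (λ y → f (x , y)))
  ∑-product []       ys f = refl
  ∑-product (x ∷ xs) ys f = trans (∑-++ (map (x ,_) ys) _ f) (cong₂ _+_ (∑-map (x ,_) ys f) (∑-product xs ys f))

  #-product : ∀ {P : X × Y → Set} (P? : Decidable P) (xs : List X) (ys : List Y) →
              # P? ∣ (cartesianProduct xs ys) ≡ ∑ xs (λ x → # (λ y → P? (x , y)) ∣ ys)
  #-product P? xs ys = trans (≡-sym (∑-ind P? (cartesianProduct xs ys)))
    (trans (∑-product xs ys _) (∑-cong xs (λ x → ∑-ind (λ y → P? (x , y)) ys)))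

  length-product : ∀ (xs : List X) (ys : List Y) → length (cartesianProduct xs ys) ≡ length xs * length ys
  length-product xs ys = trans (≡-sym (trans (∑-const (cartesianProduct xs ys) 1) (*-identityʳ _)))
    (trans (∑-product xs ys (λ _ → 1)) (trans (∑-cong xs (λ _ → trans (∑-const ys 1) (*-identityʳ _))) (∑-const xs (length ys))))

  -- Gram-type estimates

  ⟨_⟩[_,_] : List Z → (Z → ℕ) → (Z → ℕ) → ℕ
  ⟨ zs ⟩[ f , g ] = ∑ zs (λ z → f z * g z)

  superpose : (X → Z → ℕ) → List X → Z → ℕ
  superpose g xs z = ∑ xs (λ x → g x z)

  module _ (zs : List Z) (g : X → Z → ℕ) where

    superpose-inner : ∀ (f : Z → ℕ) xs → ⟨ zs ⟩[ f , superpose g xs ] ≡ ∑ xs (λ x → ⟨ zs ⟩[ f , g x ])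
    superpose-inner f xs = trans (∑-cong zs (λ z → ≡-sym (∑-* xs (f z) (λ x → g x z))))
                                 (≡-sym (∑-swap xs zs (λ x z → f z * g x z)))

    gram-row : ∀ c M (f : Z → ℕ) {xs} → All (λ x → c * ⟨ zs ⟩[ f , g x ] ≤ M) xs →
               c * ⟨ zs ⟩[ f , superpose g xs ] ≤ length xs * M
    gram-row c M f {xs} h = begin
      c * ⟨ zs ⟩[ f , superpose g xs ]             ≡⟨ cong (c *_) (superpose-inner f xs) ⟩
      c * ∑ xs (λ x → ⟨ zs ⟩[ f , g x ])           ≡⟨ ≡-sym (∑-* xs c _) ⟩
      ∑ xs (λ x → c * ⟨ zs ⟩[ f , g x ])           ≤⟨ ∑-upper M h ⟩
      length xs * M                               ∎
      where open ≤-Reasoning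

    gram-cross : ∀ c M {xs ys} → All (λ x → All (λ y → c * ⟨ zs ⟩[ g x , g y ] ≤ M) ys) xs →
                 c * ⟨ zs ⟩[ superpose g xs , superpose g ys ] ≤ length xs * length ys * M
    gram-cross c M {xs} {ys} h = begin
      c * ⟨ zs ⟩[ superpose g xs , superpose g ys ]
        ≡⟨ cong (c *_) (∑-cong zs (λ z → *-comm (superpose g xs z) (superpose g ys z))) ⟩
      c * ⟨ zs ⟩[ superpose g ys , superpose g xs ]
        ≤⟨ gram-row c (length ys * M) (superpose g ys) (All.map (λ {x} q → ≤-trans (≤-reflexive (cong (c *_) (∑-cong zs (λ z → *-comm (superpose g ys z) (g x z))))) (gram-row c M (g x) q)) h) ⟩
      length xs * (length ys * M)                 ≡⟨ ≡-sym (*-assoc (length xs) (length ys) M) ⟩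
      length xs * length ys * M                   ∎
      where open ≤-Reasoning

    -- Expansion of the square of a sum. The factor `c` clears the denominator of codegree bounds
    -- such as 2 C̄ ≤ n + 4; the diagonal is the only place for the cruder bound `m`, and it
    -- contributes linearly in the length.
    gram-self : ∀ c M m {xs} → (∀ x → ⟨ zs ⟩[ g x , g x ] ≤ m) → AllPairs (λ x y → c * ⟨ zs ⟩[ g x , g y ] ≤ M) xs →
                c * ⟨ zs ⟩[ superpose g xs , superpose g xs ] ≤ length xs * length xs * M + c * length xs * m
    gram-self c M m diag [] = ≤-trans (≤-reflexive (trans (cong (c *_) (trans (∑-const zs 0) (*-zeroʳ (length zs)))) (*-zeroʳ c))) z≤n
    gram-self c M m {x ∷ xs} diag (h ∷ hs) =
      step (length xs) ⟨ zs ⟩[ g x , g x ] ⟨ zs ⟩[ g x , superpose g xs ] ⟨ zs ⟩[ superpose g xs , superpose g xs ]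
           expand (diag x) (gram-row c M (g x) h) (gram-self c M m diag hs)
      where
      sq : ∀ a b → (a + b) * (a + b) ≡ a * a + (2 * (a * b) + b * b)
      sq = solve-∀
      expand : ⟨ zs ⟩[ superpose g (x ∷ xs) , superpose g (x ∷ xs) ] ≡
               ⟨ zs ⟩[ g x , g x ] + (2 * ⟨ zs ⟩[ g x , superpose g xs ] + ⟨ zs ⟩[ superpose g xs , superpose g xs ])
      expand = trans (∑-cong zs (λ z → sq (g x z) (superpose g xs z)))
              (trans (∑-+ zs _ _) (cong (⟨ zs ⟩[ g x , g x ] +_) (trans (∑-+ zs _ _)
                (cong (_+ ⟨ zs ⟩[ superpose g xs , superpose g xs ]) (∑-* zs 2 _)))))
      step : ∀ k s r t {q} → q ≡ s + (2 * r + t) → s ≤ m → c * r ≤ k * M → c * t ≤ k * k * M + c * k * m →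
             c * q ≤ suc k * suc k * M + c * suc k * m
      step k s r t refl s≤ r≤ t≤ = from (c * (s + (2 * r + t))) (suc k * suc k * M + c * suc k * m) M
        (c ⊗ s≤ ⊕ 2 ⊗ r≤ ⊕ t≤) (eq c k M m s r t)
        where
        eq : ∀ c k M m s r t → c * (s + (2 * r + t)) + (c * m + (2 * (k * M) + (k * k * M + c * k * m))) + M
             ≡ (1 + k) * (1 + k) * M + c * (1 + k) * m + (c * s + (2 * (c * r) + c * t))
        eq = solve-∀

  -- Squares behind the pointwise inequalities

  complement-square : ∀ {v w k} → v + w ≡ k → v * v + 2 * (k * w) ≡ k * k + w * w
  complement-square {v} {w} refl = eq v w
    where
    eq : ∀ v w → v * v + 2 * ((v + w) * w) ≡ (v + w) * (v + w) + w * w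
    eq = solve-∀

  -- With w = k − v the difference of the two sides is (w₁ + w₂ − k)², and (w₁ + w₂ + w₃ − k)² in three-cover.
  two-cover : ∀ {k v₁ w₁ v₂ w₂} → v₁ + w₁ ≡ k → v₂ + w₂ ≡ k →
              k * k ≤ v₁ * v₁ + v₂ * v₂ + 2 * (w₁ * w₂)
  two-cover {k} {v₁} {w₁} {v₂} {w₂} e₁ e₂ =
    from (k * k) (v₁ * v₁ + v₂ * v₂ + 2 * (w₁ * w₂)) 0
      (2xy≤x²+y² (w₁ + w₂) k ⊕ ≤-reflexive (≡-sym (complement-square {v₁} {w₁} e₁)) ⊕ ≤-reflexive (≡-sym (complement-square {v₂} {w₂} e₂)))
      (eq k v₁ w₁ v₂ w₂)
    where
    eq : ∀ k v₁ w₁ v₂ w₂ →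
         k * k + ((w₁ + w₂) * (w₁ + w₂) + k * k + (v₁ * v₁ + 2 * (k * w₁) + (v₂ * v₂ + 2 * (k * w₂)))) + 0
         ≡ v₁ * v₁ + v₂ * v₂ + 2 * (w₁ * w₂) + (2 * ((w₁ + w₂) * k) + (k * k + w₁ * w₁ + (k * k + w₂ * w₂)))
    eq = solve-∀

  three-cover : ∀ {k v₁ w₁ v₂ w₂ v₃ w₃} → v₁ + w₁ ≡ k → v₂ + w₂ ≡ k → v₃ + w₃ ≡ k →
                2 * (k * k) ≤ v₁ * v₁ + v₂ * v₂ + v₃ * v₃ + 2 * (w₁ * w₂ + w₁ * w₃ + w₂ * w₃)
  three-cover {k} {v₁} {w₁} {v₂} {w₂} {v₃} {w₃} e₁ e₂ e₃ =
    from (2 * (k * k)) (v₁ * v₁ + v₂ * v₂ + v₃ * v₃ + 2 * (w₁ * w₂ + w₁ * w₃ + w₂ * w₃)) 0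
      (2xy≤x²+y² (w₁ + w₂ + w₃) k ⊕ ≤-reflexive (≡-sym (complement-square {v₁} {w₁} e₁))
        ⊕ ≤-reflexive (≡-sym (complement-square {v₂} {w₂} e₂)) ⊕ ≤-reflexive (≡-sym (complement-square {v₃} {w₃} e₃)))
      (eq k v₁ w₁ v₂ w₂ v₃ w₃)
    where
    eq : ∀ k v₁ w₁ v₂ w₂ v₃ w₃ →
         2 * (k * k) + ((w₁ + w₂ + w₃) * (w₁ + w₂ + w₃) + k * k
           + (v₁ * v₁ + 2 * (k * w₁) + (v₂ * v₂ + 2 * (k * w₂) + (v₃ * v₃ + 2 * (k * w₃))))) + 0
         ≡ v₁ * v₁ + v₂ * v₂ + v₃ * v₃ + 2 * (w₁ * w₂ + w₁ * w₃ + w₂ * w₃)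
           + (2 * ((w₁ + w₂ + w₃) * k) + (k * k + w₁ * w₁ + (k * k + w₂ * w₂ + (k * k + w₃ * w₃))))
    eq = solve-∀

  -- (12 (v₁ + v₂) − 17 m)² ≥ 0
  two-cliques : ∀ {m v₁ w₁ v₂ w₂} → v₁ + w₁ ≡ m → v₂ + w₂ ≡ m →
                120 * (m * (v₁ + v₂)) ≤ 144 * (w₁ * w₁ + w₂ * w₂ + 2 * (v₁ * v₂)) + m * m
  two-cliques {m} {v₁} {w₁} {v₂} {w₂} e₁ e₂ =
    from (120 * (m * (v₁ + v₂))) (144 * (w₁ * w₁ + w₂ * w₂ + 2 * (v₁ * v₂)) + m * m) 0
      (2xy≤x²+y² (12 * (v₁ + v₂)) (17 * m)
        ⊕ 144 ⊗ (≤-reflexive (≡-sym (complement-square {w₁} {v₁} (trans (+-comm w₁ v₁) e₁)))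
        ⊕ ≤-reflexive (≡-sym (complement-square {w₂} {v₂} (trans (+-comm w₂ v₂) e₂)))))
      (eq m v₁ w₁ v₂ w₂)
    where
    eq : ∀ m v₁ w₁ v₂ w₂ →
         120 * (m * (v₁ + v₂)) + (12 * (v₁ + v₂) * (12 * (v₁ + v₂)) + 17 * m * (17 * m)
           + 144 * (w₁ * w₁ + 2 * (m * v₁) + (w₂ * w₂ + 2 * (m * v₂)))) + 0
         ≡ 144 * (w₁ * w₁ + w₂ * w₂ + 2 * (v₁ * v₂)) + m * m
           + (2 * (12 * (v₁ + v₂) * (17 * m)) + 144 * (m * m + v₁ * v₁ + (m * m + v₂ * v₂)))
    eq = solve-∀

  -- (w₁ + 2 M (w₁ + w₂ − k))² ≥ 0
  near-partition : ∀ M {k v₁ w₁ v₂ w₂} → v₁ + w₁ ≡ k → v₂ + w₂ ≡ k →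
                   4 * M * (k * v₁) + 4 * (M * M) * (k * k) ≤
                   4 * M * (v₁ * v₁) + 4 * M * (w₁ * w₂) + 4 * (M * M) * (v₁ * v₁ + v₂ * v₂ + 2 * (w₁ * w₂)) + w₁ * w₁
  near-partition M {k} {v₁} {w₁} {v₂} {w₂} e₁ e₂ =
    from (4 * M * (k * v₁) + 4 * (M * M) * (k * k))
         (4 * M * (v₁ * v₁) + 4 * M * (w₁ * w₂) + 4 * (M * M) * (v₁ * v₁ + v₂ * v₂ + 2 * (w₁ * w₂)) + w₁ * w₁) 0
      (2xy≤x²+y² (w₁ + 2 * M * (w₁ + w₂)) (2 * M * k)
        ⊕ 4 * (M * M) ⊗ (≤-reflexive (≡-sym (complement-square {v₁} {w₁} e₁)) ⊕ ≤-reflexive (≡-sym (complement-square {v₂} {w₂} e₂)))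
        ⊕ 4 * M ⊗ (≤-reflexive (≡-sym (complement-square {v₁} {w₁} e₁)))
        ⊕ 4 * M * k ⊗ ≤-reflexive e₁)
      (eq M k v₁ w₁ v₂ w₂)
    where
    eq : ∀ M k v₁ w₁ v₂ w₂ →
         4 * M * (k * v₁) + 4 * (M * M) * (k * k) +
         ((w₁ + 2 * M * (w₁ + w₂)) * (w₁ + 2 * M * (w₁ + w₂)) + 2 * M * k * (2 * M * k)
          + (4 * (M * M) * (v₁ * v₁ + 2 * (k * w₁) + (v₂ * v₂ + 2 * (k * w₂)))
          + (4 * M * (v₁ * v₁ + 2 * (k * w₁)) + 4 * M * k * k))) + 0
         ≡ 4 * M * (v₁ * v₁) + 4 * M * (w₁ * w₂) + 4 * (M * M) * (v₁ * v₁ + v₂ * v₂ + 2 * (w₁ * w₂)) + w₁ * w₁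
         + (2 * ((w₁ + 2 * M * (w₁ + w₂)) * (2 * M * k)) + (4 * (M * M) * (k * k + w₁ * w₁ + (k * k + w₂ * w₂))
          + (4 * M * (k * k + w₁ * w₁) + 4 * M * k * (v₁ + w₁))))
    eq = solve-∀

  absurd-≤0 : ∀ {x} → 1 ≤ x → x ≤ 0 → ⊥
  absurd-≤0 (s≤s _) ()

  -- Adjacency functions, degrees and codegrees

  module Counting {n : ℕ} (G : Graph n) where

    vertices : List (Fin n)
    vertices = allFin n

    length-vertices : length vertices ≡ n
    length-vertices = length-tabulate id

    E F : Fin n → Fin n → Set
    E u v = T (adj G u v)
    F u v = T (compAdj G u v)

    E? : ∀ u v → Dec (E u v)
    E? u v = T? (adj G u v)

    F? : ∀ u v → Dec (F u v)
    F? u v = T? (compAdj G u v)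

    A Ā : Fin n → Fin n → ℕ
    A u v = ind (adj G u v)
    Ā u v = ind (not (adj G u v))

    d : Fin n → ℕ
    d u = ∑ vertices (A u)

    C C̄ : Fin n → Fin n → ℕ
    C u v = ⟨ vertices ⟩[ A u , A v ]
    C̄ u v = ⟨ vertices ⟩[ Ā u , Ā v ]

    W V : List (Fin n) → Fin n → ℕ
    W = superpose A
    V = superpose Ā

    ‖_‖² : (Fin n → ℕ) → ℕ
    ‖ f ‖² = ⟨ vertices ⟩[ f , f ]

    Ā+A : ∀ u v → Ā u v + A u v ≡ 1
    Ā+A u v with adj G u v
    ... | true  = refl
    ... | false = refl

    V+W : ∀ {k} P → length P ≡ k → ∀ z → V P z + W P z ≡ k
    V+W P refl z = trans (≡-sym (∑-+ P (λ p → Ā p z) (λ p → A p z)))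
                   (trans (∑-cong P (λ p → Ā+A p z)) (trans (∑-const P 1) (*-identityʳ (length P))))

    ∑-vertices-const : ∀ c → ∑ vertices (λ _ → c) ≡ n * c
    ∑-vertices-const c = trans (∑-const vertices c) (cong (_* c) length-vertices)

    ind-inner≤n : ∀ (p q : Fin n → Bool) → ⟨ vertices ⟩[ (λ z → ind (p z)) , (λ z → ind (q z)) ] ≤ n
    ind-inner≤n p q = ≤-trans (∑-mono vertices (λ z → *-mono-≤ (ind≤1 (p z)) (ind≤1 (q z))))
                              (≤-reflexive (trans (∑-vertices-const 1) (*-identityʳ n)))

    d≤n : ∀ u → d u ≤ n
    d≤n u = ≤-trans (∑-mono vertices (λ z → ind≤1 (adj G u z))) (≤-reflexive (trans (∑-vertices-const 1) (*-identityʳ n)))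

    ∑W : ∀ zs P → ∑ zs (W P) ≡ ∑ P (λ p → ∑ zs (A p))
    ∑W zs P = ∑-swap zs P (λ z p → A p z)

    ∑V+∑W : ∀ {k} zs P → length P ≡ k → ∑ zs (V P) + ∑ P (λ p → ∑ zs (A p)) ≡ length zs * k
    ∑V+∑W {k} zs P l = trans (cong (∑ zs (V P) +_) (≡-sym (∑W zs P)))
      (trans (≡-sym (∑-+ zs (V P) (W P))) (trans (∑-cong zs (V+W P l)) (∑-const zs k)))

    ∑V+∑d : ∀ {k} P → length P ≡ k → ∑ vertices (V P) + ∑ P d ≡ n * k
    ∑V+∑d {k} P l = trans (∑V+∑W vertices P l) (cong (_* k) length-vertices)

    -- The tangent to v² at v = 17 k / 24, that is (24 v - 17 k)² ≥ 0. The point lies close to k /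
    -- √2, the largest root mean square of `V P` over all vertices that independence allows up to
    -- lower order, so little is lost; and 17/24 = 1 - 7/24 matches the bound on low degrees.
    tangent : ∀ {k} P → length P ≡ k → ∀ zs → 816 * (k * ∑ zs (V P)) ≤ 576 * ⟨ zs ⟩[ V P , V P ] + length zs * (289 * (k * k))
    tangent {k} P l zs = begin
      816 * (k * ∑ zs (V P))                          ≡⟨ cong (816 *_) (≡-sym (∑-* zs k (V P))) ⟩
      816 * ∑ zs (λ z → k * V P z)                    ≡⟨ ≡-sym (∑-* zs 816 _) ⟩
      ∑ zs (λ z → 816 * (k * V P z))                  ≤⟨ ∑-mono zs (λ z → pointwise (V P z)) ⟩
      ∑ zs (λ z → 576 * (V P z * V P z) + 289 * (k * k)) ≡⟨ ∑-+ zs _ _ ⟩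
      ∑ zs (λ z → 576 * (V P z * V P z)) + ∑ zs (λ _ → 289 * (k * k)) ≡⟨ cong₂ _+_ (∑-* zs 576 _) (∑-const zs _) ⟩
      576 * ⟨ zs ⟩[ V P , V P ] + length zs * (289 * (k * k)) ∎
      where
      open ≤-Reasoning
      pointwise : ∀ v → 816 * (k * v) ≤ 576 * (v * v) + 289 * (k * k)
      pointwise v = from (816 * (k * v)) (576 * (v * v) + 289 * (k * k)) 0 (2xy≤x²+y² (24 * v) (17 * k)) (eq k v)
        where
        eq : ∀ k v → 816 * (k * v) + (24 * v * (24 * v) + 17 * k * (17 * k)) + 0 ≡ 576 * (v * v) + 289 * (k * k) + 2 * (24 * v * (17 * k))
        eq = solve-∀

  -- C̄ u v also counts u and v, hence the 4.
  record Bookless {n : ℕ} (G : Graph n) (N b : ℕ) : Set where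
    open Counting G
    field
      edge-book    : ∀ u v → E u v → C u v ≤ b
      nonedge-book : ∀ u v → F u v → 2 * C̄ u v ≤ n + 4
      N≥1          : 1 ≤ N
      b-bound      : 12 * (N * b) + n ≤ N * n

    12b≤n : 12 * b ≤ n
    12b≤n = *-cancelˡ-≤ N {{>-nonZero N≥1}} (from (N * (12 * b)) (N * n) n b-bound (eq N b n))
      where
      eq : ∀ N b n → N * (12 * b) + N * n + n ≡ N * n + (12 * (N * b) + n)
      eq = solve-∀

  -- Low and high vertices; norms of homogeneous lists

  module Estimates {n : ℕ} (G : Graph n) {N b : ℕ} (bookless : Bookless G N b) where
    open Counting G public
    open Bookless bookless public

    -- 1/√12 < 7/24 < 1 − 1/√2: the first inequality excludes cliques among the high vertices,
    -- the second one independent sets among the low vertices.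
    Low High : Fin n → Set
    Low u  = 24 * d u ≤ 7 * n
    High u = ¬ Low u

    independent-norm : ∀ {k P} → length P ≡ k → AllPairs F P → 2 * ‖ V P ‖² ≤ k * k * (n + 4) + 2 * k * n
    independent-norm {P = P} refl h = gram-self vertices Ā 2 (n + 4) n (λ x → ind-inner≤n (λ z → not (adj G x z)) (λ z → not (adj G x z)))
      (AllPairs.map (λ {x} {y} → nonedge-book x y) h)

    clique-norm : ∀ {m Q} → length Q ≡ m → AllPairs E Q → ‖ W Q ‖² ≤ m * m * b + m * n
    clique-norm {Q = Q} refl h = from ‖ W Q ‖² (length Q * length Q * b + length Q * n) 0
      (gram-self vertices A 1 b n (λ x → ind-inner≤n (adj G x) (adj G x))
        (AllPairs.map (λ {x} {y} e → ≤-trans (≤-reflexive (*-identityˡ (C x y))) (edge-book x y e)) h))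
      (eq ‖ W Q ‖² (length Q) b n)
      where
      eq : ∀ w k b n → w + (k * k * b + 1 * k * n) + 0 ≡ k * k * b + k * n + 1 * w
      eq = solve-∀

    joined-inner : ∀ {k P P′} B → length P ≡ k → length P′ ≡ k → All (λ p → All (λ p′ → C p p′ ≤ B) P′) P →
                   ⟨ vertices ⟩[ W P , W P′ ] ≤ k * k * B
    joined-inner {P = P} {P′} B refl l h = subst (λ z → ⟨ vertices ⟩[ W P , W P′ ] ≤ length P * z * B) l
      (≤-trans (≤-reflexive (≡-sym (*-identityˡ _)))
        (gram-cross vertices A 1 B (All.map (All.map (λ q → ≤-trans (≤-reflexive (*-identityˡ _)) q)) h)))

    disjoint-inner : ∀ {k P P′} → length P ≡ k → length P′ ≡ k → All (λ p → All (F p) P′) P →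
                     2 * ⟨ vertices ⟩[ V P , V P′ ] ≤ k * k * (n + 4)
    disjoint-inner {P = P} {P′} refl l h = subst (λ z → 2 * ⟨ vertices ⟩[ V P , V P′ ] ≤ length P * z * (n + 4)) l
      (gram-cross vertices Ā 2 (n + 4) (All.map (λ {p} → All.map (λ {p′} → nonedge-book p p′)) h))

    -- Low degrees put the average of `V P` at 17 k / 24 or more, so ‖V P‖² is at least (289/576) k²
    -- n, while independence allows (288/576) k² n + 2 k² + k n. The sizes 2000 and 4000 keep the
    -- error below the margin k² n / 576.
    low-not-independent : ∀ {k P} → length P ≡ k → AllPairs F P → All Low P → 2000 ≤ k → 4000 ≤ n → ⊥
    low-not-independent {k} {P} l indep low k≥ n≥ =
      arith k n (∑ vertices (V P)) (∑ P d) ‖ V P ‖²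
        (subst (λ z → 816 * (k * ∑ vertices (V P)) ≤ 576 * ‖ V P ‖² + z * (289 * (k * k))) length-vertices (tangent P l vertices))
        (∑V+∑d P l)
        (≤-trans (≤-reflexive (≡-sym (∑-* P 24 d))) (subst (λ z → ∑ P (λ p → 24 * d p) ≤ z * (7 * n)) l (∑-upper (7 * n) low)))
        (independent-norm l indep) k≥ n≥
      where
      arith : ∀ k n S D Q → 816 * (k * S) ≤ 576 * Q + n * (289 * (k * k)) → S + D ≡ n * k → 24 * D ≤ k * (7 * n) →
              2 * Q ≤ k * k * (n + 4) + 2 * k * n → 2000 ≤ k → 4000 ≤ n → ⊥
      arith k n S D Q h₁ h₂ h₃ h₄ k≥ n≥ = absurd-≤0
        (*-mono-≤ k≥1 k≥1)
        (from (k * k) 0 (1695 * (k * k) + 848 * (k * n))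
          (2 ⊗ h₁ ⊕ 1632 * k ⊗ ≤-reflexive (≡-sym h₂) ⊕ 68 * k ⊗ h₃ ⊕ 576 ⊗ h₄ ⊕ k * k ⊗ n≥ ⊕ k * n ⊗ k≥) (eq k n S D Q))
        where
        k≥1 : 1 ≤ k
        k≥1 = ≤-trans (s≤s z≤n) k≥
        eq : ∀ k n S D Q → k * k + (2 * (576 * Q + n * (289 * (k * k))) + (1632 * k * (S + D) + (68 * k * (k * (7 * n)) + (576 * (k * k * (n + 4) + 2 * k * n) + (k * k * n + k * n * k))))) + (1695 * (k * k) + 848 * (k * n))
             ≡ 0 + (2 * (816 * (k * S)) + (1632 * k * (n * k) + (68 * k * (24 * D) + (576 * (2 * Q) + (k * k * 4000 + k * n * 2000)))))
        eq = solve-∀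

  -- Forbidden configurations of cliques and independent lists

  module Configurations {n : ℕ} (G : Graph n) {N b : ℕ} (bookless : Bookless G N b) where
    open Estimates G bookless public

    ∑-vertices-mono : ∀ {f : Fin n → ℕ} c → (∀ z → c ≤ f z) → n * c ≤ ∑ vertices f
    ∑-vertices-mono c h = ≤-trans (≤-reflexive (≡-sym (∑-vertices-const c))) (∑-mono vertices h)

    -- The tangent to w² at w = 7 m / 24 gives ‖W Q‖² ≥ (49/576) m² n, whereas codegrees of at most
    -- n / 12 = 48 n / 576 allow no more than (48/576) m² n + m n.
    high-not-clique : ∀ {m Q} → length Q ≡ m → AllPairs E Q → All High Q → 2000 ≤ m → 1 ≤ n → ⊥
    high-not-clique {m} {Q} l clique high m≥ n≥ =
      arith m n b (∑ Q d) ‖ W Q ‖² tangent-W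
        (≤-trans (subst (λ z → z * (7 * n) ≤ ∑ Q (λ p → 24 * d p)) l (∑-lower (7 * n) (All.map (λ h → <⇒≤ (≰⇒> h)) high))) (≤-reflexive (∑-* Q 24 d)))
        (clique-norm l clique) 12b≤n m≥ n≥
      where
      pointwise : ∀ w → 336 * (m * w) ≤ 576 * (w * w) + 49 * (m * m)
      pointwise w = from (336 * (m * w)) (576 * (w * w) + 49 * (m * m)) 0 (2xy≤x²+y² (24 * w) (7 * m)) (eq m w)
        where
        eq : ∀ m w → 336 * (m * w) + (24 * w * (24 * w) + 7 * m * (7 * m)) + 0 ≡ 576 * (w * w) + 49 * (m * m) + 2 * (24 * w * (7 * m))
        eq = solve-∀
      tangent-W : 336 * (m * ∑ Q d) ≤ 576 * ‖ W Q ‖² + n * (49 * (m * m))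
      tangent-W = begin
        336 * (m * ∑ Q d)                                 ≡⟨ cong (λ z → 336 * (m * z)) (≡-sym (∑W vertices Q)) ⟩
        336 * (m * ∑ vertices (W Q))                      ≡⟨ cong (336 *_) (≡-sym (∑-* vertices m (W Q))) ⟩
        336 * ∑ vertices (λ z → m * W Q z)                ≡⟨ ≡-sym (∑-* vertices 336 _) ⟩
        ∑ vertices (λ z → 336 * (m * W Q z))              ≤⟨ ∑-mono vertices (λ z → pointwise (W Q z)) ⟩
        ∑ vertices (λ z → 576 * (W Q z * W Q z) + 49 * (m * m)) ≡⟨ ∑-+ vertices _ _ ⟩
        ∑ vertices (λ z → 576 * (W Q z * W Q z)) + ∑ vertices (λ _ → 49 * (m * m)) ≡⟨ cong₂ _+_ (∑-* vertices 576 _) (∑-vertices-const _) ⟩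
        576 * ‖ W Q ‖² + n * (49 * (m * m))               ∎
        where open ≤-Reasoning
      arith : ∀ m n b S q → 336 * (m * S) ≤ 576 * q + n * (49 * (m * m)) → m * (7 * n) ≤ 24 * S →
              q ≤ m * m * b + m * n → 12 * b ≤ n → 2000 ≤ m → 1 ≤ n → ⊥
      arith m n b S q h₁ h₂ h₃ h₄ m≥ n≥ = absurd-≤0
        (*-mono-≤ m≥1 n≥)
        (from (m * n) 0 (1423 * (m * n))
          (h₁ ⊕ 14 * m ⊗ h₂ ⊕ 576 ⊗ h₃ ⊕ 48 * (m * m) ⊗ h₄ ⊕ m * n ⊗ m≥) (eq m n b S q))
        where
        m≥1 : 1 ≤ m
        m≥1 = ≤-trans (s≤s z≤n) m≥
        eq : ∀ m n b S q → m * n + (576 * q + n * (49 * (m * m)) + (14 * m * (24 * S) + (576 * (m * m * b + m * n) + (48 * (m * m) * n + m * n * m)))) + 1423 * (m * n)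
             ≡ 0 + (336 * (m * S) + (14 * m * (m * (7 * n)) + (576 * q + (48 * (m * m) * (12 * b) + m * n * 2000))))
        eq = solve-∀

    -- (2 − 7/12)² > 2 (1 − 7/12) + 1/6 + 1
    low-cliques-not-disjoint : ∀ {m Q Q′} → length Q ≡ m → length Q′ ≡ m → AllPairs E Q → AllPairs E Q′ →
      All Low Q → All Low Q′ → All (λ p → All (F p) Q′) Q → 2000 ≤ m → 4000 ≤ n → ⊥
    low-cliques-not-disjoint {m} {Q} {Q′} l l′ clique clique′ low low′ cross m≥ n≥ =
      arith m n b (∑ vertices (V Q)) (∑ vertices (V Q′)) (∑ Q d) (∑ Q′ d) ‖ W Q ‖² ‖ W Q′ ‖² ⟨ vertices ⟩[ V Q , V Q′ ]
        summed (∑V+∑d Q l) (∑V+∑d Q′ l′) (low-sum l low) (low-sum l′ low′) (clique-norm l clique) (clique-norm l′ clique′)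
        (disjoint-inner l l′ cross) 12b≤n m≥ n≥
      where
      low-sum : ∀ {P} → length P ≡ m → All Low P → 24 * ∑ P d ≤ m * (7 * n)
      low-sum {P} refl h = ≤-trans (≤-reflexive (≡-sym (∑-* P 24 d))) (∑-upper (7 * n) h)
      summed : 120 * (m * (∑ vertices (V Q) + ∑ vertices (V Q′))) ≤
               144 * (‖ W Q ‖² + ‖ W Q′ ‖² + 2 * ⟨ vertices ⟩[ V Q , V Q′ ]) + n * (m * m)
      summed = begin
        120 * (m * (∑ vertices (V Q) + ∑ vertices (V Q′)))
          ≡⟨ cong (λ z → 120 * (m * z)) (≡-sym (∑-+ vertices (V Q) (V Q′))) ⟩
        120 * (m * ∑ vertices (λ z → V Q z + V Q′ z))   ≡⟨ cong (120 *_) (≡-sym (∑-* vertices m _)) ⟩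
        120 * ∑ vertices (λ z → m * (V Q z + V Q′ z))   ≡⟨ ≡-sym (∑-* vertices 120 _) ⟩
        ∑ vertices (λ z → 120 * (m * (V Q z + V Q′ z))) ≤⟨ ∑-mono vertices (λ z → two-cliques {v₁ = V Q z} {v₂ = V Q′ z} (V+W Q l z) (V+W Q′ l′ z)) ⟩
        ∑ vertices (λ z → 144 * (W Q z * W Q z + W Q′ z * W Q′ z + 2 * (V Q z * V Q′ z)) + m * m) ≡⟨ ∑-+ vertices _ _ ⟩
        ∑ vertices (λ z → 144 * (W Q z * W Q z + W Q′ z * W Q′ z + 2 * (V Q z * V Q′ z))) + ∑ vertices (λ _ → m * m)
          ≡⟨ cong₂ _+_ (∑-* vertices 144 _) (∑-vertices-const _) ⟩
        144 * ∑ vertices (λ z → W Q z * W Q z + W Q′ z * W Q′ z + 2 * (V Q z * V Q′ z)) + n * (m * m)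
          ≡⟨ cong (λ z → 144 * z + n * (m * m)) (trans (∑-+ vertices _ _) (cong₂ _+_ (∑-+ vertices _ _) (∑-* vertices 2 _))) ⟩
        144 * (‖ W Q ‖² + ‖ W Q′ ‖² + 2 * ⟨ vertices ⟩[ V Q , V Q′ ]) + n * (m * m) ∎
        where open ≤-Reasoning
      arith : ∀ m n b S S′ D D′ q q′ x → 120 * (m * (S + S′)) ≤ 144 * (q + q′ + 2 * x) + n * (m * m) →
              S + D ≡ n * m → S′ + D′ ≡ n * m → 24 * D ≤ m * (7 * n) → 24 * D′ ≤ m * (7 * n) →
              q ≤ m * m * b + m * n → q′ ≤ m * m * b + m * n → 2 * x ≤ m * m * (n + 4) → 12 * b ≤ n → 2000 ≤ m → 4000 ≤ n → ⊥
      arith m n b S S′ D D′ q q′ x h₁ h₂ h₂′ h₃ h₃′ h₄ h₄′ h₅ h₆ m≥ n≥ = absurd-≤0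
        (*-mono-≤ m≥1 m≥1)
        (from (m * m) 0 (2847 * (m * m) + 1424 * (m * n))
          (2 ⊗ h₁ ⊕ 240 * m ⊗ (≤-reflexive (≡-sym h₂) ⊕ ≤-reflexive (≡-sym h₂′)) ⊕ 10 * m ⊗ (h₃ ⊕ h₃′)
            ⊕ 288 ⊗ (h₄ ⊕ h₄′ ⊕ h₅) ⊕ 48 * (m * m) ⊗ h₆ ⊕ m * n ⊗ m≥ ⊕ m * m ⊗ n≥)
          (eq m n b S S′ D D′ q q′ x))
        where
        m≥1 : 1 ≤ m
        m≥1 = ≤-trans (s≤s z≤n) m≥
        eq : ∀ m n b S S′ D D′ q q′ x →
             m * m + (2 * (144 * (q + q′ + 2 * x) + n * (m * m)) + (240 * m * (S + D + (S′ + D′)) + (10 * m * (m * (7 * n) + m * (7 * n))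
               + (288 * (m * m * b + m * n + (m * m * b + m * n + m * m * (n + 4))) + (48 * (m * m) * n + (m * n * m + m * m * n)))))) + (2847 * (m * m) + 1424 * (m * n))
             ≡ 0 + (2 * (120 * (m * (S + S′))) + (240 * m * (n * m + n * m) + (10 * m * (24 * D + 24 * D′)
               + (288 * (q + (q′ + 2 * x)) + (48 * (m * m) * (12 * b) + (m * n * 2000 + m * m * 4000))))))
        eq = solve-∀

    -- Summing `three-cover` gives 2 k² n ≤ 3 (k² n / 2 + 2 k² + k n) + 6 k² b. The gap n / (12 N)
    -- between b and n / 12 turns this into k² n / (2 N) ≤ 6 k² + 3 k n. For k = 12 N the left side
    -- is 6 k n, so n ≤ 2 k = 24 N.
    no-triple : ∀ {P₁ P₂ P₃} → length P₁ ≡ 12 * N → length P₂ ≡ 12 * N → length P₃ ≡ 12 * N →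
      AllPairs F P₁ → AllPairs F P₂ → AllPairs F P₃ →
      All (λ p → All (E p) P₂) P₁ → All (λ p → All (E p) P₃) P₁ → All (λ p → All (E p) P₃) P₂ → 24 * N < n → ⊥
    no-triple {P₁} {P₂} {P₃} l₁ l₂ l₃ i₁ i₂ i₃ c₁₂ c₁₃ c₂₃ n> =
      arith N n b ‖ V P₁ ‖² ‖ V P₂ ‖² ‖ V P₃ ‖² ⟨ vertices ⟩[ W P₁ , W P₂ ] ⟨ vertices ⟩[ W P₁ , W P₃ ] ⟨ vertices ⟩[ W P₂ , W P₃ ]
        summed (independent-norm l₁ i₁) (independent-norm l₂ i₂) (independent-norm l₃ i₃)
        (joined l₁ l₂ c₁₂) (joined l₁ l₃ c₁₃) (joined l₂ l₃ c₂₃) b-bound N≥1 n>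
      where
      k : ℕ
      k = 12 * N
      joined : ∀ {P P′} → length P ≡ k → length P′ ≡ k → All (λ p → All (E p) P′) P → ⟨ vertices ⟩[ W P , W P′ ] ≤ k * k * b
      joined l l′ h = joined-inner b l l′ (All.map (λ {p} → All.map (λ {p′} → edge-book p p′)) h)
      summed : n * (2 * (k * k)) ≤ ‖ V P₁ ‖² + ‖ V P₂ ‖² + ‖ V P₃ ‖²
        + 2 * (⟨ vertices ⟩[ W P₁ , W P₂ ] + ⟨ vertices ⟩[ W P₁ , W P₃ ] + ⟨ vertices ⟩[ W P₂ , W P₃ ])
      summed = ≤-trans (∑-vertices-mono (2 * (k * k)) (λ z →
          three-cover {v₁ = V P₁ z} {v₂ = V P₂ z} {v₃ = V P₃ z} (V+W P₁ l₁ z) (V+W P₂ l₂ z) (V+W P₃ l₃ z)))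
        (≤-reflexive (trans (∑-+ vertices _ _) (cong₂ _+_
          (trans (∑-+ vertices _ _) (cong (_+ ‖ V P₃ ‖²) (∑-+ vertices _ _)))
          (trans (∑-* vertices 2 _) (cong (2 *_) (trans (∑-+ vertices _ _) (cong (_+ ⟨ vertices ⟩[ W P₂ , W P₃ ]) (∑-+ vertices _ _))))))))
      arith : ∀ N n b q₁ q₂ q₃ x₁ x₂ x₃ → let k = 12 * N in
              n * (2 * (k * k)) ≤ q₁ + q₂ + q₃ + 2 * (x₁ + x₂ + x₃) →
              2 * q₁ ≤ k * k * (n + 4) + 2 * k * n → 2 * q₂ ≤ k * k * (n + 4) + 2 * k * n → 2 * q₃ ≤ k * k * (n + 4) + 2 * k * n →
              x₁ ≤ k * k * b → x₂ ≤ k * k * b → x₃ ≤ k * k * b → 12 * (N * b) + n ≤ N * n → 1 ≤ N → 1 + 24 * N ≤ n → ⊥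
      arith N n b q₁ q₂ q₃ x₁ x₂ x₃ h q₁≤ q₂≤ q₃≤ x₁≤ x₂≤ x₃≤ hb N≥ n> = absurd-≤0
        (*-mono-≤ (*-mono-≤ (s≤s (z≤n {11})) N≥) (*-mono-≤ (s≤s (z≤n {11})) N≥))
        (from (12 * N * (12 * N)) 0 0
          (4 * N ⊗ h ⊕ 2 * N ⊗ (q₁≤ ⊕ q₂≤ ⊕ q₃≤) ⊕ 8 * N ⊗ (x₁≤ ⊕ x₂≤ ⊕ x₃≤) ⊕ 288 * (N * N) ⊗ hb ⊕ 144 * (N * N) ⊗ n>)
          (eq N n b q₁ q₂ q₃ x₁ x₂ x₃))
        where
        eq : ∀ N n b q₁ q₂ q₃ x₁ x₂ x₃ →
             12 * N * (12 * N) + (4 * N * (q₁ + q₂ + q₃ + 2 * (x₁ + x₂ + x₃))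
               + (2 * N * (12 * N * (12 * N) * (n + 4) + 2 * (12 * N) * n + (12 * N * (12 * N) * (n + 4) + 2 * (12 * N) * n + (12 * N * (12 * N) * (n + 4) + 2 * (12 * N) * n)))
               + (8 * N * (12 * N * (12 * N) * b + (12 * N * (12 * N) * b + 12 * N * (12 * N) * b))
               + (288 * (N * N) * (N * n) + 144 * (N * N) * n)))) + 0
             ≡ 0 + (4 * N * (n * (2 * (12 * N * (12 * N)))) + (2 * N * (2 * q₁ + (2 * q₂ + 2 * q₃)) + (8 * N * (x₁ + (x₂ + x₃))
               + (288 * (N * N) * (12 * (N * b) + n) + 144 * (N * N) * (1 + 24 * N)))))
        eq = solve-∀

  -- Numerical comparisons for the estimates over the low vertices

  rescale : ∀ p q r s x y → .{{NonZero p}} → p * x ≤ q * y → r * q ≤ p * s → r * x ≤ s * y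
  rescale p q r s x y h c = *-cancelˡ-≤ p (begin
    p * (r * x)   ≡⟨ swap p r x ⟩
    r * (p * x)   ≤⟨ *-monoʳ-≤ r h ⟩
    r * (q * y)   ≡⟨ ≡-sym (*-assoc r q y) ⟩
    r * q * y     ≤⟨ *-monoˡ-≤ y c ⟩
    p * s * y     ≡⟨ *-assoc p s y ⟩
    p * (s * y)   ∎)
    where
    open ≤-Reasoning
    swap : ∀ p r x → p * (r * x) ≡ r * (p * x)
    swap = solve-∀

  -- Multiplied by 3, the lower bound has 1434 k² ℓ on its left, while 24/41 ≤ 1433/2448 and 2448 =
  -- 3 · 816 cap the degree term at 1433 k² ℓ. Hence k² ℓ ≤ 3456 Δ, where 3456 = 3 · 1152 and Δ
  -- collects the errors. From k = c ε, c ≤ ℓ and n ≤ ε ℓ also c Δ ≤ 4 k² ℓ, which is incompatible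
  -- with c ≥ 5 · 3456.
  joined-not-low-arith : ∀ c ε k n ℓ τ D D′ x →
    478 * (k * k * ℓ) ≤ 816 * (k * (D + D′)) + 1152 * (2 * (k * k) + k * n + x) →
    D ≤ k * τ → 41 * (D′ + k * τ) ≤ k * (24 * ℓ) → k * x ≤ k * k * n →
    k ≡ c * ε → 5 * 3456 ≤ c → 1 ≤ k → c ≤ ℓ → n ≤ ε * ℓ → ⊥
  joined-not-low-arith c ε k n ℓ τ D D′ x h D≤ D′≤ kx≤ refl c≥ k≥1 ℓ≥ n≤ =
    finish 3456 c (k * k * ℓ) Δ main (s≤s z≤n) c≥ (small c ε n ℓ x ℓ≥ n≤ x≤) Δ≥1
    where
    Δ : ℕ
    Δ = 2 * (k * k) + k * n + x
    Δ≥1 : 1 ≤ Δ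
    Δ≥1 = ≤-trans (*-mono-≤ {1} {2} (s≤s z≤n) (*-mono-≤ k≥1 k≥1)) (≤-trans (m≤m+n (2 * (k * k)) (k * n)) (m≤m+n (2 * (k * k) + k * n) x))
    x≤ : x ≤ k * n
    x≤ = *-cancelˡ-≤ k {{>-nonZero k≥1}} (≤-trans kx≤ (≤-reflexive (*-assoc k k n)))
    swap : ∀ k ℓ → k * (24 * ℓ) ≡ 24 * (k * ℓ)
    swap = solve-∀
    combine : ∀ k ℓ D Δ → 478 * (k * k * ℓ) ≤ 816 * (k * D) + 1152 * Δ → 2448 * D ≤ 1433 * (k * ℓ) → k * k * ℓ ≤ 3456 * Δ
    combine k ℓ D Δ h₁ h₂ = from (k * k * ℓ) (3456 * Δ) 0 (3 ⊗ h₁ ⊕ k ⊗ h₂) (eq k ℓ D Δ)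
      where
      eq : ∀ k ℓ D Δ → k * k * ℓ + (3 * (816 * (k * D) + 1152 * Δ) + k * (1433 * (k * ℓ))) + 0 ≡ 3456 * Δ + (3 * (478 * (k * k * ℓ)) + k * (2448 * D))
      eq = solve-∀
    main : k * k * ℓ ≤ 3456 * Δ
    main = combine k ℓ (D + D′) (2 * (k * k) + k * n + x) h
      (rescale 41 24 2448 1433 (D + D′) (k * ℓ)
        (≤-trans (*-monoʳ-≤ 41 (≤-trans (≤-reflexive (+-comm D D′)) (+-monoʳ-≤ D′ D≤))) (≤-trans D′≤ (≤-reflexive (swap k ℓ))))
        (≤ᵇ⇒≤ (2448 * 24) (41 * 1433) _))
    small : ∀ c ε n ℓ x → c ≤ ℓ → n ≤ ε * ℓ → x ≤ c * ε * n → c * (2 * (c * ε * (c * ε)) + c * ε * n + x) ≤ 4 * (c * ε * (c * ε) * ℓ)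
    small c ε n ℓ x h₁ h₂ h₃ = from (c * (2 * (c * ε * (c * ε)) + c * ε * n + x)) (4 * (c * ε * (c * ε) * ℓ)) 0
      (2 * (c * ε * (c * ε)) ⊗ h₁ ⊕ 2 * (c * (c * ε)) ⊗ h₂ ⊕ c ⊗ h₃) (eq c ε n ℓ x)
      where
      eq : ∀ c ε n ℓ x → c * (2 * (c * ε * (c * ε)) + c * ε * n + x) + (2 * (c * ε * (c * ε)) * ℓ + (2 * (c * (c * ε)) * (ε * ℓ) + c * (c * ε * n))) + 0
           ≡ 4 * (c * ε * (c * ε) * ℓ) + (2 * (c * ε * (c * ε)) * c + (2 * (c * (c * ε)) * n + c * x))
      eq = solve-∀
    finish : ∀ g c K Δ → K ≤ g * Δ → 1 ≤ g → 5 * g ≤ c → c * Δ ≤ 4 * K → 1 ≤ Δ → ⊥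
    finish g c K Δ h₁ g≥ h₂ h₃ Δ≥ = absurd-≤0 (*-mono-≤ g≥ Δ≥)
      (from (g * Δ) 0 0 (4 ⊗ h₁ ⊕ Δ ⊗ h₂ ⊕ h₃) (eq g K Δ c))
      where
      eq : ∀ g K Δ c → g * Δ + (4 * (g * Δ) + (Δ * c + 4 * K)) + 0 ≡ 0 + (4 * K + (Δ * (5 * g) + c * Δ))
      eq = solve-∀

  -- Since 26/89 ≤ 477/1632, the term ℓ k² has coefficient 1632 - 477 - 2 · 289 = 577 where 576
  -- would do. The spare ℓ k² pays for the errors 2 k² + 5 k n, which is where c ≥ 7 · (2 · 576)
  -- enters.
  low-codegree-half-arith : ∀ c ε k n ℓ β τ S D qL qB DB →
    816 * (k * S) ≤ 576 * qL + ℓ * (289 * (k * k)) → S + D ≡ ℓ * k → D ≤ k * τ → 89 * τ ≤ 26 * ℓ →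
    β * (k * k) ≤ qB + 2 * (k * DB) → k * DB ≤ k * (2 * n) → 2 * (qL + qB) ≤ k * k * (n + 4) + 2 * k * n →
    k ≡ c * ε → 7 * (2 * 576) ≤ c → 1 ≤ k → c ≤ ℓ → n ≤ ε * ℓ → 2 * β + ℓ ≤ n
  low-codegree-half-arith c ε k n ℓ β τ S D qL qB DB t s D≤ τ≤ cover kDB≤ norm refl c≥ k≥1 ℓ≥ n≤ =
    finish 576 β (k * k) ℓ n (2 * (k * k) + 5 * (k * n))
      (combine k n ℓ β τ S D qL qB DB t s D≤ (rescale 89 26 1632 477 τ ℓ τ≤ (≤ᵇ⇒≤ (1632 * 26) (89 * 477) _)) cover
        (*-cancelˡ-≤ k {{>-nonZero k≥1}} kDB≤) norm)
      (*-cancelˡ-≤ 7 (small (2 * 576) c ε n ℓ c≥ ℓ≥ n≤)) (s≤s z≤n) (*-mono-≤ k≥1 k≥1)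
    where
    combine : ∀ k n ℓ β τ S D qL qB DB → 816 * (k * S) ≤ 576 * qL + ℓ * (289 * (k * k)) → S + D ≡ ℓ * k → D ≤ k * τ → 1632 * τ ≤ 477 * ℓ →
      β * (k * k) ≤ qB + 2 * (k * DB) → DB ≤ 2 * n → 2 * (qL + qB) ≤ k * k * (n + 4) + 2 * k * n →
      2 * 576 * (β * (k * k)) + (1 + 576) * (ℓ * (k * k)) ≤ 576 * (k * k * n) + 2 * 576 * (2 * (k * k) + 5 * (k * n))
    combine k n ℓ β τ S D qL qB DB t s h₁ h₂ h₃ h₄ q =
      from (2 * 576 * (β * (k * k)) + (1 + 576) * (ℓ * (k * k))) (576 * (k * k * n) + 2 * 576 * (2 * (k * k) + 5 * (k * n))) 0
        (2 ⊗ t ⊕ 1632 * k ⊗ ≤-reflexive (≡-sym s) ⊕ 1632 * k ⊗ h₁ ⊕ k * k ⊗ h₂ ⊕ 1152 ⊗ h₃ ⊕ 2304 * k ⊗ h₄ ⊕ 576 ⊗ q)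
        (eq k n ℓ β τ S D qL qB DB)
      where
      eq : ∀ k n ℓ β τ S D qL qB DB →
        2 * 576 * (β * (k * k)) + (1 + 576) * (ℓ * (k * k)) + (2 * (576 * qL + ℓ * (289 * (k * k))) + (1632 * k * (S + D) + (1632 * k * (k * τ) + (k * k * (477 * ℓ)
          + (1152 * (qB + 2 * (k * DB)) + (2304 * k * (2 * n) + 576 * (k * k * (n + 4) + 2 * k * n))))))) + 0
        ≡ 576 * (k * k * n) + 2 * 576 * (2 * (k * k) + 5 * (k * n)) + (2 * (816 * (k * S)) + (1632 * k * (ℓ * k) + (1632 * k * D + (k * k * (1632 * τ)
          + (1152 * (β * (k * k)) + (2304 * k * DB + 576 * (2 * (qL + qB))))))))
      eq = solve-∀
    small : ∀ g c ε n ℓ → 7 * g ≤ c → c ≤ ℓ → n ≤ ε * ℓ → 7 * (g * (2 * (c * ε * (c * ε)) + 5 * (c * ε * n))) ≤ 7 * (c * ε * (c * ε) * ℓ)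
    small g c ε n ℓ h₀ h₁ h₂ = from (7 * (g * (2 * (c * ε * (c * ε)) + 5 * (c * ε * n)))) (7 * (c * ε * (c * ε) * ℓ)) 0
      ((2 * (c * ε * (c * ε)) + 5 * (c * ε * n)) ⊗ h₀ ⊕ 2 * (c * ε * (c * ε)) ⊗ h₁ ⊕ 5 * (c * (c * ε)) ⊗ h₂) (eq g c ε n ℓ)
      where
      eq : ∀ g c ε n ℓ → 7 * (g * (2 * (c * ε * (c * ε)) + 5 * (c * ε * n))) + ((2 * (c * ε * (c * ε)) + 5 * (c * ε * n)) * c + (2 * (c * ε * (c * ε)) * ℓ + 5 * (c * (c * ε)) * (ε * ℓ))) + 0
           ≡ 7 * (c * ε * (c * ε) * ℓ) + ((2 * (c * ε * (c * ε)) + 5 * (c * ε * n)) * (7 * g) + (2 * (c * ε * (c * ε)) * c + 5 * (c * (c * ε)) * n))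
      eq = solve-∀
    finish : ∀ g β K ℓ n Δ → 2 * g * (β * K) + (1 + g) * (ℓ * K) ≤ g * (K * n) + 2 * g * Δ → 2 * g * Δ ≤ K * ℓ → 1 ≤ g → 1 ≤ K → 2 * β + ℓ ≤ n
    finish g β K ℓ n Δ h₁ h₂ g≥ K≥ = *-cancelˡ-≤ (g * K) {{>-nonZero (*-mono-≤ g≥ K≥)}}
      (from (g * K * (2 * β + ℓ)) (g * K * n) 0 (h₁ ⊕ h₂) (eq g β K ℓ n Δ))
      where
      eq : ∀ g β K ℓ n Δ → g * K * (2 * β + ℓ) + (g * (K * n) + 2 * g * Δ + K * ℓ) + 0 ≡ g * K * n + (2 * g * (β * K) + (1 + g) * (ℓ * K) + 2 * g * Δ)
      eq = solve-∀

  -- Independent lists measured separately on low and high vertices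

  module Split {n : ℕ} (G : Graph n) {N b : ℕ} (bookless : Bookless G N b) where
    open Configurations G bookless public

    Low? : Decidable Low
    Low? u = 24 * d u ≤? 7 * n

    High? : Decidable High
    High? u = ¬? (Low? u)

    lows highs : List (Fin n)
    lows  = filter Low? vertices
    highs = filter High? vertices

    ℓ r : ℕ
    ℓ = length lows
    r = length highs

    ℓ+r≡n : ℓ + r ≡ n
    ℓ+r≡n = trans (#-split Low? vertices) length-vertices

    ∑-split : ∀ (f : Fin n → ℕ) → ∑ lows f + ∑ highs f ≡ ∑ vertices f
    ∑-split = ∑-filter Low? vertices

    dL : Fin n → ℕ
    dL u = ∑ lows (A u)

    -- Codegree among the high vertices only: triangles can be controlled there, and low common
    -- neighbours are added once the low vertices are known to be few.
    CR : Fin n → Fin n → ℕ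
    CR u v = ⟨ highs ⟩[ A u , A v ]

    CR-inner : ∀ {k e P P′} → length P ≡ k → length P′ ≡ k → All (λ p → All (λ p′ → e * CR p p′ ≤ n) P′) P →
               e * ⟨ highs ⟩[ W P , W P′ ] ≤ k * k * n
    CR-inner {e = e} {P} {P′} refl l h = subst (λ z → e * ⟨ highs ⟩[ W P , W P′ ] ≤ length P * z * n) l (gram-cross highs A e n h)

    -- The norms of `V P` and `V P′` are bounded below by tangents on the low vertices and by
    -- `two-cover` on the high ones, and above by independence. This leaves the coefficient 478 = 2
    -- (816 - 289) - 576, and 478/816 falls just short of 2 - √2.
    joined-lower : ∀ {k P P′} → length P ≡ k → length P′ ≡ k → AllPairs F P → AllPairs F P′ →
      478 * (k * k * ℓ) ≤ 816 * (k * (∑ P dL + ∑ P′ dL)) + 1152 * (2 * (k * k) + k * n + ⟨ highs ⟩[ W P , W P′ ])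
    joined-lower {k} {P} {P′} l l′ i i′ =
      arith k n ℓ r (∑ lows (V P)) (∑ lows (V P′)) (∑ P dL) (∑ P′ dL)
        ⟨ lows ⟩[ V P , V P ] ⟨ lows ⟩[ V P′ , V P′ ] ⟨ highs ⟩[ V P , V P ] ⟨ highs ⟩[ V P′ , V P′ ] ⟨ highs ⟩[ W P , W P′ ]
        (tangent {k} P l lows) (tangent {k} P′ l′ lows) (∑V+∑W {k} lows P l) (∑V+∑W {k} lows P′ l′) cover
        (≤-trans (≤-reflexive (cong (2 *_) (∑-split _))) (independent-norm {k} {P} l i))
        (≤-trans (≤-reflexive (cong (2 *_) (∑-split _))) (independent-norm {k} {P′} l′ i′)) ℓ+r≡n
      where
      cover : r * (k * k) ≤ ⟨ highs ⟩[ V P , V P ] + ⟨ highs ⟩[ V P′ , V P′ ] + 2 * ⟨ highs ⟩[ W P , W P′ ]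
      cover = ≤-trans (∑-lower (k * k) (All.universal (λ z → two-cover {v₁ = V P z} {v₂ = V P′ z} (V+W P l z) (V+W P′ l′ z)) highs))
        (≤-reflexive (trans (∑-+ highs _ _) (cong₂ _+_ (∑-+ highs _ _) (∑-* highs 2 _))))
      arith : ∀ k n ℓ r S S′ D D′ qL qL′ qR qR′ x →
        816 * (k * S) ≤ 576 * qL + ℓ * (289 * (k * k)) → 816 * (k * S′) ≤ 576 * qL′ + ℓ * (289 * (k * k)) →
        S + D ≡ ℓ * k → S′ + D′ ≡ ℓ * k → r * (k * k) ≤ qR + qR′ + 2 * x →
        2 * (qL + qR) ≤ k * k * (n + 4) + 2 * k * n → 2 * (qL′ + qR′) ≤ k * k * (n + 4) + 2 * k * n → ℓ + r ≡ n →
        478 * (k * k * ℓ) ≤ 816 * (k * (D + D′)) + 1152 * (2 * (k * k) + k * n + x)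
      arith k n ℓ r S S′ D D′ qL qL′ qR qR′ x t t′ s s′ c q q′ refl =
        from (478 * (k * k * ℓ)) (816 * (k * (D + D′)) + 1152 * (2 * (k * k) + k * (ℓ + r) + x)) 0
          (t ⊕ t′ ⊕ 816 * k ⊗ (≤-reflexive (≡-sym s) ⊕ ≤-reflexive (≡-sym s′)) ⊕ 576 ⊗ c ⊕ 288 ⊗ (q ⊕ q′))
          (eq k ℓ r S S′ D D′ qL qL′ qR qR′ x)
        where
        eq : ∀ k ℓ r S S′ D D′ qL qL′ qR qR′ x →
          478 * (k * k * ℓ) + (576 * qL + ℓ * (289 * (k * k)) + (576 * qL′ + ℓ * (289 * (k * k)) + (816 * k * (S + D + (S′ + D′))
            + (576 * (qR + qR′ + 2 * x) + 288 * (k * k * (ℓ + r + 4) + 2 * k * (ℓ + r) + (k * k * (ℓ + r + 4) + 2 * k * (ℓ + r))))))) + 0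
          ≡ 816 * (k * (D + D′)) + 1152 * (2 * (k * k) + k * (ℓ + r) + x)
            + (816 * (k * S) + (816 * (k * S′) + (816 * k * (ℓ * k + ℓ * k) + (576 * (r * (k * k)) + 288 * (2 * (qL + qR) + 2 * (qL′ + qR′))))))
        eq = solve-∀

    -- 24/41 < 2 − √2
    joined-not-low : ∀ {k P P′} c ε τ → k ≡ c * ε → 5 * 3456 ≤ c → 1 ≤ k → c ≤ ℓ → n ≤ ε * ℓ →
      length P ≡ k → length P′ ≡ k → AllPairs F P → AllPairs F P′ → All (λ p → All (λ p′ → k * CR p p′ ≤ n) P′) P →
      All (λ p → dL p ≤ τ) P → All (λ p → 41 * (dL p + τ) ≤ 24 * ℓ) P′ → ⊥
    joined-not-low {k} {P} {P′} c ε τ k≡ c≥ k≥1 ℓ≥ n≤ l l′ i i′ good lowP lowP′ =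
      joined-not-low-arith c ε k n ℓ τ (∑ P dL) (∑ P′ dL) ⟨ highs ⟩[ W P , W P′ ] (joined-lower {k} {P} {P′} l l′ i i′) D≤ D′≤
        (CR-inner {k} {k} {P} {P′} l l′ good) k≡ c≥ k≥1 ℓ≥ n≤
      where
      D≤ : ∑ P dL ≤ k * τ
      D≤ = subst (λ z → ∑ P dL ≤ z * τ) l (∑-upper τ lowP)
      D′≤ : 41 * (∑ P′ dL + k * τ) ≤ k * (24 * ℓ)
      D′≤ = begin
        41 * (∑ P′ dL + k * τ)                    ≡⟨ cong (λ z → 41 * (∑ P′ dL + z * τ)) (≡-sym l′) ⟩
        41 * (∑ P′ dL + length P′ * τ)            ≡⟨ cong (λ z → 41 * (∑ P′ dL + z)) (≡-sym (∑-const P′ τ)) ⟩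
        41 * (∑ P′ dL + ∑ P′ (λ _ → τ))           ≡⟨ cong (41 *_) (≡-sym (∑-+ P′ dL (λ _ → τ))) ⟩
        41 * ∑ P′ (λ p → dL p + τ)                ≡⟨ ≡-sym (∑-* P′ 41 _) ⟩
        ∑ P′ (λ p → 41 * (dL p + τ))              ≤⟨ ∑-upper (24 * ℓ) lowP′ ⟩
        length P′ * (24 * ℓ)                      ≡⟨ cong (_* (24 * ℓ)) l′ ⟩
        k * (24 * ℓ)                              ∎
        where open ≤-Reasoning

    -- 26/89 < 1 − 1/√2
    low-codegree-half : ∀ {k P} {Q : Fin n → Set} (Q? : Decidable Q) c ε τ → k ≡ c * ε → 7 * (2 * 576) ≤ c → 1 ≤ k → c ≤ ℓ → n ≤ ε * ℓ →
      length P ≡ k → AllPairs F P → All (λ p → dL p ≤ τ) P → 89 * τ ≤ 26 * ℓ →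
      All (λ p → k * ∑ (filter Q? highs) (A p) ≤ 2 * n) P → 2 * # Q? ∣ highs + ℓ ≤ n
    low-codegree-half {k} {P} Q? c ε τ k≡ c≥ k≥1 ℓ≥ n≤ l i lowP τ≤ few =
      low-codegree-half-arith c ε k n ℓ (# Q? ∣ highs) τ (∑ lows (V P)) (∑ P dL)
        ⟨ lows ⟩[ V P , V P ] ⟨ filter Q? highs ⟩[ V P , V P ] (∑ P (λ p → ∑ (filter Q? highs) (A p)))
        (tangent {k} P l lows) (∑V+∑W {k} lows P l) D≤ τ≤ cover DB≤ norm k≡ c≥ k≥1 ℓ≥ n≤
      where
      B : List (Fin n)
      B = filter Q? highs
      DB≤ : k * ∑ P (λ p → ∑ (filter Q? highs) (A p)) ≤ k * (2 * n)
      DB≤ = ≤-trans (≤-reflexive (≡-sym (∑-* P k _))) (subst (λ z → ∑ P (λ p → k * ∑ B (A p)) ≤ z * (2 * n)) l (∑-upper (2 * n) few))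
      D≤ : ∑ P dL ≤ k * τ
      D≤ = subst (λ z → ∑ P dL ≤ z * τ) l (∑-upper τ lowP)
      -- Few edges from `P` into `B` mean that `V P` is nearly k there: V² ≥ k² - 2 k W.
      cover : # Q? ∣ highs * (k * k) ≤ ⟨ filter Q? highs ⟩[ V P , V P ] + 2 * (k * ∑ P (λ p → ∑ (filter Q? highs) (A p)))
      cover = begin
        # Q? ∣ highs * (k * k)                             ≤⟨ ∑-lower (k * k) (All.universal (λ z → ≤-trans (m≤m+n (k * k) _)
                                                               (≤-reflexive (≡-sym (complement-square {V P z} {W P z} (V+W P l z))))) B) ⟩
        ∑ B (λ z → V P z * V P z + 2 * (k * W P z))        ≡⟨ trans (∑-+ B _ _) (cong (⟨ B ⟩[ V P , V P ] +_) (trans (∑-* B 2 _) (cong (2 *_) (∑-* B k _)))) ⟩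
        ⟨ B ⟩[ V P , V P ] + 2 * (k * ∑ B (W P))           ≡⟨ cong (λ z → ⟨ B ⟩[ V P , V P ] + 2 * (k * z)) (∑W B P) ⟩
        ⟨ B ⟩[ V P , V P ] + 2 * (k * ∑ P (λ p → ∑ B (A p))) ∎
        where open ≤-Reasoning
      norm : 2 * (⟨ lows ⟩[ V P , V P ] + ⟨ filter Q? highs ⟩[ V P , V P ]) ≤ k * k * (n + 4) + 2 * k * n
      norm = ≤-trans (*-monoʳ-≤ 2 (≤-trans (+-monoʳ-≤ ⟨ lows ⟩[ V P , V P ] (∑-filter-≤ Q? highs _)) (≤-reflexive (∑-split _)))) (independent-norm {k} {P} l i)

    -- Summing `near-partition` with both ‖V‖² about k² n / 2 at most, ⟨W P , W P′⟩ negligible and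
    -- ‖W P‖² ≤ k² n yields ∑ V P ≤ k n / 2 + k n / (4 M) up to lower order. So degrees in `P`
    -- average about n / 2 - n / (4 M) or more, while the hypothesis caps them at n / 2 - n / M. The
    -- size of k makes the lower order terms smaller than this difference.
    joined-degree : ∀ {k P P′} M → k ≡ 16 * M * (1 + 2 * M) → 1 ≤ M → k ≤ n →
      length P ≡ k → length P′ ≡ k → AllPairs F P → AllPairs F P′ → All (λ p → All (λ p′ → k * C p p′ ≤ 2 * n) P′) P →
      All (λ p → 2 * M * d p + 2 * n ≤ M * n) P → ⊥
    joined-degree {k} {P} {P′} M refl M≥ n≥ l l′ i i′ good lowP =
      arith k M n (∑ vertices (V P)) (∑ P d) ‖ V P ‖² ‖ V P′ ‖² x ‖ W P ‖² ≤-refl summed W≤ (∑V+∑d P l) D≤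
        (independent-norm {k} {P} l i) (independent-norm {k} {P′} l′ i′) x≤ n≥ k≥1
      where
      x : ℕ
      x = ⟨ vertices ⟩[ W P , W P′ ]
      k≥1 : 1 ≤ k
      k≥1 = *-mono-≤ (*-mono-≤ {1} {16} (s≤s z≤n) M≥) (s≤s z≤n)
      x≤ : x ≤ 2 * (k * n)
      x≤ = *-cancelˡ-≤ k {{>-nonZero k≥1}} (≤-trans
        (subst (λ z → k * x ≤ z * (2 * n)) (cong₂ _*_ l l′) (gram-cross vertices A k (2 * n) good)) (≤-reflexive (swap k n)))
        where
        swap : ∀ k n → k * k * (2 * n) ≡ k * (2 * (k * n))
        swap = solve-∀
      D≤ : 2 * M * ∑ P d + k * (2 * n) ≤ k * (M * n)
      D≤ = begin
        2 * M * ∑ P d + k * (2 * n)                  ≡⟨ cong₂ _+_ (≡-sym (∑-* P (2 * M) d)) (trans (cong (_* (2 * n)) (≡-sym l)) (≡-sym (∑-const P (2 * n)))) ⟩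
        ∑ P (λ p → 2 * M * d p) + ∑ P (λ _ → 2 * n)  ≡⟨ ≡-sym (∑-+ P _ _) ⟩
        ∑ P (λ p → 2 * M * d p + 2 * n)              ≤⟨ ∑-upper (M * n) lowP ⟩
        length P * (M * n)                           ≡⟨ cong (_* (M * n)) l ⟩
        k * (M * n)                                  ∎
        where open ≤-Reasoning
      W≤ : ‖ W P ‖² ≤ n * (k * k)
      W≤ = ≤-trans (∑-mono vertices (λ z → *-mono-≤ (W≤k z) (W≤k z))) (≤-reflexive (∑-vertices-const (k * k)))
        where
        W≤k : ∀ z → W P z ≤ k
        W≤k z = ≤-trans (m≤n+m _ (V P z)) (≤-reflexive (V+W P l z))
      summed : 4 * M * (k * ∑ vertices (V P)) + n * (4 * (M * M) * (k * k)) ≤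
               4 * M * ‖ V P ‖² + 4 * M * x + 4 * (M * M) * (‖ V P ‖² + ‖ V P′ ‖² + 2 * x) + ‖ W P ‖²
      summed = begin
        4 * M * (k * ∑ vertices (V P)) + n * (4 * (M * M) * (k * k))
          ≡⟨ cong₂ _+_ (trans (cong (4 * M *_) (≡-sym (∑-* vertices k _))) (≡-sym (∑-* vertices (4 * M) _))) (≡-sym (∑-vertices-const _)) ⟩
        ∑ vertices (λ z → 4 * M * (k * V P z)) + ∑ vertices (λ _ → 4 * (M * M) * (k * k)) ≡⟨ ≡-sym (∑-+ vertices _ _) ⟩
        ∑ vertices (λ z → 4 * M * (k * V P z) + 4 * (M * M) * (k * k))
          ≤⟨ ∑-mono vertices (λ z → near-partition M {v₁ = V P z} {w₁ = W P z} {v₂ = V P′ z} {w₂ = W P′ z} (V+W P l z) (V+W P′ l′ z)) ⟩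
        ∑ vertices (λ z → 4 * M * (V P z * V P z) + 4 * M * (W P z * W P′ z)
          + 4 * (M * M) * (V P z * V P z + V P′ z * V P′ z + 2 * (W P z * W P′ z)) + W P z * W P z)
          ≡⟨ trans (∑-+ vertices _ _) (cong (_+ ‖ W P ‖²) (trans (∑-+ vertices _ _) (cong₂ _+_
               (trans (∑-+ vertices _ _) (cong₂ _+_ (∑-* vertices (4 * M) _) (∑-* vertices (4 * M) _)))
               (trans (∑-* vertices (4 * (M * M)) _) (cong (4 * (M * M) *_) (trans (∑-+ vertices _ _) (cong₂ _+_ (∑-+ vertices _ _) (∑-* vertices 2 _)))))))) ⟩
        4 * M * ‖ V P ‖² + 4 * M * x + 4 * (M * M) * (‖ V P ‖² + ‖ V P′ ‖² + 2 * x) + ‖ W P ‖² ∎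
        where open ≤-Reasoning
      arith : ∀ k M n S D q q′ x w → 16 * M * (1 + 2 * M) ≤ k →
        4 * M * (k * S) + n * (4 * (M * M) * (k * k)) ≤ 4 * M * q + 4 * M * x + 4 * (M * M) * (q + q′ + 2 * x) + w → w ≤ n * (k * k) →
        S + D ≡ n * k → 2 * M * D + k * (2 * n) ≤ k * (M * n) →
        2 * q ≤ k * k * (n + 4) + 2 * k * n → 2 * q′ ≤ k * k * (n + 4) + 2 * k * n → x ≤ 2 * (k * n) → k ≤ n → 1 ≤ k → ⊥
      arith k M n S D q q′ x w k≡ h w≤ s h₁ q≤ q′≤ x≤ n≥ k≥ = absurd-≤0 (*-mono-≤ (*-mono-≤ k≥ k≥) k≥)
        (from (k * k * k) 0 (6 * (k * k * k))
          (4 ⊗ h ⊕ 4 ⊗ w≤ ⊕ 16 * (M * k) ⊗ ≤-reflexive (≡-sym s) ⊕ 8 * k ⊗ h₁ ⊕ (8 * M + 8 * (M * M)) ⊗ q≤ ⊕ 8 * (M * M) ⊗ q′≤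
            ⊕ (16 * M + 32 * (M * M)) ⊗ x≤ ⊕ 9 * (k * k) ⊗ n≥ ⊕ (2 * (k * k) + 3 * (k * n)) ⊗ k≡)
          (eq k M n S D q q′ x w))
        where
        eq : ∀ k M n S D q q′ x w →
          k * k * k + (4 * (4 * M * q + 4 * M * x + 4 * (M * M) * (q + q′ + 2 * x) + w) + (4 * (n * (k * k)) + (16 * (M * k) * (S + D)
            + (8 * k * (k * (M * n)) + ((8 * M + 8 * (M * M)) * (k * k * (n + 4) + 2 * k * n) + (8 * (M * M) * (k * k * (n + 4) + 2 * k * n)
            + ((16 * M + 32 * (M * M)) * (2 * (k * n)) + (9 * (k * k) * n + (2 * (k * k) + 3 * (k * n)) * k)))))))) + 6 * (k * k * k)
          ≡ 0 + (4 * (4 * M * (k * S) + n * (4 * (M * M) * (k * k))) + (4 * w + (16 * (M * k) * (n * k) + (8 * k * (2 * M * D + k * (2 * n))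
            + ((8 * M + 8 * (M * M)) * (2 * q) + (8 * (M * M) * (2 * q′) + ((16 * M + 32 * (M * M)) * x + (9 * (k * k) * k
            + (2 * (k * k) + 3 * (k * n)) * (16 * M * (1 + 2 * M))))))))))
        eq = solve-∀

  -- Density of the low vertices; few triangles among the high vertices

  unique-count : ∀ {n} (u : Fin n) {xs} → Unique xs → # (u Fin.≟_) ∣ xs ≤ 1
  unique-count u []          = z≤n
  unique-count u {x ∷ xs} (x∉ ∷ xs!) with u Fin.≟ x
  ... | yes refl = s≤s (≤-reflexive (none x∉))
    where
    none : ∀ {ys} → All (λ y → u ≢ y) ys → # (u Fin.≟_) ∣ ys ≡ 0
    none []           = refl
    none {y ∷ ys} (p ∷ ps) with u Fin.≟ y
    ... | yes q = contradiction q p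
    ... | no _  = none ps
  ... | no _ = unique-count u xs!

  All-const : ∀ {X Q : Set} {xs : List X} → 1 ≤ length xs → All (λ _ → Q) xs → Q
  All-const _ (q ∷ _) = q

  ¬E⇒F : ∀ {n} (G : Graph n) {u v} → u ≢ v → ¬ T (adj G u v) → T (compAdj G u v)
  ¬E⇒F G {u} {v} u≢v ¬e with u Fin.≟ v | adj G u v
  ... | yes p | _     = contradiction p u≢v
  ... | no _  | true  = contradiction tt ¬e
  ... | no _  | false = tt

  triple-factor : ℕ → ℕ → ℕ
  triple-factor N e = kst-factor (12 * N) (e * e)

  bad-bound bad-size : ℕ → ℕ → ℕ → ℕ
  bad-bound κ N e = ramsey κ (2 * (12 * N * (e * e)))
  bad-size κ N e = e * (2 * triple-factor N e * ramsey κ (2 * (12 * N * (2 * triple-factor N e)))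
    + kst-factor (12 * N) (2 * triple-factor N e) * suc (ramsey κ (12 * N)))

  module Dense {n : ℕ} (G : Graph n) {N b : ℕ} (bookless : Bookless G N b) (κ : ℕ) (κ≥ : 2000 ≤ κ) (n≥ : 4000 ≤ n) where
    open Split G bookless public

    n≥1 : 1 ≤ n
    n≥1 = ≤-trans (s≤s z≤n) n≥

    vertices! : Unique vertices
    vertices! = allFin⁺ n

    lows! : Unique lows
    lows! = AllPairs-resp-⊆ (filter-⊆ Low? vertices) vertices!

    highs! : Unique highs
    highs! = AllPairs-resp-⊆ (filter-⊆ High? vertices) vertices!

    lows-Low : All Low lows
    lows-Low = all-filter Low? vertices

    highs-High : All High highs
    highs-High = all-filter High? vertices

    independent : ∀ {xs} → Unique xs → AllPairs (λ x y → ¬ E x y) xs → AllPairs F xs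
    independent []       []       = []
    independent (u ∷ us) (e ∷ es) = All.map (λ (p , q) → ¬E⇒F G p q) (All.zip (u , e)) ∷ independent us es

    homogeneous-high : HasHomogeneous High F (ramsey κ)
    homogeneous-high k xs xs! high h with ramsey-sublist E? κ k xs h
    ... | inj₁ (Q , s , l , c) = ⊥-elim (high-not-clique l c (All-resp-⊆ s high) κ≥ n≥1)
    ... | inj₂ (P , s , l , i) = P , s , l , independent (AllPairs-resp-⊆ s xs!) i

    homogeneous-low : HasHomogeneous Low E (λ k → ramsey k κ)
    homogeneous-low k xs xs! low h with ramsey-sublist E? k κ xs h
    ... | inj₁ r = r
    ... | inj₂ (P , s , l , i) = ⊥-elim (low-not-independent l (independent (AllPairs-resp-⊆ s xs!) i) (All-resp-⊆ s low) κ≥ n≥)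

    A-sym : ∀ u v → A u v ≡ A v u
    A-sym u v = cong ind (Graph.sym G u v)

    Sparse : Fin n → Set
    Sparse u = ℓ ≤ 2 * # F? u ∣ lows

    Sparse? : Decidable Sparse
    Sparse? u = ℓ ≤? 2 * # F? u ∣ lows

    sparse-Low : All Low (filter Sparse? lows)
    sparse-Low = All-resp-⊆ (filter-⊆ Sparse? lows) lows-Low

    no-sparse-join : Joined E F (filter Sparse? lows) lows κ → ⊥
    no-sparse-join j = low-cliques-not-disjoint left-length right-length left-hom right-hom
      (All-resp-⊆ left⊆ sparse-Low) (All-resp-⊆ right⊆ lows-Low) complete κ≥ n≥
      where open Joined j

    -- Otherwise `join`, applied to nonadjacency, produces two cliques of low vertices without edges
    -- between them, which their degrees exclude.
    sparse-few : kst-factor κ 2 * suc (ramsey κ κ) ≤ ℓ → # Sparse? ∣ lows ≤ ramsey (2 * (κ * 2)) κ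
    sparse-few ℓ≥ = ≮⇒≥ λ lt → no-sparse-join
      (join {ρ = λ k → ramsey k κ} homogeneous-low F? (filter Sparse? lows) lows κ 2 (≤-trans (s≤s z≤n) κ≥) (s≤s z≤n)
        (AllPairs-resp-⊆ (filter-⊆ Sparse? lows) lows!) sparse-Low lows! lows-Low (<⇒≤ lt) ℓ≥ (all-filter Sparse? lows))

    -- The 1 accounts for `u` itself, which is related to `u` neither by `E` nor by `F`.
    low-partition : ∀ u → ℓ ≤ dL u + (# F? u ∣ lows + 1)
    low-partition u = begin
      ℓ                                                 ≡⟨ ≡-sym (trans (∑-const lows 1) (*-identityʳ ℓ)) ⟩
      ∑ lows (λ _ → 1)                                  ≤⟨ ∑-mono lows cover ⟩
      ∑ lows (λ v → A u v + (ind (does (F? u v)) + ind (does (u Fin.≟ v)))) ≡⟨ trans (∑-+ lows _ _) (cong (dL u +_) (∑-+ lows _ _)) ⟩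
      dL u + (∑ lows (λ v → ind (does (F? u v))) + ∑ lows (λ v → ind (does (u Fin.≟ v))))
        ≤⟨ +-monoʳ-≤ (dL u) (+-mono-≤ (≤-reflexive (∑-ind (F? u) lows)) (≤-trans (≤-reflexive (∑-ind (u Fin.≟_) lows)) (unique-count u lows!))) ⟩
      dL u + (# F? u ∣ lows + 1)                        ∎
      where
      open ≤-Reasoning
      cover : ∀ v → 1 ≤ A u v + (ind (does (F? u v)) + ind (does (u Fin.≟ v)))
      cover v with adj G u v | u Fin.≟ v
      ... | true  | _     = s≤s z≤n
      ... | false | yes _ = s≤s z≤n
      ... | false | no _  = s≤s z≤n

    -- All but boundedly many low vertices miss less than half of the low vertices. The resulting
    -- density 1/2 already exceeds 7/24, which is what the edge count requires.
    low-inner : kst-factor κ 2 * suc (ramsey κ κ) ≤ ℓ → ℓ * ℓ ≤ 2 * ∑ lows dL + ℓ * (1 + ramsey (2 * (κ * 2)) κ)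
    low-inner ℓ≥ = begin
      ℓ * ℓ                                              ≡⟨ cong (_* ℓ) (≡-sym (#-split Sparse? lows)) ⟩
      (# Sparse? ∣ lows + length rest) * ℓ               ≡⟨ *-distribʳ-+ ℓ (# Sparse? ∣ lows) (length rest) ⟩
      # Sparse? ∣ lows * ℓ + length rest * ℓ             ≤⟨ +-mono-≤ (*-monoˡ-≤ ℓ (sparse-few ℓ≥)) (∑-lower ℓ rest-dense) ⟩
      ramsey (2 * (κ * 2)) κ * ℓ + ∑ rest (λ u → 2 * dL u + 1)
        ≤⟨ +-monoʳ-≤ _ (∑-filter-≤ (λ u → ¬? (Sparse? u)) lows _) ⟩
      ramsey (2 * (κ * 2)) κ * ℓ + ∑ lows (λ u → 2 * dL u + 1)
        ≡⟨ cong (ramsey (2 * (κ * 2)) κ * ℓ +_) (trans (∑-+ lows _ _) (cong₂ _+_ (∑-* lows 2 dL) (trans (∑-const lows 1) (*-identityʳ ℓ)))) ⟩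
      ramsey (2 * (κ * 2)) κ * ℓ + (2 * ∑ lows dL + ℓ)   ≡⟨ eq (ramsey (2 * (κ * 2)) κ) ℓ (∑ lows dL) ⟩
      2 * ∑ lows dL + ℓ * (1 + ramsey (2 * (κ * 2)) κ)   ∎
      where
      open ≤-Reasoning
      rest : List (Fin n)
      rest = filter (λ u → ¬? (Sparse? u)) lows
      eq : ∀ a ℓ s → a * ℓ + (2 * s + ℓ) ≡ 2 * s + ℓ * (1 + a)
      eq = solve-∀
      rest-dense : All (λ u → ℓ ≤ 2 * dL u + 1) rest
      rest-dense = All.map (λ {u} ¬s → arith ℓ (dL u) (# F? u ∣ lows) (≰⇒> ¬s) (low-partition u)) (all-filter (λ u → ¬? (Sparse? u)) lows)
        where
        arith : ∀ ℓ x f → 1 + 2 * f ≤ ℓ → ℓ ≤ x + (f + 1) → ℓ ≤ 2 * x + 1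
        arith ℓ x f h₁ h₂ = from ℓ (2 * x + 1) 0 (h₁ ⊕ 2 ⊗ h₂) (eq′ ℓ x f)
          where
          eq′ : ∀ ℓ x f → ℓ + (ℓ + 2 * (x + (f + 1))) + 0 ≡ 2 * x + 1 + (1 + 2 * f + 2 * ℓ)
          eq′ = solve-∀

    -- The low degrees sum to at most 7 ℓ (ℓ + r) / 24. About ℓ² / 2 of this is spent among the low
    -- vertices themselves; that exceeds 7 ℓ² / 24 by 5 ℓ² / 24, enough to cover the linear error,
    -- and leaves 7 ℓ r / 24 for edges to high vertices.
    low-high-edges : kst-factor κ 2 * suc (ramsey κ κ) ≤ ℓ → 12 * (1 + ramsey (2 * (κ * 2)) κ) ≤ 5 * ℓ →
                     24 * ∑ highs dL ≤ 7 * (r * ℓ)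
    low-high-edges ℓ≥ ℓ≥′ = arith n ℓ r (ramsey (2 * (κ * 2)) κ) (∑ lows dL) (∑ highs dL) total (low-inner ℓ≥) ℓ≥′ ℓ+r≡n
      where
      swapped : ∑ highs dL ≡ ∑ lows (λ u → ∑ highs (A u))
      swapped = trans (∑-swap highs lows (λ v u → A v u)) (∑-cong lows (λ u → ∑-cong highs (λ v → A-sym v u)))
      total : 24 * (∑ lows dL + ∑ highs dL) ≤ ℓ * (7 * n)
      total = begin
        24 * (∑ lows dL + ∑ highs dL)                       ≡⟨ cong (λ z → 24 * (∑ lows dL + z)) swapped ⟩
        24 * (∑ lows dL + ∑ lows (λ u → ∑ highs (A u)))     ≡⟨ cong (24 *_) (≡-sym (∑-+ lows _ _)) ⟩
        24 * ∑ lows (λ u → dL u + ∑ highs (A u))            ≡⟨ cong (24 *_) (∑-cong lows (λ u → ∑-split (A u))) ⟩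
        24 * ∑ lows d                                       ≡⟨ ≡-sym (∑-* lows 24 d) ⟩
        ∑ lows (λ u → 24 * d u)                             ≤⟨ ∑-upper (7 * n) lows-Low ⟩
        ℓ * (7 * n)                                         ∎
        where open ≤-Reasoning
      arith : ∀ n ℓ r a s t → 24 * (s + t) ≤ ℓ * (7 * n) → ℓ * ℓ ≤ 2 * s + ℓ * (1 + a) → 12 * (1 + a) ≤ 5 * ℓ → ℓ + r ≡ n → 24 * t ≤ 7 * (r * ℓ)
      arith n ℓ r a s t h₁ h₂ h₃ refl = from (24 * t) (7 * (r * ℓ)) 0 (h₁ ⊕ 12 ⊗ h₂ ⊕ ℓ ⊗ h₃) (eq ℓ r a s t)
        where
        eq : ∀ ℓ r a s t → 24 * t + (ℓ * (7 * (ℓ + r)) + (12 * (2 * s + ℓ * (1 + a)) + ℓ * (5 * ℓ))) + 0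
             ≡ 7 * (r * ℓ) + (24 * (s + t) + (12 * (ℓ * ℓ) + ℓ * (12 * (1 + a))))
        eq = solve-∀

    -- Lists joined by good edges have a negligible inner product ⟨W , W⟩ over the high vertices, so
    -- `two-cover` is then nearly a bound on the two norms alone.
    BadEdge GoodEdge : ℕ → Fin n → Fin n → Set
    BadEdge e u v = E u v × n < e * CR u v
    GoodEdge e u v = E u v × e * CR u v ≤ n

    BadEdge? : ∀ e u v → Dec (BadEdge e u v)
    BadEdge? e u v = E? u v ×-dec (n <? e * CR u v)

    GoodEdge? : ∀ e u v → Dec (GoodEdge e u v)
    GoodEdge? e u v = E? u v ×-dec (e * CR u v ≤? n)

    Bad : ℕ → Fin n → Set
    Bad e u = n < e * # BadEdge? e u ∣ highs

    Bad? : ∀ e → Decidable (Bad e)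
    Bad? e u = n <? e * # BadEdge? e u ∣ highs

    Triangle : Fin n → Fin n × Fin n → Set
    Triangle u (v , w) = E u v × E u w × E v w

    Triangle? : ∀ u vw → Dec (Triangle u vw)
    Triangle? u (v , w) = E? u v ×-dec (E? u w ×-dec E? v w)

    pairs : List (Fin n × Fin n)
    pairs = cartesianProduct highs highs

    -- More than n / e bad edges at `u`, each in more than n / e triangles. The count is phrased as
    -- a density among pairs because `kst` is applied between vertices and pairs.
    bad-triangles : ∀ e {u} → Bad e u → length pairs ≤ e * e * # Triangle? u ∣ pairs
    bad-triangles e {u} bad = begin
      length pairs                                     ≡⟨ length-product highs highs ⟩
      r * r                                            ≤⟨ *-mono-≤ r≤n r≤n ⟩
      n * n                                            ≤⟨ *-monoˡ-≤ n (<⇒≤ bad) ⟩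
      e * # BadEdge? e u ∣ highs * n                   ≡⟨ *-assoc e _ n ⟩
      e * (# BadEdge? e u ∣ highs * n)                 ≤⟨ *-monoʳ-≤ e (∑-lower n (All.map (λ (p , q) → ≤-trans (<⇒≤ q) (*-monoʳ-≤ e (fan p))) (all-filter (BadEdge? e u) highs))) ⟩
      e * ∑ (filter (BadEdge? e u) highs) (λ v → e * # (λ w → Triangle? u (v , w)) ∣ highs)
        ≤⟨ *-monoʳ-≤ e (∑-filter-≤ (BadEdge? e u) highs _) ⟩
      e * ∑ highs (λ v → e * # (λ w → Triangle? u (v , w)) ∣ highs) ≡⟨ cong (e *_) (∑-* highs e _) ⟩
      e * (e * ∑ highs (λ v → # (λ w → Triangle? u (v , w)) ∣ highs)) ≡⟨ ≡-sym (*-assoc e e _) ⟩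
      e * e * ∑ highs (λ v → # (λ w → Triangle? u (v , w)) ∣ highs) ≡⟨ cong (e * e *_) (≡-sym (#-product (Triangle? u) highs highs)) ⟩
      e * e * # Triangle? u ∣ pairs                    ∎
      where
      open ≤-Reasoning
      r≤n : r ≤ n
      r≤n = ≤-trans (m≤n+m r ℓ) (≤-reflexive ℓ+r≡n)
      fan : ∀ {v} → E u v → CR u v ≤ # (λ w → Triangle? u (v , w)) ∣ highs
      fan {v} uv = ≤-trans (∑-mono highs (pointwise uv)) (≤-reflexive (∑-ind (λ w → Triangle? u (v , w)) highs))
        where
        pointwise : E u v → ∀ w → A u w * A v w ≤ ind (does (Triangle? u (v , w)))
        pointwise e w with adj G u v | adj G u w | adj G v w | e
        ... | true  | true  | true  | _ = ≤-refl
        ... | true  | true  | false | _ = z≤n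
        ... | true  | false | _     | _ = z≤n

    module Triples (k f : ℕ) (k≡ : k ≡ 12 * N) (k≥1 : 1 ≤ k) (f≥1 : 1 ≤ f) (n> : 24 * N < n)
                   (r≥₁ : 2 * f * ramsey κ (2 * (k * (2 * f))) ≤ r) (r≥₂ : kst-factor k (2 * f) * suc (ramsey κ k) ≤ r) where

      2f≥1 : 1 ≤ 2 * f
      2f≥1 = *-mono-≤ {1} {2} (s≤s z≤n) f≥1

      r≥1 : 1 ≤ r
      r≥1 = ≤-trans (*-mono-≤ (kst-factor≥1 k 2f≥1) (s≤s z≤n)) r≥₂

      -- Ramsey among the common third vertices supplies `P₃`, and the three lists contradict
      -- `no-triple`.
      no-common-triangles : ∀ {P₁ P₂} → length P₁ ≡ k → length P₂ ≡ k → AllPairs F P₁ → AllPairs F P₂ →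
              (Rel? : ∀ v w → Dec (All (λ s → Triangle s (v , w)) P₁)) → r ≤ kst-factor k (2 * f) * # Common? Rel? P₂ ∣ highs → ⊥
      no-common-triangles {P₁} {P₂} l₁ l₂ i₁ i₂ Rel? bound = finish
          (homogeneous-high k (filter (Common? Rel? P₂) highs) (AllPairs-resp-⊆ (filter-⊆ (Common? Rel? P₂) highs) highs!)
             (All-resp-⊆ (filter-⊆ (Common? Rel? P₂) highs) highs-High)
             (≤-trans (n≤1+n (ramsey κ k)) (*-cancelˡ-bound (kst-factor k (2 * f)) (kst-factor≥1 k 2f≥1) r≥₂ bound)))
        where
        nonempty : ∀ (xs : List (Fin n)) → length xs ≡ k → 1 ≤ length xs
        nonempty _ l = ≤-trans k≥1 (≤-reflexive (≡-sym l))
        finish : Homogeneous F (filter (Common? Rel? P₂) highs) k → ⊥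
        finish (P₃ , s , l₃ , i₃) = no-triple (trans l₁ k≡) (trans l₂ k≡) (trans l₃ k≡) i₁ i₂ i₃
            -- An edge between two of the lists is read off a triangle through any member of the
            -- third list, hence the need for nonempty lists.
            (All-transpose (All-const (nonempty P₃ l₃) (All.map (All.map (All.map proj₁)) tri)))
            (All-transpose (All.map (λ h → All-const (nonempty P₂ l₂) (All.map (All.map (λ t → proj₁ (proj₂ t))) h)) tri))
            (All-transpose (All.map (All.map (λ h → All-const (nonempty P₁ l₁) (All.map (λ t → proj₂ (proj₂ t)) h))) tri)) n>
          where
          tri : All (λ w → All (λ v → All (λ s → Triangle s (v , w)) P₁) P₂) P₃
          tri = All-resp-⊆ s (all-filter (Common? Rel? P₂) highs)

      -- `P₁` closes triangles with a fraction 1 / f of all pairs, so at least r / (2 f) of the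
      -- first coordinates v have a fraction 1 / (2 f) of admissible w. Ramsey and `kst` among these
      -- v give `P₂`, still with many common w.
      no-rich-triangle-pairs : ∀ {P₁} → length P₁ ≡ k → AllPairs F P₁ → r * r ≤ f * # Common? Triangle? P₁ ∣ pairs → ⊥
      no-rich-triangle-pairs {P₁} l₁ i₁ bound = continue (homogeneous-high (2 * (k * (2 * f))) rich rich! rich-High
          (*-cancelˡ-bound (2 * f) 2f≥1 r≥₁ (arith r f (length rich) total bound′ r≥1)))
        where
        Rel? : ∀ v w → Dec (All (λ s → Triangle s (v , w)) P₁)
        Rel? v w = Common? Triangle? P₁ (v , w)
        g : Fin n → ℕ
        g v = # Rel? v ∣ highs
        rich? : Decidable (λ v → r ≤ 2 * f * g v)
        rich? v = r ≤? 2 * f * g v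
        rich : List (Fin n)
        rich = filter rich? highs
        rich! : Unique rich
        rich! = AllPairs-resp-⊆ (filter-⊆ rich? highs) highs!
        rich-High : All High rich
        rich-High = All-resp-⊆ (filter-⊆ rich? highs) highs-High
        bound′ : r * r ≤ f * ∑ highs g
        bound′ = ≤-trans bound (≤-reflexive (cong (f *_) (#-product (Common? Triangle? P₁) highs highs)))
        total : 2 * f * ∑ highs g ≤ 2 * f * (length rich * r) + r * r
        total = begin
          2 * f * ∑ highs g                                 ≡⟨ cong (2 * f *_) (≡-sym (∑-filter rich? highs g)) ⟩
          2 * f * (∑ rich g + ∑ poor g)                     ≡⟨ *-distribˡ-+ (2 * f) (∑ rich g) (∑ poor g) ⟩
          2 * f * ∑ rich g + 2 * f * ∑ poor g               ≡⟨ cong (2 * f * ∑ rich g +_) (≡-sym (∑-* poor (2 * f) g)) ⟩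
          2 * f * ∑ rich g + ∑ poor (λ v → 2 * f * g v)
            ≤⟨ +-mono-≤ (*-monoʳ-≤ (2 * f) (∑-upper r (All.universal (λ v → length-filter (Rel? v) highs) rich)))
                        (≤-trans (∑-upper r (All.map (λ h → <⇒≤ (≰⇒> h)) (all-filter (λ v → ¬? (rich? v)) highs)))
                                 (*-monoˡ-≤ r (length-filter (λ v → ¬? (rich? v)) highs))) ⟩
          2 * f * (length rich * r) + r * r                 ∎
          where
          open ≤-Reasoning
          poor : List (Fin n)
          poor = filter (λ v → ¬? (rich? v)) highs
        arith : ∀ r f x {S} → 2 * f * S ≤ 2 * f * (x * r) + r * r → r * r ≤ f * S → 1 ≤ r → r ≤ 2 * f * x
        arith r f x {S} h₁ h₂ r≥1 = *-cancelˡ-≤ r {{>-nonZero r≥1}} (from (r * r) (r * (2 * f * x)) 0 (h₁ ⊕ 2 ⊗ h₂) (eq r f x S))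
          where
          eq : ∀ r f x S → r * r + (2 * f * (x * r) + r * r + 2 * (f * S)) + 0 ≡ r * (2 * f * x) + (2 * f * S + 2 * (r * r))
          eq = solve-∀
        continue : Homogeneous F rich (2 * (k * (2 * f))) → ⊥
        continue (U , U⊆ , lU , iU) = apply (kst Rel? U highs k (2 * f) k≥1 2f≥1 lU r≥1 (All-resp-⊆ U⊆ (all-filter rich? highs)))
          where
          apply : (Σ (List (Fin n)) λ S → S ⊆ U × length S ≡ k × r ≤ kst-factor k (2 * f) * # Common? Rel? S ∣ highs) → ⊥
          apply (P₂ , P₂⊆ , l₂ , bound₂) = no-common-triangles l₁ l₂ i₁ (AllPairs-resp-⊆ P₂⊆ iU) Rel? bound₂

      -- The first round of `kst` fixes `P₁` among independent bad vertices, whose links are dense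
      -- sets of pairs; the second round works inside the common link.
      no-rich-triangles : ∀ e → 1 ≤ e → f ≡ kst-factor k (e * e) → Homogeneous F (filter (Bad? e) highs) (2 * (k * (e * e))) → ⊥
      no-rich-triangles e e≥1 f≡ (U , U⊆ , lU , iU) = apply (kst Triangle? U pairs k (e * e) k≥1 (*-mono-≤ e≥1 e≥1) lU
            (≤-trans (*-mono-≤ r≥1 r≥1) (≤-reflexive (≡-sym (length-product highs highs))))
            (All-resp-⊆ U⊆ (All.map (λ {u} → bad-triangles e {u}) (all-filter (Bad? e) highs))))
        where
        apply : (Σ (List (Fin n)) λ S → S ⊆ U × length S ≡ k × length pairs ≤ kst-factor k (e * e) * # Common? Triangle? S ∣ pairs) → ⊥
        apply (P₁ , P₁⊆ , l₁ , bound) = no-rich-triangle-pairs l₁ (AllPairs-resp-⊆ P₁⊆ iU) (subst (λ z → r * r ≤ z * # Common? Triangle? P₁ ∣ pairs) (≡-sym f≡)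
          (≤-trans (≤-reflexive (≡-sym (length-product highs highs))) bound))

    bad-few : ∀ e → 1 ≤ e → bad-size κ N e ≤ n → 24 * N < n → # Bad? e ∣ highs ≤ bad-bound κ N e
    bad-few e e≥1 size n> = ≮⇒≥ contra
      where
      k f : ℕ
      k = 12 * N
      f = triple-factor N e

      k≥1 : 1 ≤ k
      k≥1 = *-mono-≤ {1} {12} (s≤s z≤n) N≥1

      -- One bad vertex already has more than n / e high neighbours, so r > n / e. This converts the
      -- demand on n into one on r and explains the factor e in `bad-size`.
      n<er : 1 ≤ # Bad? e ∣ highs → n < e * r
      n<er p = All-const p (All.map (λ {u} q → ≤-trans q (*-monoʳ-≤ e (length-filter (BadEdge? e u) highs))) (all-filter (Bad? e) highs))

      contra : ¬ (bad-bound κ N e < # Bad? e ∣ highs)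
      contra lt = Triples.no-rich-triangles k f refl k≥1 (kst-factor≥1 k (*-mono-≤ e≥1 e≥1)) n> (m+n≤o⇒m≤o r₁ r≥) (m+n≤o⇒n≤o r₁ r≥) e e≥1 refl
        (homogeneous-high (2 * (k * (e * e))) (filter (Bad? e) highs) (AllPairs-resp-⊆ (filter-⊆ (Bad? e) highs) highs!)
          (All-resp-⊆ (filter-⊆ (Bad? e) highs) highs-High) (<⇒≤ lt))
        where
        r₁ r₂ : ℕ
        r₁ = 2 * f * ramsey κ (2 * (k * (2 * f)))
        r₂ = kst-factor k (2 * f) * suc (ramsey κ k)
        r≥ : r₁ + r₂ ≤ r
        r≥ = <⇒≤ (*-cancelˡ-< e (r₁ + r₂) r (≤-trans (s≤s size) (n<er (≤-trans (s≤s z≤n) lt))))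

  -- The low vertices are negligible

  least-threshold : ∀ {X : Set} (f : X → ℕ) xs c m → c ≤ # (λ x → f x ≤? m) ∣ xs →
                    Σ ℕ λ τ → c ≤ # (λ x → f x ≤? τ) ∣ xs × # (λ x → f x <? τ) ∣ xs ≤ c
  least-threshold f xs c zero    h = 0 , h , ≤-trans (≤-reflexive (none xs)) z≤n
    where
    none : ∀ ys → # (λ x → f x <? 0) ∣ ys ≡ 0
    none []       = refl
    none (y ∷ ys) = none ys
  -- Descend to the last value that `c` elements do not exceed: these suffice for Ramsey, while at
  -- most `c` elements lie strictly below, so τ bounds nearly all values from below.
  least-threshold f xs c (suc m) h with c ≤? # (λ x → f x ≤? m) ∣ xs
  ... | yes h′ = least-threshold f xs c m h′
  ... | no ¬h  = suc m , h , ≤-trans (#-mono (λ x → f x <? suc m) (λ x → f x ≤? m) (All.universal (λ _ → ≤-pred) xs)) (<⇒≤ (≰⇒> ¬h))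

  -- 12/41 > 7/24
  half-large-arith : ∀ ℓ r β γ τ N₀ S₁ S₂ → β + γ ≡ r → 2 * β ≤ r → 41 * τ ≤ 12 * ℓ → β * τ ≤ S₁ + N₀ * τ →
    γ * (24 * ℓ) ≤ 41 * (S₂ + γ * τ) → 24 * (S₁ + S₂) ≤ 7 * (r * ℓ) → 1 + 288 * N₀ ≤ r → 1 ≤ ℓ → ⊥
  half-large-arith ℓ r β γ τ N₀ S₁ S₂ refl β≤ h₁ h₂ h₃ h₄ h₅ ℓ≥1
    -- Write γ = β + w and pair the β vertices with as many of the others: apart from N₀ exceptions
    -- a pair contributes 24 ℓ / 41, and each of the w left over at least 24 ℓ / 41 - τ ≥ 12 ℓ / 41.
    with m≤n⇒∃[o]m+o≡n (+-cancelˡ-≤ β β γ (≤-trans (≤-reflexive (cong (β +_) (≡-sym (+-identityʳ β)))) β≤))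
  ... | w , refl = absurd-≤0 ℓ≥1 (from ℓ 0 0
      (24 ⊗ h₃ ⊕ 984 ⊗ h₂ ⊕ 24 * w ⊗ h₁ ⊕ 24 * N₀ ⊗ h₁ ⊕ 41 ⊗ h₄ ⊕ ℓ ⊗ h₅) (eq ℓ β w τ N₀ S₁ S₂))
    where
    eq : ∀ ℓ β w τ N₀ S₁ S₂ →
         ℓ + (24 * (41 * (S₂ + (β + w) * τ)) + (984 * (S₁ + N₀ * τ) + (24 * w * (12 * ℓ) + (24 * N₀ * (12 * ℓ)
           + (41 * (7 * ((β + (β + w)) * ℓ)) + ℓ * (β + (β + w))))))) + 0
         ≡ 0 + (24 * ((β + w) * (24 * ℓ)) + (984 * (β * τ) + (24 * w * (41 * τ) + (24 * N₀ * (41 * τ)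
           + (41 * (24 * (S₁ + S₂)) + ℓ * (1 + 288 * N₀))))))
    eq = solve-∀

  -- 26/89 > 7/24
  all-large-arith : ∀ ℓ r τ N₀ S → r * τ ≤ S + N₀ * τ → 26 * ℓ ≤ 89 * τ → 24 * S ≤ 7 * (r * ℓ) → 1 + 624 * N₀ ≤ r → 1 ≤ ℓ → ⊥
  all-large-arith ℓ r τ N₀ S h₁ h₂ h₃ h₄ ℓ≥1 with m≤n⇒∃[o]m+o≡n (≤-trans (≤-trans (m≤m+n N₀ (623 * N₀)) (n≤1+n _)) h₄)
  ... | w , refl = absurd-≤0 ℓ≥1 (from ℓ 0 0
      (24 * w ⊗ h₂ ⊕ 2136 ⊗ h₁ ⊕ 89 ⊗ h₃ ⊕ ℓ ⊗ h₄) (eq ℓ w τ N₀ S))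
    where
    eq : ∀ ℓ w τ N₀ S →
         ℓ + (24 * w * (89 * τ) + (2136 * (S + N₀ * τ) + (89 * (7 * ((N₀ + w) * ℓ)) + ℓ * (N₀ + w)))) + 0
         ≡ 0 + (24 * w * (26 * ℓ) + (2136 * ((N₀ + w) * τ) + (89 * (24 * S) + ℓ * (1 + 624 * N₀))))
    eq = solve-∀

  module Lows {n : ℕ} (G : Graph n) {N b : ℕ} (bookless : Bookless G N b) (κ : ℕ) (κ≥ : 2000 ≤ κ) (n≥ : 4000 ≤ n) where
    open Dense G bookless κ κ≥ n≥ public

    ∑-A-split : ∀ e u (xs : List (Fin n)) → ∑ xs (A u) ≤ # GoodEdge? e u ∣ xs + # BadEdge? e u ∣ xs
    ∑-A-split e u xs = ≤-trans (≤-reflexive (∑-ind (E? u) xs))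
      (#-∪ (E? u) (GoodEdge? e u) (BadEdge? e u) (All.universal split xs))
      where
      split : ∀ v → E u v → GoodEdge e u v ⊎ BadEdge e u v
      split v uv with e * CR u v ≤? n
      ... | yes p = inj₁ (uv , p)
      ... | no ¬p = inj₂ (uv , ≰⇒> ¬p)

    BadEdge-highs : ∀ e u {Q : Fin n → Set} (Q? : Decidable Q) → # BadEdge? e u ∣ (filter Q? highs) ≤ # BadEdge? e u ∣ highs
    BadEdge-highs e u Q? = #-filter Q? (BadEdge? e u) (BadEdge? e u) highs (λ _ _ p → p)

    -- Low vertices have about ℓ / 2 low neighbours on average but degree at most 7 n / 24, so ℓ is
    -- at most about 7 n / 12; with the error allowed for, 11 ℓ ≤ 7 n.
    highs-many : 12 * (1 + ramsey (2 * (κ * 2)) κ) ≤ ℓ → kst-factor κ 2 * suc (ramsey κ κ) ≤ ℓ → 1 ≤ ℓ → 4 * n ≤ 11 * r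
    highs-many h₁ h₂ ℓ≥1 = arith n ℓ r (ramsey (2 * (κ * 2)) κ) (∑ lows dL) (low-inner h₂) total h₁ ℓ+r≡n ℓ≥1
      where
      total : 24 * ∑ lows dL ≤ ℓ * (7 * n)
      total = begin
        24 * ∑ lows dL             ≡⟨ ≡-sym (∑-* lows 24 dL) ⟩
        ∑ lows (λ u → 24 * dL u)   ≤⟨ ∑-mono lows (λ u → *-monoʳ-≤ 24 (≤-trans (m≤m+n (dL u) (∑ highs (A u))) (≤-reflexive (∑-split (A u))))) ⟩
        ∑ lows (λ u → 24 * d u)    ≤⟨ ∑-upper (7 * n) lows-Low ⟩
        ℓ * (7 * n)                ∎
        where open ≤-Reasoning
      arith : ∀ n ℓ r a s → ℓ * ℓ ≤ 2 * s + ℓ * (1 + a) → 24 * s ≤ ℓ * (7 * n) → 12 * (1 + a) ≤ ℓ → ℓ + r ≡ n → 1 ≤ ℓ → 4 * n ≤ 11 * r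
      arith n ℓ r a s h₁ h₂ h₃ refl ℓ≥1 = *-cancelˡ-≤ ℓ {{>-nonZero ℓ≥1}}
        (from (ℓ * (4 * (ℓ + r))) (ℓ * (11 * r)) 0 (12 ⊗ h₁ ⊕ h₂ ⊕ ℓ ⊗ h₃) (eq ℓ r a s))
        where
        eq : ∀ ℓ r a s → ℓ * (4 * (ℓ + r)) + (12 * (2 * s + ℓ * (1 + a)) + (ℓ * (7 * (ℓ + r)) + ℓ * ℓ)) + 0
             ≡ ℓ * (11 * r) + (12 * (ℓ * ℓ) + (24 * s + ℓ * (12 * (1 + a))))
        eq = solve-∀

    lows-exceptions : ℕ → ℕ
    lows-exceptions k = bad-bound κ N k + (ramsey κ (2 * (k * k)) + ramsey κ k)

    module Threshold (c ε k : ℕ) (k≡ : k ≡ c * ε) (c≥ : 5 * 3456 ≤ c) (k≥1 : 1 ≤ k) (c≤ℓ : c ≤ ℓ) (n≤εℓ : n ≤ ε * ℓ)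
             (bad≤ : # Bad? k ∣ highs ≤ bad-bound κ N k) (r≥ : 2 * (kst-factor k k * suc (ramsey κ k)) ≤ r) (τ : ℕ) where

      Small? : Decidable (λ v → dL v ≤ τ)
      Small? v = dL v ≤? τ

      -- By `joined-not-low`, a list of vertices with at most τ low neighbours cannot be joined by
      -- good edges to a list of these.
      Opposite? : Decidable (λ v → 41 * (dL v + τ) ≤ 24 * ℓ)
      Opposite? v = 41 * (dL v + τ) ≤? 24 * ℓ

      B smalls clean rich rest : List (Fin n)
      B      = filter Opposite? highs
      smalls = filter Small? highs
      clean  = filter (λ v → ¬? (Bad? k v)) smalls

      Rich? : Decidable (λ v → length B ≤ k * # GoodEdge? k v ∣ B)
      Rich? v = length B ≤? k * # GoodEdge? k v ∣ B

      rich = filter Rich? clean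
      rest = filter (λ v → ¬? (Rich? v)) clean

      B⊆ : B ⊆ highs
      B⊆ = filter-⊆ Opposite? highs

      clean⊆smalls : clean ⊆ smalls
      clean⊆smalls = filter-⊆ (λ v → ¬? (Bad? k v)) smalls

      clean⊆ : clean ⊆ highs
      clean⊆ = ⊆-trans clean⊆smalls (filter-⊆ Small? highs)

      rich⊆ : rich ⊆ clean
      rich⊆ = filter-⊆ Rich? clean

      rest⊆ : rest ⊆ clean
      rest⊆ = filter-⊆ (λ v → ¬? (Rich? v)) clean

      clean-Small : All (λ v → dL v ≤ τ) clean
      clean-Small = All-resp-⊆ clean⊆smalls (all-filter Small? highs)

      no-rich-join : Joined F (GoodEdge k) rich B k → ⊥
      no-rich-join j = joined-not-low {k} {left} {right} c ε τ k≡ c≥ k≥1 c≤ℓ n≤εℓ left-length right-length left-hom right-hom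
        (All.map (All.map proj₂) complete) (All-resp-⊆ left⊆ (All-resp-⊆ rich⊆ clean-Small))
        (All-resp-⊆ right⊆ (all-filter Opposite? highs))
        where open Joined j

      rich-few : kst-factor k k * suc (ramsey κ k) ≤ length B → length rich ≤ ramsey κ (2 * (k * k))
      rich-few B≥ = ≮⇒≥ λ lt → no-rich-join (join {ρ = ramsey κ} homogeneous-high (GoodEdge? k) rich B k k k≥1 k≥1
        (AllPairs-resp-⊆ (⊆-trans rich⊆ clean⊆) highs!) (All-resp-⊆ (⊆-trans rich⊆ clean⊆) highs-High)
        (AllPairs-resp-⊆ B⊆ highs!) (All-resp-⊆ B⊆ highs-High) (<⇒≤ lt) B≥ (all-filter Rich? clean))

      rest-degree : All (λ p → k * ∑ B (A p) ≤ 2 * n) rest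
      rest-degree = All.map (λ {p} (¬rich , ¬bad) → bound p ¬rich ¬bad)
        (All.zip (all-filter (λ v → ¬? (Rich? v)) clean , All-resp-⊆ rest⊆ (all-filter (λ v → ¬? (Bad? k v)) smalls)))
        where
        length-B≤n : length B ≤ n
        length-B≤n = ≤-trans (length-filter Opposite? highs) (≤-trans (m≤n+m r ℓ) (≤-reflexive ℓ+r≡n))
        bound : ∀ p → ¬ (length B ≤ k * # GoodEdge? k p ∣ B) → ¬ Bad k p → k * ∑ B (A p) ≤ 2 * n
        bound p ¬rich ¬bad = begin
          k * ∑ B (A p)                                               ≤⟨ *-monoʳ-≤ k (∑-A-split k p B) ⟩
          k * (# GoodEdge? k p ∣ B + # BadEdge? k p ∣ B)              ≡⟨ *-distribˡ-+ k _ _ ⟩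
          k * # GoodEdge? k p ∣ B + k * # BadEdge? k p ∣ B
            ≤⟨ +-mono-≤ (≤-trans (<⇒≤ (≰⇒> ¬rich)) length-B≤n) (≤-trans (*-monoʳ-≤ k (BadEdge-highs k p Opposite?)) (≮⇒≥ ¬bad)) ⟩
          n + n                                                       ≡⟨ cong (n +_) (≡-sym (+-identityʳ n)) ⟩
          2 * n                                                       ∎
          where open ≤-Reasoning

      -- Enough of the small vertices are neither bad nor rich; a list of them has few edges into
      -- `B`, so its `V P` is nearly k there. As τ ≤ 26 ℓ / 89, the low vertices take up at least ℓ
      -- / 2 of the total n / 2 (in units of k²), which leaves at most r / 2 for `B`.
      opposite-half : lows-exceptions k ≤ length smalls → 89 * τ ≤ 26 * ℓ → 2 * length B + ℓ ≤ n
      opposite-half smalls≥ τ≤ = case (kst-factor k k * suc (ramsey κ k) ≤? length B)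
        where
        small-case : ¬ (kst-factor k k * suc (ramsey κ k) ≤ length B) → 2 * length B + ℓ ≤ n
        -- A `B` too short for `join` is below r / 2 because r is large.
        small-case ¬p = ≤-trans (+-monoˡ-≤ ℓ (≤-trans (*-monoʳ-≤ 2 (<⇒≤ (≰⇒> ¬p))) r≥)) (≤-reflexive (trans (+-comm r ℓ) ℓ+r≡n))
        clean≥ : ramsey κ (2 * (k * k)) + ramsey κ k ≤ length clean
        clean≥ = +-cancelˡ-≤ (bad-bound κ N k) _ _ (begin
          bad-bound κ N k + (ramsey κ (2 * (k * k)) + ramsey κ k) ≤⟨ smalls≥ ⟩
          length smalls                                           ≡⟨ ≡-sym (#-split (Bad? k) smalls) ⟩
          # Bad? k ∣ smalls + length clean
            ≤⟨ +-monoˡ-≤ (length clean) (≤-trans (#-filter Small? (Bad? k) (Bad? k) highs (λ _ _ p → p)) bad≤) ⟩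
          bad-bound κ N k + length clean                          ∎)
          where open ≤-Reasoning
        rest≥ : kst-factor k k * suc (ramsey κ k) ≤ length B → ramsey κ k ≤ length rest
        rest≥ B≥ = +-cancelˡ-≤ (ramsey κ (2 * (k * k))) _ _
          (≤-trans clean≥ (≤-trans (≤-reflexive (≡-sym (#-split Rich? clean))) (+-monoˡ-≤ (length rest) (rich-few B≥))))
        finish : Homogeneous F rest k → 2 * length B + ℓ ≤ n
        finish (P , P⊆ , l , i) = low-codegree-half {k} {P} Opposite? c ε τ k≡ (≤-trans (≤ᵇ⇒≤ (7 * (2 * 576)) (5 * 3456) tt) c≥) k≥1 c≤ℓ n≤εℓ l i
          (All-resp-⊆ (⊆-trans P⊆ rest⊆) clean-Small) τ≤ (All-resp-⊆ P⊆ rest-degree)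
        case : Dec (kst-factor k k * suc (ramsey κ k) ≤ length B) → 2 * length B + ℓ ≤ n
        case (no ¬p)  = small-case ¬p
        case (yes B≥) = finish (homogeneous-high k rest (AllPairs-resp-⊆ (⊆-trans rest⊆ clean⊆) highs!)
          (All-resp-⊆ (⊆-trans rest⊆ clean⊆) highs-High) (rest≥ B≥))

      module _ (N₀ : ℕ) (below≤ : # (λ v → dL v <? τ) ∣ highs ≤ N₀) where

        mostly-above : ∀ (xs : List (Fin n)) → # (λ v → dL v <? τ) ∣ xs ≤ N₀ → length xs * τ ≤ ∑ xs dL + N₀ * τ
        mostly-above xs h = begin
          length xs * τ                                       ≤⟨ ∑-lower τ (All.universal pointwise xs) ⟩
          ∑ xs (λ v → dL v + ind (does (dL v <? τ)) * τ)      ≡⟨ trans (∑-+ xs _ _) (cong (∑ xs dL +_) (∑-*ʳ xs _ τ)) ⟩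
          ∑ xs dL + ∑ xs (λ v → ind (does (dL v <? τ))) * τ   ≤⟨ +-monoʳ-≤ (∑ xs dL) (*-monoˡ-≤ τ (≤-trans (≤-reflexive (∑-ind (λ v → dL v <? τ) xs)) h)) ⟩
          ∑ xs dL + N₀ * τ                                    ∎
          where
          open ≤-Reasoning
          pointwise : ∀ v → τ ≤ dL v + ind (does (dL v <? τ)) * τ
          pointwise v = helper (dL v) (dL v <? τ)
            where
            helper : ∀ x (p? : Dec (x < τ)) → τ ≤ x + ind (does p?) * τ
            helper x (yes _) = ≤-trans (m≤n+m τ x) (+-monoʳ-≤ x (≤-reflexive (≡-sym (*-identityˡ τ))))
            helper x (no ¬p) = ≤-trans (≮⇒≥ ¬p) (m≤m+n x 0)

        -- Either τ exceeds 26 ℓ / 89 and nearly all high vertices have τ low neighbours, or at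
        -- least half of them lie outside `B`. The averages 26 ℓ / 89 and 12 ℓ / 41 beat 7 ℓ / 24 by
        -- ℓ / 2136 and ℓ / 984, so r must be large enough for the N₀ exceptions not to matter.
        lows-contradiction : lows-exceptions k ≤ length smalls → 24 * ∑ highs dL ≤ 7 * (r * ℓ) → 1 + 624 * N₀ ≤ r → 1 ≤ ℓ → ⊥
        lows-contradiction smalls≥ edges r> ℓ≥1 = case (89 * τ ≤? 26 * ℓ)
          where
          rest′ : List (Fin n)
          rest′ = filter (λ v → ¬? (Opposite? v)) highs
          above : length rest′ * (24 * ℓ) ≤ 41 * (∑ rest′ dL + length rest′ * τ)
          above = begin
            length rest′ * (24 * ℓ)                     ≤⟨ ∑-lower (24 * ℓ) (All.map (λ ¬p → <⇒≤ (≰⇒> ¬p)) (all-filter (λ v → ¬? (Opposite? v)) highs)) ⟩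
            ∑ rest′ (λ v → 41 * (dL v + τ))             ≡⟨ ∑-* rest′ 41 _ ⟩
            41 * ∑ rest′ (λ v → dL v + τ)               ≡⟨ cong (41 *_) (trans (∑-+ rest′ dL (λ _ → τ)) (cong (∑ rest′ dL +_) (∑-const rest′ τ))) ⟩
            41 * (∑ rest′ dL + length rest′ * τ)        ∎
            where open ≤-Reasoning
          r>′ : 1 + 288 * N₀ ≤ r
          r>′ = ≤-trans (s≤s (*-monoˡ-≤ N₀ (≤ᵇ⇒≤ 288 624 tt))) r>
          2B≤r : 89 * τ ≤ 26 * ℓ → 2 * length B ≤ r
          2B≤r τ≤ = +-cancelʳ-≤ ℓ (2 * length B) r (≤-trans (opposite-half smalls≥ τ≤) (≤-reflexive (trans (≡-sym ℓ+r≡n) (+-comm ℓ r))))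
          edges′ : 24 * (∑ B dL + ∑ rest′ dL) ≤ 7 * (r * ℓ)
          edges′ = ≤-trans (≤-reflexive (cong (24 *_) (∑-filter Opposite? highs dL))) edges
          B-above : length B * τ ≤ ∑ B dL + N₀ * τ
          B-above = mostly-above B (≤-trans (#-filter Opposite? (λ v → dL v <? τ) (λ v → dL v <? τ) highs (λ _ _ p → p)) below≤)
          case : Dec (89 * τ ≤ 26 * ℓ) → ⊥
          case (no ¬p)  = all-large-arith ℓ r τ N₀ (∑ highs dL) (mostly-above highs below≤) (<⇒≤ (≰⇒> ¬p)) edges r> ℓ≥1
          case (yes τ≤) = half-large-arith ℓ r (length B) (length rest′) τ N₀ (∑ B dL) (∑ rest′ dL) (#-split Opposite? highs)
            (2B≤r τ≤) (rescale 89 26 41 12 τ ℓ τ≤ (≤ᵇ⇒≤ (41 * 26) (89 * 12) tt)) B-above above edges′ r>′ ℓ≥1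

    -- Assuming n ≤ ε ℓ makes ℓ comparable with n; with lists of size c ε the errors in the list
    -- estimates are then small against k² ℓ.
    lows-few : ∀ c ε k N₀ y z₁ z₂ → k ≡ c * ε → 5 * 3456 ≤ c → 1 ≤ k → lows-exceptions k ≤ N₀ →
      2 * (kst-factor k k * suc (ramsey κ k)) ≤ y → 12 * (1 + ramsey (2 * (κ * 2)) κ) ≤ z₁ → kst-factor κ 2 * suc (ramsey κ κ) ≤ z₂ →
      ε * (c + (z₁ + z₂)) ≤ n → 3 * (y + (1 + 624 * N₀)) ≤ n → # Bad? k ∣ highs ≤ bad-bound κ N k → ε * ℓ < n
    lows-few c ε k N₀ y z₁ z₂ k≡ c≥ k≥1 N₀≥ y≥ z₁≥ z₂≥ size₁ size₂ bad≤ = ≰⇒> contra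
      where
      contra : ¬ (n ≤ ε * ℓ)
      contra n≤εℓ = use (least-threshold dL highs N₀ n (≤-trans N₀≤r (≤-reflexive (≡-sym (#-all (λ v → dL v ≤? n) (All.universal dL≤n highs))))))
        where
        ε≥1 : 1 ≤ ε
        ε≥1 = positive ε (≤-trans n≥1 n≤εℓ)
          where
          positive : ∀ ε → 1 ≤ ε * ℓ → 1 ≤ ε
          positive (suc ε) _ = s≤s z≤n
        ℓ≥ : c + (z₁ + z₂) ≤ ℓ
        ℓ≥ = *-cancelˡ-bound ε ε≥1 size₁ n≤εℓ
        c≤ℓ : c ≤ ℓ
        c≤ℓ = m+n≤o⇒m≤o c ℓ≥
        ℓ≥₁ : 12 * (1 + ramsey (2 * (κ * 2)) κ) ≤ ℓ
        ℓ≥₁ = ≤-trans z₁≥ (m+n≤o⇒m≤o z₁ (m+n≤o⇒n≤o c ℓ≥))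
        ℓ≥₂ : kst-factor κ 2 * suc (ramsey κ κ) ≤ ℓ
        ℓ≥₂ = ≤-trans z₂≥ (m+n≤o⇒n≤o z₁ (m+n≤o⇒n≤o c ℓ≥))
        ℓ≥1 : 1 ≤ ℓ
        ℓ≥1 = ≤-trans (≤-trans (s≤s z≤n) c≥) c≤ℓ
        r≥ : y + (1 + 624 * N₀) ≤ r
        r≥ = arith n r (y + (1 + 624 * N₀)) size₂ (highs-many ℓ≥₁ ℓ≥₂ ℓ≥1)
          where
          arith : ∀ n r x → 3 * x ≤ n → 4 * n ≤ 11 * r → x ≤ r
          arith n r x h₁ h₂ = *-cancelˡ-≤ 11 (from (11 * x) (11 * r) x (4 ⊗ h₁ ⊕ h₂) (eq n r x))
            where
            eq : ∀ n r x → 11 * x + (4 * n + 11 * r) + x ≡ 11 * r + (4 * (3 * x) + 4 * n)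
            eq = solve-∀
        r> : 1 + 624 * N₀ ≤ r
        r> = m+n≤o⇒n≤o y r≥
        N₀≤r : N₀ ≤ r
        N₀≤r = ≤-trans (≤-trans (m≤m+n N₀ (623 * N₀)) (n≤1+n (624 * N₀))) r>
        dL≤n : ∀ v → dL v ≤ n
        dL≤n v = ≤-trans (∑-filter-≤ Low? vertices (A v)) (d≤n v)
        edges : 24 * ∑ highs dL ≤ 7 * (r * ℓ)
        edges = low-high-edges ℓ≥₂ (≤-trans ℓ≥₁ (m≤m+n ℓ (4 * ℓ)))
        use : (Σ ℕ λ τ → N₀ ≤ # (λ x → dL x ≤? τ) ∣ highs × # (λ x → dL x <? τ) ∣ highs ≤ N₀) → ⊥
        use (τ , above , below) = Threshold.lows-contradiction c ε k k≡ c≥ k≥1 c≤ℓ n≤εℓ bad≤ (≤-trans y≥ (m+n≤o⇒m≤o y r≥)) τ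
          N₀ below (≤-trans N₀≥ above) edges r> ℓ≥1

  -- Almost all degrees near n / 2; the bipartition

  T-does⁻ : ∀ {P : Set} (p? : Dec P) → T (does p?) → P
  T-does⁻ (yes p) _ = p

  T-does⁺ : ∀ {P : Set} (p? : Dec P) → P → T (does p?)
  T-does⁺ (yes _) _ = tt
  T-does⁺ (no ¬p) p = contradiction p ¬p

  same-answer : ∀ {P Q : Set} (p? : Dec P) (q? : Dec Q) → does p? ≡ does q? → (P × Q) ⊎ (¬ P × ¬ Q)
  same-answer (yes p) (yes q) _ = inj₁ (p , q)
  same-answer (no ¬p) (no ¬q) _ = inj₂ (¬p , ¬q)

  module Structure {n : ℕ} (G : Graph n) {N b : ℕ} (bookless : Bookless G N b) (κ : ℕ) (κ≥ : 2000 ≤ κ) (n≥ : 4000 ≤ n)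
                   (M k : ℕ) (k≡ : k ≡ 16 * M * (1 + 2 * M)) (M≥ : 20 ≤ M) where
    open Lows G bookless κ κ≥ n≥ public

    M≥1 : 1 ≤ M
    M≥1 = ≤-trans (s≤s z≤n) M≥

    k≥48M : 48 * M ≤ k
    k≥48M = ≤-trans (arith M M≥1) (≤-reflexive (≡-sym k≡))
      where
      arith : ∀ M → 1 ≤ M → 48 * M ≤ 16 * M * (1 + 2 * M)
      arith M h = from (48 * M) (16 * M * (1 + 2 * M)) 0 (32 * M ⊗ h) (eq M)
        where
        eq : ∀ M → 48 * M + 32 * M * M + 0 ≡ 16 * M * (1 + 2 * M) + 32 * M * 1
        eq = solve-∀

    k≥48 : 48 ≤ k
    k≥48 = ≤-trans (*-monoʳ-≤ 48 M≥1) k≥48M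

    k≥1 : 1 ≤ k
    k≥1 = ≤-trans (s≤s z≤n) k≥48

    -- Degree at most (1/2 - 1/M) n, cleared of denominators.
    Deficient : Fin n → Set
    Deficient v = 2 * M * d v + 2 * n ≤ M * n

    Deficient? : Decidable Deficient
    Deficient? v = 2 * M * d v + 2 * n ≤? M * n

    r≤n : r ≤ n
    r≤n = ≤-trans (m≤n+m r ℓ) (≤-reflexive ℓ+r≡n)

    module _ (kℓ≤n : k * ℓ ≤ n) (bad≤ : # Bad? k ∣ highs ≤ bad-bound κ N k) where

      kdL≤n : ∀ v → k * dL v ≤ n
      kdL≤n v = ≤-trans (*-monoʳ-≤ k (≤-trans (∑-mono lows (λ z → ind≤1 (adj G v z))) (≤-reflexive (trans (∑-const lows 1) (*-identityʳ ℓ))))) kℓ≤n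

      good-codegree : ∀ {u v} → GoodEdge k u v → k * C u v ≤ 2 * n
      good-codegree {u} {v} (_ , h) = begin
        k * C u v                                   ≡⟨ cong (k *_) (≡-sym (∑-split _)) ⟩
        k * (⟨ lows ⟩[ A u , A v ] + CR u v)        ≡⟨ *-distribˡ-+ k _ _ ⟩
        k * ⟨ lows ⟩[ A u , A v ] + k * CR u v      ≤⟨ +-mono-≤ (≤-trans (*-monoʳ-≤ k (∑-mono lows (λ z → ≤-trans (*-monoʳ-≤ (A u z) (ind≤1 (adj G v z))) (≤-reflexive (*-identityʳ _))))) (kdL≤n u)) h ⟩
        n + n                                       ≡⟨ cong (n +_) (≡-sym (+-identityʳ n)) ⟩
        2 * n                                       ∎
        where open ≤-Reasoning

      -- Of a degree above 7 n / 24, at most n / k is lost to low neighbours and n / k to bad edges;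
      -- as k ≥ 48, more than n / k remains.
      good-neighbours : ∀ {v} → High v → ¬ Bad k v → n ≤ k * # GoodEdge? k v ∣ highs
      good-neighbours {v} high ¬bad = arith k n (d v) (k * dL v) (k * # GoodEdge? k v ∣ highs) (k * # BadEdge? k v ∣ highs)
        split (kdL≤n v) (≮⇒≥ ¬bad) (<⇒≤ (≰⇒> high)) k≥48
        where
        split : k * d v ≤ k * dL v + (k * # GoodEdge? k v ∣ highs + k * # BadEdge? k v ∣ highs)
        split = begin
          k * d v                                    ≡⟨ cong (k *_) (≡-sym (∑-split (A v))) ⟩
          k * (dL v + ∑ highs (A v))                 ≡⟨ *-distribˡ-+ k _ _ ⟩
          k * dL v + k * ∑ highs (A v)               ≤⟨ +-monoʳ-≤ (k * dL v) (≤-trans (*-monoʳ-≤ k (∑-A-split k v highs)) (≤-reflexive (*-distribˡ-+ k _ _))) ⟩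
          k * dL v + (k * # GoodEdge? k v ∣ highs + k * # BadEdge? k v ∣ highs) ∎
          where open ≤-Reasoning
        arith : ∀ k n x a g c → k * x ≤ a + (g + c) → a ≤ n → c ≤ n → 7 * n ≤ 24 * x → 48 ≤ k → n ≤ g
        arith k n x a g c h₁ h₂ h₃ h₄ h₅ = *-cancelˡ-≤ 24 (from (24 * n) (24 * g) (264 * n)
          (24 ⊗ h₁ ⊕ 24 ⊗ h₂ ⊕ 24 ⊗ h₃ ⊕ k ⊗ h₄ ⊕ 7 * n ⊗ h₅) (eq k n x a g c))
          where
          eq : ∀ k n x a g c → 24 * n + (24 * (a + (g + c)) + (24 * n + (24 * n + (k * (24 * x) + 7 * n * k)))) + 264 * n
               ≡ 24 * g + (24 * (k * x) + (24 * a + (24 * c + (k * (7 * n) + 7 * n * 48))))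
          eq = solve-∀

      deficients clean : List (Fin n)
      deficients = filter Deficient? highs
      clean      = filter (λ v → ¬? (Bad? k v)) deficients

      clean⊆ : clean ⊆ highs
      clean⊆ = ⊆-trans (filter-⊆ (λ v → ¬? (Bad? k v)) deficients) (filter-⊆ Deficient? highs)

      no-clean-join : k ≤ n → Joined F (GoodEdge k) clean highs k → ⊥
      no-clean-join k≤n j = joined-degree {k} {left} {right} M k≡ M≥1 k≤n left-length right-length left-hom right-hom
        (All.map (All.map good-codegree) complete)
        (All-resp-⊆ left⊆ (All-resp-⊆ (filter-⊆ (λ v → ¬? (Bad? k v)) deficients) (all-filter Deficient? highs)))
        where open Joined j

      -- Every high vertex that is not bad has good edges to a fraction 1 / k of the high vertices,
      -- so too many deficient ones would be joined to an independent list by good edges, against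
      -- `joined-degree`.
      deficient-few : k ≤ n → kst-factor k k * suc (ramsey κ k) ≤ r → # Deficient? ∣ highs ≤ bad-bound κ N k + ramsey κ (2 * (k * k))
      deficient-few k≤n r≥ = ≤-trans (≤-reflexive (≡-sym (#-split (Bad? k) deficients)))
        (+-mono-≤ (≤-trans (#-filter Deficient? (Bad? k) (Bad? k) highs (λ _ _ p → p)) bad≤) clean≤)
        where
        clean-rich : All (λ v → r ≤ k * # GoodEdge? k v ∣ highs) clean
        clean-rich = All.map (λ (h , ¬b) → ≤-trans r≤n (good-neighbours h ¬b))
          (All.zip (All-resp-⊆ clean⊆ highs-High , all-filter (λ v → ¬? (Bad? k v)) deficients))
        clean≤ : length clean ≤ ramsey κ (2 * (k * k))
        clean≤ = ≮⇒≥ λ lt → no-clean-join k≤n (join {ρ = ramsey κ} homogeneous-high (GoodEdge? k) clean highs k k k≥1 k≥1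
          (AllPairs-resp-⊆ clean⊆ highs!) (All-resp-⊆ clean⊆ highs-High) highs! highs-High (<⇒≤ lt) r≥ clean-rich)

      -- Inclusion–exclusion: three vertices of degree about n/2 cannot have pairwise small codegrees.
      no-good-triangle : ∀ {u v w} → ¬ Deficient u → ¬ Deficient v → ¬ Deficient w → GoodEdge k u v → GoodEdge k u w → ¬ E v w
      no-good-triangle {u} {v} {w} du dv dw uv uw vw =
        arith k M n b (d u) (d v) (d w) (C v w) (C u v) (C u w) summed (<⇒≤ (≰⇒> du)) (<⇒≤ (≰⇒> dv)) (<⇒≤ (≰⇒> dw))
          (edge-book v w vw) 12b≤n (good-codegree uv) (good-codegree uw) M≥ k≥48 n≥1
        where
        pointwise : ∀ z → A u z + A v z + A w z ≤ 1 + (A v z * A w z + A u z * A v z + A u z * A w z)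
        pointwise z with adj G u z | adj G v z | adj G w z
        ... | true  | true  | true  = s≤s (s≤s (s≤s z≤n))
        ... | true  | true  | false = s≤s (s≤s z≤n)
        ... | true  | false | true  = s≤s (s≤s z≤n)
        ... | true  | false | false = s≤s z≤n
        ... | false | true  | true  = s≤s (s≤s z≤n)
        ... | false | true  | false = s≤s z≤n
        ... | false | false | true  = s≤s z≤n
        ... | false | false | false = z≤n
        summed : d u + d v + d w ≤ n * 1 + (C v w + C u v + C u w)
        summed = begin
          d u + d v + d w                                  ≡⟨ ≡-sym (trans (∑-+ vertices _ _) (cong (_+ d w) (∑-+ vertices _ _))) ⟩
          ∑ vertices (λ z → A u z + A v z + A w z)         ≤⟨ ∑-mono vertices pointwise ⟩
          ∑ vertices (λ z → 1 + (A v z * A w z + A u z * A v z + A u z * A w z))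
            ≡⟨ trans (∑-+ vertices _ _) (cong₂ _+_ (∑-vertices-const 1) (trans (∑-+ vertices _ _) (cong (_+ C u w) (∑-+ vertices _ _)))) ⟩
          n * 1 + (C v w + C u v + C u w)                  ∎
          where open ≤-Reasoning
        arith : ∀ k M n b x y z c₁ c₂ c₃ → x + y + z ≤ n * 1 + (c₁ + c₂ + c₃) → M * n ≤ 2 * M * x + 2 * n → M * n ≤ 2 * M * y + 2 * n →
          M * n ≤ 2 * M * z + 2 * n → c₁ ≤ b → 12 * b ≤ n → k * c₂ ≤ 2 * n → k * c₃ ≤ 2 * n → 20 ≤ M → 48 ≤ k → 1 ≤ n → ⊥
        arith k M n b x y z c₁ c₂ c₃ h hx hy hz h₁ hb h₂ h₃ M≥ k≥ n≥ = absurd-≤0 (*-mono-≤ (≤-trans (s≤s z≤n) k≥) n≥)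
          (from (k * n) 0 (7 * (k * n) + 4 * (M * k * n))
            (24 * (M * k) ⊗ h ⊕ 12 * k ⊗ (hx ⊕ hy ⊕ hz) ⊕ 24 * (M * k) ⊗ h₁ ⊕ 2 * (M * k) ⊗ hb ⊕ 24 * M ⊗ (h₂ ⊕ h₃) ⊕ 4 * (k * n) ⊗ M≥ ⊕ 2 * (M * n) ⊗ k≥)
            (eq k M n b x y z c₁ c₂ c₃))
          where
          eq : ∀ k M n b x y z c₁ c₂ c₃ →
            k * n + (24 * (M * k) * (n * 1 + (c₁ + c₂ + c₃)) + (12 * k * (2 * M * x + 2 * n + (2 * M * y + 2 * n + (2 * M * z + 2 * n)))
              + (24 * (M * k) * b + (2 * (M * k) * n + (24 * M * (2 * n + 2 * n) + (4 * (k * n) * M + 2 * (M * n) * k)))))) + (7 * (k * n) + 4 * (M * k * n))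
            ≡ 0 + (24 * (M * k) * (x + y + z) + (12 * k * (M * n + (M * n + M * n)) + (24 * (M * k) * c₁ + (2 * (M * k) * (12 * b)
              + (24 * M * (k * c₂ + k * c₃) + (4 * (k * n) * 20 + 2 * (M * n) * 48))))))
          eq = solve-∀

      module Bipartition (δ : ℕ) (deficient≤ : # Deficient? ∣ highs ≤ δ) (δ≤ : M * δ ≤ n) (u v : Fin n)
                         (¬bad-u : ¬ Bad k u) (¬bad-v : ¬ Bad k v) (¬def-u : ¬ Deficient u) (¬def-v : ¬ Deficient v) (uv : GoodEdge k u v) where

        -- The colour classes are the good neighbourhoods of the ends of the good edge `u v`, a
        -- vertex in both counting for `u`. Deficient vertices are removed so that
        -- `no-good-triangle` applies within each class.
        InS : Fin n → Set
        InS z = ¬ Deficient z × (GoodEdge k u z ⊎ GoodEdge k v z)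

        InS? : Decidable InS
        InS? z = ¬? (Deficient? z) ×-dec (GoodEdge? k u z ⊎-dec GoodEdge? k v z)

        Missed : Fin n → Set
        Missed z = ¬ E u z × ¬ E v z

        Missed? : Decidable Missed
        Missed? z = ¬? (E? u z) ×-dec ¬? (E? v z)

        Bad₂ Bad₃ : Fin n → Set
        Bad₂ z = BadEdge k v z ⊎ Missed z
        Bad₃ z = BadEdge k u z ⊎ Bad₂ z

        classify : ∀ z → ¬ InS z → Deficient z ⊎ Bad₃ z
        classify z ¬s = case (Deficient? z) (E? u z) (E? v z) (k * CR u z ≤? n) (k * CR v z ≤? n)
          where
          case : Dec (Deficient z) → Dec (E u z) → Dec (E v z) → Dec (k * CR u z ≤ n) → Dec (k * CR v z ≤ n) → Deficient z ⊎ Bad₃ z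
          case (yes p) _        _        _       _       = inj₁ p
          case (no ¬p) (yes uz) _        (yes g) _       = ⊥-elim (¬s (¬p , inj₁ (uz , g)))
          case (no ¬p) (yes uz) _        (no ¬g) _       = inj₂ (inj₁ (uz , ≰⇒> ¬g))
          case (no ¬p) (no ¬uz) (yes vz) _       (yes g) = ⊥-elim (¬s (¬p , inj₂ (vz , g)))
          case (no ¬p) (no ¬uz) (yes vz) _       (no ¬g) = inj₂ (inj₂ (inj₁ (vz , ≰⇒> ¬g)))
          case (no ¬p) (no ¬uz) (no ¬vz) _       _       = inj₂ (inj₂ (inj₂ (¬uz , ¬vz)))

        Bad₂? : Decidable Bad₂
        Bad₂? z = BadEdge? k v z ⊎-dec Missed? z

        Bad₃? : Decidable Bad₃
        Bad₃? z = BadEdge? k u z ⊎-dec Bad₂? z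

        outside : # (λ z → ¬? (InS? z)) ∣ highs ≤ # Deficient? ∣ highs + (# BadEdge? k u ∣ highs + (# BadEdge? k v ∣ highs + # Missed? ∣ highs))
        outside = ≤-trans (#-∪ (λ z → ¬? (InS? z)) Deficient? Bad₃? (All.universal classify highs))
          (+-monoʳ-≤ (# Deficient? ∣ highs) (≤-trans (#-∪ Bad₃? (BadEdge? k u) Bad₂? (All.universal (λ _ p → p) highs))
          (+-monoʳ-≤ (# BadEdge? k u ∣ highs) (#-∪ Bad₂? (BadEdge? k v) Missed? (All.universal (λ _ p → p) highs)))))

        missed : # Missed? ∣ highs + (d u + d v) ≤ n * 1 + C u v
        missed = begin
          # Missed? ∣ highs + (d u + d v)
            ≤⟨ +-monoˡ-≤ (d u + d v) (#-filter High? Missed? Missed? vertices (λ _ _ p → p)) ⟩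
          # Missed? ∣ vertices + (d u + d v)
            ≡⟨ cong₂ _+_ (≡-sym (∑-ind Missed? vertices)) (≡-sym (∑-+ vertices (A u) (A v))) ⟩
          ∑ vertices (λ z → ind (does (Missed? z))) + ∑ vertices (λ z → A u z + A v z)  ≡⟨ ≡-sym (∑-+ vertices _ _) ⟩
          ∑ vertices (λ z → ind (does (Missed? z)) + (A u z + A v z))    ≤⟨ ∑-mono vertices pointwise ⟩
          ∑ vertices (λ z → 1 + A u z * A v z)                           ≡⟨ trans (∑-+ vertices _ _) (cong (_+ C u v) (∑-vertices-const 1)) ⟩
          n * 1 + C u v                                                  ∎
          where
          open ≤-Reasoning
          pointwise : ∀ z → ind (does (Missed? z)) + (A u z + A v z) ≤ 1 + A u z * A v z
          pointwise z with adj G u z | adj G v z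
          ... | true  | true  = ≤-refl
          ... | true  | false = ≤-refl
          ... | false | true  = ≤-refl
          ... | false | false = ≤-refl

        S : Fin n → Bool
        S z = does (InS? z)

        S-sound : ∀ z → T (S z) → InS z
        S-sound z = T-does⁻ (InS? z)

        #S≤card : # InS? ∣ highs ≤ card S
        #S≤card = #-filter High? InS? (λ z → T? (S z)) vertices (λ z _ → T-does⁺ (InS? z))

        -- Lost are at most n / k low vertices, n / k along bad edges at each of `u` and `v`, n / M
        -- deficient vertices, and 2 n / M + 2 n / k vertices missed by both ends. The total 3 n / M
        -- + 5 n / k stays below 4 n / M because k ≥ 48 M.
        card-large : M * n ≤ M * card S + 4 * n
        card-large = ≤-trans (arith k M n ℓ r (# InS? ∣ highs) (# (λ z → ¬? (InS? z)) ∣ highs) δ (# BadEdge? k u ∣ highs) (# BadEdge? k v ∣ highs) (# Missed? ∣ highs)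
            (d u) (d v) (C u v) ℓ+r≡n (#-split InS? highs)
            (≤-trans outside (+-monoˡ-≤ _ deficient≤)) kℓ≤n (≮⇒≥ ¬bad-u) (≮⇒≥ ¬bad-v) missed (good-codegree uv)
            (<⇒≤ (≰⇒> ¬def-u)) (<⇒≤ (≰⇒> ¬def-v)) δ≤ k≥48M k≥1)
          (+-monoˡ-≤ (4 * n) (*-monoʳ-≤ M #S≤card))
          where
          arith : ∀ k M n ℓ r x o δ bu bv m du dv c → ℓ + r ≡ n → x + o ≡ r → o ≤ δ + (bu + (bv + m)) →
            k * ℓ ≤ n → k * bu ≤ n → k * bv ≤ n → m + (du + dv) ≤ n * 1 + c → k * c ≤ 2 * n →
            M * n ≤ 2 * M * du + 2 * n → M * n ≤ 2 * M * dv + 2 * n → M * δ ≤ n → 48 * M ≤ k → 1 ≤ k → M * n ≤ M * x + 4 * n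
          arith k M n ℓ r x o δ bu bv m du dv c refl refl h hℓ hu hv hm hc hdu hdv hδ hk k≥1 =
            *-cancelˡ-≤ k {{>-nonZero k≥1}} (*-cancelˡ-≤ 48
              (from (48 * (k * (M * (ℓ + (x + o))))) (48 * (k * (M * x + 4 * (ℓ + (x + o))))) (43 * (k * (ℓ + (x + o))))
              (48 * (k * M) ⊗ h ⊕ 48 * M ⊗ hℓ ⊕ 48 * M ⊗ hu ⊕ 48 * M ⊗ hv ⊕ 48 * (k * M) ⊗ hm ⊕ 48 * M ⊗ hc ⊕ 24 * k ⊗ hdu ⊕ 24 * k ⊗ hdv
                ⊕ 48 * k ⊗ hδ ⊕ 5 * (ℓ + (x + o)) ⊗ hk)
              (eq k M ℓ x o δ bu bv m du dv c)))
            where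
            eq : ∀ k M ℓ x o δ bu bv m du dv c → let n = ℓ + (x + o) in
              48 * (k * (M * n)) + (48 * (k * M) * (δ + (bu + (bv + m))) + (48 * M * n + (48 * M * n + (48 * M * n + (48 * (k * M) * (n * 1 + c) + (48 * M * (2 * n)
                + (24 * k * (2 * M * du + 2 * n) + (24 * k * (2 * M * dv + 2 * n) + (48 * k * n + 5 * n * k))))))))) + 43 * (k * n)
              ≡ 48 * (k * (M * x + 4 * n)) + (48 * (k * M) * o + (48 * M * (k * ℓ) + (48 * M * (k * bu) + (48 * M * (k * bv) + (48 * (k * M) * (m + (du + dv))
                + (48 * M * (k * c) + (24 * k * (M * n) + (24 * k * (M * n) + (48 * k * (M * δ) + 5 * n * (48 * M))))))))))
            eq = solve-∀

        -- The degree exceeds n / 2 - n / M and at most 4 n / M neighbours lie outside `S`; the 10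
        -- is twice 1 + 4.
        degree-large : ∀ z → T (S z) → M * n ≤ 2 * M * degIn G S z + 10 * n
        degree-large z t = arith M n (d z) (degIn G S z) (card S) loss (<⇒≤ (≰⇒> (proj₁ (S-sound z t)))) card-large
          where
          loss : d z + card S ≤ n * 1 + degIn G S z
          loss = begin
            d z + card S                                              ≡⟨ cong (d z +_) (≡-sym (∑-ind (λ w → T? (S w)) vertices)) ⟩
            d z + ∑ vertices (λ w → ind (S w))                        ≡⟨ ≡-sym (∑-+ vertices _ _) ⟩
            ∑ vertices (λ w → A z w + ind (S w))                      ≤⟨ ∑-mono vertices (λ w → table (adj G z w) (S w)) ⟩
            ∑ vertices (λ w → 1 + ind (S w ∧ adj G z w))              ≡⟨ trans (∑-+ vertices _ _) (cong₂ _+_ (∑-vertices-const 1) (∑-ind (λ w → T? (S w ∧ adj G z w)) vertices)) ⟩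
            n * 1 + degIn G S z                                       ∎
            where
            open ≤-Reasoning
            table : ∀ a s → ind a + ind s ≤ 1 + ind (s ∧ a)
            table true  true  = ≤-refl
            table true  false = ≤-refl
            table false true  = ≤-refl
            table false false = z≤n
          arith : ∀ M n x y c → x + c ≤ n * 1 + y → M * n ≤ 2 * M * x + 2 * n → M * n ≤ M * c + 4 * n → M * n ≤ 2 * M * y + 10 * n
          arith M n x y c h₁ h₂ h₃ = from (M * n) (2 * M * y + 10 * n) 0 (2 * M ⊗ h₁ ⊕ h₂ ⊕ 2 ⊗ h₃) (eq M n x y c)
            where
            eq : ∀ M n x y c → M * n + (2 * M * (n * 1 + y) + (2 * M * x + 2 * n + 2 * (M * c + 4 * n))) + 0
                 ≡ 2 * M * y + 10 * n + (2 * M * (x + c) + (M * n + 2 * (M * n)))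
            eq = solve-∀

        col : Fin n → Bool
        col z = does (GoodEdge? k u z)

        -- Equal colours put both vertices into the good neighbourhood of `u`, or else both into
        -- that of `v`; an edge between them would close a triangle with two good sides.
        bipartite : InducedBipartite G S
        bipartite = col , λ x y sx sy xy same → proper x y (S-sound x sx) (S-sound y sy) xy same
          where
          proper : ∀ x y → InS x → InS y → E x y → col x ≡ col y → ⊥
          proper x y (¬dx , gx) (¬dy , gy) xy same = case (same-answer (GoodEdge? k u x) (GoodEdge? k u y) same) gx gy
            where
            case : (GoodEdge k u x × GoodEdge k u y) ⊎ (¬ GoodEdge k u x × ¬ GoodEdge k u y) →
                   GoodEdge k u x ⊎ GoodEdge k v x → GoodEdge k u y ⊎ GoodEdge k v y → ⊥
            case (inj₁ (ux , uy))   _         _         = no-good-triangle ¬def-u ¬dx ¬dy ux uy xy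
            case (inj₂ (¬ux , ¬uy)) (inj₁ ux) _         = ¬ux ux
            case (inj₂ (¬ux , ¬uy)) (inj₂ vx) (inj₁ uy) = ¬uy uy
            case (inj₂ (¬ux , ¬uy)) (inj₂ vx) (inj₂ vy) = no-good-triangle ¬def-v ¬dx ¬dy vx vy xy

  -- Choice of the constants and of the order threshold

  All⇒∃ : ∀ {X : Set} {Q : X → Set} {xs : List X} → 1 ≤ length xs → All Q xs → Σ X Q
  All⇒∃ _ (q ∷ _) = _ , q

  avoid : ∀ {X : Set} {Cls P Q : X → Set} (P? : Decidable P) (Q? : Decidable Q) {xs} p q → All Cls xs →
          # P? ∣ xs ≤ p → # Q? ∣ xs ≤ q → suc (p + q) ≤ length xs → Σ X λ x → Cls x × ¬ P x × ¬ Q x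
  avoid P? Q? {xs} p q cls p≤ q≤ h = All⇒∃ ys≥1
    (All.zip (All-resp-⊆ ys⊆xs cls , All.zip (All-resp-⊆ ys⊆ (all-filter (λ x → ¬? (P? x)) xs) , all-filter (λ x → ¬? (Q? x)) (filter (λ x → ¬? (P? x)) xs))))
    where
    xs′ ys : List _
    xs′ = filter (λ x → ¬? (P? x)) xs
    ys  = filter (λ x → ¬? (Q? x)) xs′
    ys⊆ : ys ⊆ xs′
    ys⊆ = filter-⊆ (λ x → ¬? (Q? x)) xs′
    ys⊆xs : ys ⊆ xs
    ys⊆xs = ⊆-trans ys⊆ (filter-⊆ (λ x → ¬? (P? x)) xs)
    ys≥1 : 1 ≤ length ys
    ys≥1 = +-cancelˡ-≤ (p + q) 1 (length ys) (begin
      p + q + 1                                 ≡⟨ +-comm (p + q) 1 ⟩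
      suc (p + q)                               ≤⟨ h ⟩
      length xs                                 ≡⟨ ≡-sym (#-split P? xs) ⟩
      # P? ∣ xs + length xs′                    ≡⟨ cong (# P? ∣ xs +_) (≡-sym (#-split Q? xs′)) ⟩
      # P? ∣ xs + (# Q? ∣ xs′ + length ys)      ≤⟨ +-mono-≤ p≤ (+-monoˡ-≤ (length ys) (≤-trans (#-filter (λ x → ¬? (P? x)) Q? Q? xs (λ _ _ z → z)) q≤)) ⟩
      p + (q + length ys)                       ≡⟨ ≡-sym (+-assoc p q _) ⟩
      p + q + length ys                         ∎)
      where open ≤-Reasoning

  -- In quotients: order at least (1 - 4/M) n and minimum degree at least (1/2 - 5/M) n.
  NearlyBipartite : ∀ {n} → Graph n → ℕ → Set
  NearlyBipartite {n} G M = Σ (Fin n → Bool) λ S → InducedBipartite G S × M * n ≤ M * card S + 4 * n ×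
    (∀ z → T (S z) → M * n ≤ 2 * M * degIn G S z + 10 * n)

  -- Two list sizes occur: k for the degree estimate, and k₁ = c k for showing ℓ < n / k, where
  -- `lows-few` is used with ε = k. The Ramsey-type quantities enter as variables with bounds, so
  -- that none of them has to be evaluated.
  structure : ∀ {n} (G : Graph n) {N b} → Bookless G N b → ∀ κ M c k k₁ N₀ y z₁ z₂ β δ f → 2000 ≤ κ → 20 ≤ M →
    k ≡ 16 * M * (1 + 2 * M) → k₁ ≡ c * k → 5 * 3456 ≤ c →
    bad-bound κ N k₁ + (ramsey κ (2 * (k₁ * k₁)) + ramsey κ k₁) ≤ N₀ →
    2 * (kst-factor k₁ k₁ * suc (ramsey κ k₁)) ≤ y → 12 * (1 + ramsey (2 * (κ * 2)) κ) ≤ z₁ → kst-factor κ 2 * suc (ramsey κ κ) ≤ z₂ →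
    bad-bound κ N k ≡ β → β + ramsey κ (2 * (k * k)) ≤ δ → kst-factor k k * suc (ramsey κ k) ≤ f →
    4000 ≤ n → 24 * N < n → bad-size κ N k₁ ≤ n → bad-size κ N k ≤ n → k * (c + (z₁ + z₂)) ≤ n → 3 * (y + (1 + 624 * N₀)) ≤ n →
    2 * f ≤ n → k ≤ n → M * δ ≤ n → k * suc (β + δ) ≤ n → NearlyBipartite G M
  structure {n} G {N} {b} bookless κ M c k k₁ N₀ y z₁ z₂ β δ f κ≥ M≥ k≡ k₁≡ c≥ N₀≥ y≥ z₁≥ z₂≥ β≡ δ≥ f≥
            n≥ n> size₁ size₂ size₃ size₄ size₅ k≤n Mδ≤n size₆ = finish first
    where
    open Structure G bookless κ κ≥ n≥ M k k≡ M≥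
    k₁≥1 : 1 ≤ k₁
    k₁≥1 = ≤-trans (*-mono-≤ (≤-trans (s≤s z≤n) c≥) k≥1) (≤-reflexive (≡-sym k₁≡))
    kℓ≤n : k * ℓ ≤ n
    kℓ≤n = <⇒≤ (lows-few c k k₁ N₀ y z₁ z₂ k₁≡ c≥ k₁≥1 N₀≥ y≥ z₁≥ z₂≥ size₃ size₄ (bad-few k₁ k₁≥1 size₁ n>))
    bad≤ : # Bad? k ∣ highs ≤ bad-bound κ N k
    bad≤ = bad-few k k≥1 size₂ n>
    bad≤β : # Bad? k ∣ highs ≤ β
    bad≤β = ≤-trans bad≤ (≤-reflexive β≡)
    half : ∀ {x} → 2 * x ≤ n → x ≤ r
    half {x} h = arith n ℓ r k x h kℓ≤n (≤-trans (s≤s (s≤s z≤n)) k≥48) ℓ+r≡n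
      where
      arith : ∀ n ℓ r k x → 2 * x ≤ n → k * ℓ ≤ n → 2 ≤ k → ℓ + r ≡ n → x ≤ r
      arith n ℓ r k x h₁ h₂ h₃ refl = *-cancelˡ-≤ 2 (from (2 * x) (2 * r) 0 (h₁ ⊕ h₂ ⊕ ℓ ⊗ h₃) (eq ℓ r k x))
        where
        eq : ∀ ℓ r k x → 2 * x + (ℓ + r + (ℓ + r + ℓ * k)) + 0 ≡ 2 * r + (2 * x + (k * ℓ + ℓ * 2))
        eq = solve-∀
    deficient≤ : # Deficient? ∣ highs ≤ δ
    deficient≤ = ≤-trans (deficient-few kℓ≤n bad≤ k≤n (≤-trans f≥ (half size₅))) (≤-trans (+-monoˡ-≤ (ramsey κ (2 * (k * k))) (≤-reflexive β≡)) δ≥)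
    first : Σ (Fin n) λ u → High u × ¬ Bad k u × ¬ Deficient u
    first = avoid (Bad? k) Deficient? β δ highs-High bad≤β deficient≤ (half (≤-trans (*-monoˡ-≤ (suc (β + δ)) (≤-trans (s≤s (s≤s z≤n)) k≥48)) size₆))
    finish : (Σ (Fin n) λ u → High u × ¬ Bad k u × ¬ Deficient u) → NearlyBipartite G M
    finish (u , high , ¬bad , ¬def) = conclude second
      where
      second : Σ (Fin n) λ v → GoodEdge k u v × ¬ Bad k v × ¬ Deficient v
      second = avoid (Bad? k) Deficient? β δ (all-filter (GoodEdge? k u) highs)
        (≤-trans (#-filter (GoodEdge? k u) (Bad? k) (Bad? k) highs (λ _ _ p → p)) bad≤β)
        (≤-trans (#-filter (GoodEdge? k u) Deficient? Deficient? highs (λ _ _ p → p)) deficient≤)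
        (*-cancelˡ-bound k k≥1 size₆ (good-neighbours kℓ≤n bad≤ high ¬bad))
      conclude : (Σ (Fin n) λ v → GoodEdge k u v × ¬ Bad k v × ¬ Deficient v) → NearlyBipartite G M
      conclude (v , uv , ¬bad-v , ¬def-v) = S , bipartite , card-large , degree-large
        where open Bipartition kℓ≤n bad≤ δ deficient≤ Mδ≤n u v ¬bad ¬bad-v ¬def ¬def-v uv

  summands-≤ : ∀ ts {n} → ∑ ts (λ t → t) ≤ n → All (_≤ n) ts
  summands-≤ []       h = []
  summands-≤ (t ∷ ts) h = m+n≤o⇒m≤o t h ∷ summands-≤ ts (m+n≤o⇒n≤o t h)

  threshold : ∀ κ M N c k k₁ N₀ y z₁ z₂ β δ f s₁ s₂ → 2000 ≤ κ → 20 ≤ M →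
    k ≡ 16 * M * (1 + 2 * M) → k₁ ≡ c * k → 5 * 3456 ≤ c →
    bad-bound κ N k₁ + (ramsey κ (2 * (k₁ * k₁)) + ramsey κ k₁) ≤ N₀ →
    2 * (kst-factor k₁ k₁ * suc (ramsey κ k₁)) ≤ y → 12 * (1 + ramsey (2 * (κ * 2)) κ) ≤ z₁ → kst-factor κ 2 * suc (ramsey κ κ) ≤ z₂ →
    bad-bound κ N k ≡ β → β + ramsey κ (2 * (k * k)) ≤ δ → kst-factor k k * suc (ramsey κ k) ≤ f → bad-size κ N k₁ ≤ s₁ → bad-size κ N k ≤ s₂ →
    Σ ℕ λ n₀ → ∀ n → n₀ ≤ n → (G : Graph n) → ∀ b → Bookless G N b → 1 ≤ n × NearlyBipartite G M
  threshold κ M N c k k₁ N₀ y z₁ z₂ β δ f s₁ s₂ κ≥ M≥ k≡ k₁≡ c≥ N₀≥ y≥ z₁≥ z₂≥ β≡ δ≥ f≥ s₁≥ s₂≥ = ∑ sizes (λ t → t) , result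
    where
    sizes : List ℕ
    -- The threshold is the sum of all demands on n, so it dominates each of them.
    sizes = 4000 ∷ suc (24 * N) ∷ s₁ ∷ s₂ ∷ k * (c + (z₁ + z₂)) ∷ 3 * (y + (1 + 624 * N₀)) ∷ 2 * f ∷ k ∷ M * δ ∷ k * suc (β + δ) ∷ []
    result : ∀ n → ∑ sizes (λ t → t) ≤ n → (G : Graph n) → ∀ b → Bookless G N b → 1 ≤ n × NearlyBipartite G M
    result n h G b bookless = use (summands-≤ sizes h)
      where
      use : All (_≤ n) sizes → 1 ≤ n × NearlyBipartite G M
      use (n≥ ∷ n> ∷ h₁ ∷ h₂ ∷ h₃ ∷ h₄ ∷ h₅ ∷ h₆ ∷ h₇ ∷ h₈ ∷ []) = ≤-trans (s≤s z≤n) n≥ ,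
        structure G bookless κ M c k k₁ N₀ y z₁ z₂ β δ f κ≥ M≥ k≡ k₁≡ c≥ N₀≥ y≥ z₁≥ z₂≥ β≡ δ≥ f≥
          n≥ n> (≤-trans s₁≥ h₁) (≤-trans s₂≥ h₂) h₃ h₄ h₅ h₆ h₇ h₈

  bookless⇒nearly-bipartite : ∀ M N → 20 ≤ M →
    Σ ℕ λ n₀ → ∀ n → n₀ ≤ n → (G : Graph n) → ∀ b → Bookless G N b → 1 ≤ n × NearlyBipartite G M
  -- The numerals are generalised to `κ` and `c` before any Ramsey expression is formed, which keeps
  -- these expressions symbolic.
  bookless⇒nearly-bipartite M N M≥ = from-constants 2000 ≤-refl (5 * 3456) ≤-refl
    where
    from-constants : ∀ κ → 2000 ≤ κ → ∀ c → 5 * 3456 ≤ c →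
      Σ ℕ λ n₀ → ∀ n → n₀ ≤ n → (G : Graph n) → ∀ b → Bookless G N b → 1 ≤ n × NearlyBipartite G M
    from-constants κ κ≥ c c≥ = threshold κ M N c _ _ _ _ _ _ _ _ _ _ _ κ≥ M≥ refl refl c≥ ≤-refl ≤-refl ≤-refl ≤-refl refl ≤-refl ≤-refl ≤-refl ≤-refl

  -- From booksizes to codegree bounds

  max-bound : ∀ {x} {xs : List ℕ} → x ∈ xs → x ≤ foldr _⊔_ 0 xs
  max-bound {xs = y ∷ ys} (here refl) = m≤m⊔n y (foldr _⊔_ 0 ys)
  max-bound {xs = y ∷ ys} (there p)   = ≤-trans (max-bound p) (m≤n⊔m y (foldr _⊔_ 0 ys))

  entry-bound : ∀ {n} {f : Fin n → Fin n → ℕ} u v → f u v ≤ foldr _⊔_ 0 (concatMap (λ u′ → map (f u′) (allFin n)) (allFin n))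
  entry-bound {f = f} u v = max-bound (∈-concat⁺′ (∈-map⁺ (f u) (∈-allFin v)) (∈-map⁺ (λ u′ → map (f u′) (allFin _)) (∈-allFin u)))

  -- Pins the implicit function of entry-bound, which is local to bkAdj.
  bkAdj-bound : ∀ {n} (a : Fin n → Fin n → Bool) {x} → x ≤ bkAdj a → x ≤ bkAdj a
  bkAdj-bound a p = p

  -- Abstracting `a u v` also inside the bound makes the entry for `u`, `v` in the maximum reduce to
  -- the codegree.
  commonNbrs≤bkAdj : ∀ {n} (a : Fin n → Fin n → Bool) u v → T (a u v) → commonNbrs a u v ≤ bkAdj a
  commonNbrs≤bkAdj a u v t with a u v | t | bkAdj-bound a (entry-bound u v)
  ... | true | _ | p = p

  module _ {n : ℕ} (G : Graph n) where
    open Counting G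

    C≤bk : ∀ u v → E u v → C u v ≤ bk G
    C≤bk u v uv = ≤-trans (≤-reflexive (trans (∑-cong vertices (λ z → table (adj G u z) (adj G v z))) (∑-ind (λ z → T? (adj G u z ∧ adj G v z)) vertices)))
      (commonNbrs≤bkAdj (adj G) u v uv)
      where
      table : ∀ p q → ind p * ind q ≡ ind (p ∧ q)
      table true  true  = refl
      table true  false = refl
      table false _     = refl

    -- `Ā` is 1 on the diagonal, so `C̄` may count `u` and `v` on top of the common neighbours in
    -- the complement.
    C̄≤bkComp : ∀ u v → F u v → C̄ u v ≤ bkComp G + 2
    C̄≤bkComp u v uv = begin
      C̄ u v                                                 ≤⟨ ∑-mono vertices pointwise ⟩
      ∑ vertices (λ z → ind (compAdj G u z ∧ compAdj G v z) + (ind (does (u Fin.≟ z)) + ind (does (v Fin.≟ z))))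
        ≡⟨ trans (∑-+ vertices _ _) (cong₂ _+_ (∑-ind (λ z → T? (compAdj G u z ∧ compAdj G v z)) vertices) (∑-+ vertices _ _)) ⟩
      commonNbrs (compAdj G) u v + (∑ vertices (λ z → ind (does (u Fin.≟ z))) + ∑ vertices (λ z → ind (does (v Fin.≟ z))))
        ≤⟨ +-mono-≤ (commonNbrs≤bkAdj (compAdj G) u v uv) (+-mono-≤ (once u) (once v)) ⟩
      bkComp G + 2                                          ∎
      where
      open ≤-Reasoning
      once : ∀ w → ∑ vertices (λ z → ind (does (w Fin.≟ z))) ≤ 1
      once w = ≤-trans (≤-reflexive (∑-ind (w Fin.≟_) vertices)) (unique-count w (allFin⁺ n))
      table : ∀ s t p q → ind p * ind q ≤ ind ((not s ∧ p) ∧ (not t ∧ q)) + (ind s + ind t)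
      table _     _     false _     = z≤n
      table _     _     true  false = z≤n
      table true  _     true  true  = s≤s z≤n
      table false true  true  true  = s≤s z≤n
      table false false true  true  = s≤s z≤n
      pointwise : ∀ z → Ā u z * Ā v z ≤ ind (compAdj G u z ∧ compAdj G v z) + (ind (does (u Fin.≟ z)) + ind (does (v Fin.≟ z)))
      pointwise z = table (does (u Fin.≟ z)) (does (v Fin.≟ z)) (not (adj G u z)) (not (adj G v z))

    small-books : ∀ {N} → 1 ≤ N → 2 * bkComp G ≤ n → 12 * (N * bk G) + n ≤ N * n → Bookless G N (bk G)
    small-books N≥1 comp≤ bk≤ = record
      { edge-book    = C≤bk
      ; nonedge-book = λ u v uv → arith n (bkComp G) (C̄ u v) (C̄≤bkComp u v uv) comp≤
      ; N≥1          = N≥1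
      ; b-bound      = bk≤
      }
      where
      arith : ∀ n x c → c ≤ x + 2 → 2 * x ≤ n → 2 * c ≤ n + 4
      arith n x c h₁ h₂ = from (2 * c) (n + 4) 0 (2 ⊗ h₁ ⊕ h₂) (eq n x c)
        where
        eq : ∀ n x c → 2 * c + (2 * (x + 2) + n) + 0 ≡ n + 4 + (2 * c + 2 * x)
        eq = solve-∀

open BooklessGraphs using (bookless⇒nearly-bipartite; small-books; NearlyBipartite)
open import Data.Nat using (ℕ; _≥_)
open import Data.Bool using (Bool; T)
open import Data.Fin using (Fin)
open import Data.Integer using (+_)
open import Data.Rational using (ℚ; _/_; _<_; _≤_; _*_; _-_; 0ℚ; 1ℚ)
open import Data.Product using (Σ; _×_)
open import Data.Sum using (_⊎_)

import Data.Nat as ℕ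
import Data.Nat.Properties as ℕ
import Data.Integer as ℤ
import Data.Integer.Properties as ℤ
open import Data.Integer.Tactic.RingSolver using (solve-∀)
open import Data.Product using (_,_; proj₁; proj₂)
open import Data.Rational using (mkℚ; toℚᵘ; ↧ₙ_; _+_; -_; Positive; NonNegative; positive; nonNegative)
import Data.Rational.Properties as ℚ
open import Data.Rational.Solver using (module +-*-Solver)
open import Data.Rational.Unnormalised using (mkℚᵘ; *≡*; *≤*; *<*) renaming (_≃_ to _≃ᵘ_; _+_ to _+ᵘ_; _*_ to _*ᵘ_)
import Data.Rational.Unnormalised.Properties as ℚᵘ
open import Data.Sum using (inj₁; inj₂)
open import Relation.Binary.PropositionalEquality using (_≡_; refl; trans; cong; cong₂; subst; subst₂) renaming (sym to ≡-sym)
open import Relation.Nullary using (Dec; yes; no; contradiction)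

-- Rational inequalities and their integral forms

toℚᵘ-ℕ : ∀ k → toℚᵘ (ℕ→ℚ k) ≃ᵘ mkℚᵘ (+ k) 0
toℚᵘ-ℕ k = ℚ.toℚᵘ-fromℚᵘ (mkℚᵘ (+ k) 0)

ℕ→ℚ-+ : ∀ a b → ℕ→ℚ (a ℕ.+ b) ≡ ℕ→ℚ a + ℕ→ℚ b
ℕ→ℚ-+ a b = ℚ.toℚᵘ-injective (ℚᵘ.≃-trans (toℚᵘ-ℕ (a ℕ.+ b)) (ℚᵘ.≃-trans (*≡* (eq (+ a) (+ b)))
  (ℚᵘ.≃-trans (ℚᵘ.≃-sym (ℚᵘ.+-cong (toℚᵘ-ℕ a) (toℚᵘ-ℕ b))) (ℚᵘ.≃-sym (ℚ.toℚᵘ-homo-+ (ℕ→ℚ a) (ℕ→ℚ b))))))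
  where
  eq : ∀ x y → (x ℤ.+ y) ℤ.* (+ 1) ≡ (x ℤ.* (+ 1) ℤ.+ y ℤ.* (+ 1)) ℤ.* (+ 1)
  eq = solve-∀

ℕ→ℚ-* : ∀ a b → ℕ→ℚ (a ℕ.* b) ≡ ℕ→ℚ a * ℕ→ℚ b
ℕ→ℚ-* a b = ℚ.toℚᵘ-injective (ℚᵘ.≃-trans (toℚᵘ-ℕ (a ℕ.* b)) (ℚᵘ.≃-trans (*≡* (cong (ℤ._* (+ 1)) (ℤ.pos-* a b)))
  (ℚᵘ.≃-trans (ℚᵘ.≃-sym (ℚᵘ.*-cong (toℚᵘ-ℕ a) (toℚᵘ-ℕ b))) (ℚᵘ.≃-sym (ℚ.toℚᵘ-homo-* (ℕ→ℚ a) (ℕ→ℚ b))))))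

ℕ→ℚ-mono-≤ : ∀ {a b} → a ℕ.≤ b → ℕ→ℚ a ≤ ℕ→ℚ b
ℕ→ℚ-mono-≤ {a} {b} h = ℚ.toℚᵘ-cancel-≤ (ℚᵘ.≤-respˡ-≃ (ℚᵘ.≃-sym (toℚᵘ-ℕ a)) (ℚᵘ.≤-respʳ-≃ (ℚᵘ.≃-sym (toℚᵘ-ℕ b))
  (*≤* (ℤ.*-monoʳ-≤-nonNeg (+ 1) (ℤ.+≤+ h)))))

ℕ→ℚ-mono-< : ∀ {a b} → a ℕ.< b → ℕ→ℚ a < ℕ→ℚ b
ℕ→ℚ-mono-< {a} {b} h = ℚ.toℚᵘ-cancel-< (ℚᵘ.<-respˡ-≃ (ℚᵘ.≃-sym (toℚᵘ-ℕ a)) (ℚᵘ.<-respʳ-≃ (ℚᵘ.≃-sym (toℚᵘ-ℕ b))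
  (*<* (ℤ.*-monoʳ-<-pos (+ 1) (ℤ.+<+ h)))))

ℕ→ℚ-cancel-≤ : ∀ {a b} → ℕ→ℚ a ≤ ℕ→ℚ b → a ℕ.≤ b
ℕ→ℚ-cancel-≤ {a} {b} h with a ℕ.≤? b
... | yes p = p
... | no ¬p = contradiction refl (ℚ.<⇒≢ (ℚ.<-≤-trans (ℕ→ℚ-mono-< (ℕ.≰⇒> ¬p)) h))

ℕ→ℚ-nonNegative : ∀ k → NonNegative (ℕ→ℚ k)
ℕ→ℚ-nonNegative k = nonNegative (ℕ→ℚ-mono-≤ {0} {k} ℕ.z≤n)

-- A positive rational times its denominator is its numerator, a positive integer. In this way `η`
-- and `ξ` are traded for the integers N and M.
1≤p*↧p : ∀ p → 0ℚ < p → 1ℚ ≤ p * ℕ→ℚ (↧ₙ p)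
1≤p*↧p p@(mkℚ (+ ℕ.suc m) d c) _ = subst (1ℚ ≤_) (≡-sym eq) (ℕ→ℚ-mono-≤ {1} {ℕ.suc m} (ℕ.s≤s ℕ.z≤n))
  where
  eq : p * ℕ→ℚ (ℕ.suc d) ≡ ℕ→ℚ (ℕ.suc m)
  eq = ℚ.toℚᵘ-injective (ℚᵘ.≃-trans (ℚ.toℚᵘ-homo-* p (ℕ→ℚ (ℕ.suc d))) (ℚᵘ.≃-trans (ℚᵘ.*-cong {toℚᵘ p} ℚᵘ.≃-refl (toℚᵘ-ℕ (ℕ.suc d)))
    (ℚᵘ.≃-trans (*≡* (trans (ℤ.*-identityʳ _) (cong (λ z → + ℕ.suc m ℤ.* (+ z)) (≡-sym (ℕ.*-identityʳ (ℕ.suc d)))))) (ℚᵘ.≃-sym (toℚᵘ-ℕ (ℕ.suc m))))))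
1≤p*↧p (mkℚ (+ 0) d c) h = contradiction (positive h) λ ()
1≤p*↧p (mkℚ ℤ.-[1+ m ] d c) h = contradiction (positive h) λ ()

+-cancelʳ-≤ : ∀ p q r → p + r ≤ q + r → p ≤ q
+-cancelʳ-≤ p q r h = subst₂ _≤_ (eq p r) (eq q r) (ℚ.+-monoˡ-≤ (- r) h)
  where
  open +-*-Solver
  eq : ∀ p r → p + r + - r ≡ p
  eq = solve 2 (λ p r → p :+ r :+ :- r := p) refl

+-cancelʳ-< : ∀ p q r → p + r < q + r → p < q
+-cancelʳ-< p q r h = subst₂ _<_ (eq p r) (eq q r) (ℚ.+-monoˡ-< (- r) h)
  where
  open +-*-Solver
  eq : ∀ p r → p + r + - r ≡ p
  eq = solve 2 (λ p r → p :+ r :+ :- r := p) refl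

-- With D = `↧ₙ η`, η D ≥ 1 gives 12 D b + 12 n ≤ D n; the first step discards 11 n.
book-bound : ∀ b n η → 0ℚ < η → ℕ→ℚ b ≤ ((+ 1) / 12 - η) * ℕ→ℚ n → 12 ℕ.* (↧ₙ η ℕ.* b) ℕ.+ n ℕ.≤ ↧ₙ η ℕ.* n
book-bound b n η η>0 h = ℕ.≤-trans (ℕ.+-monoʳ-≤ (12 ℕ.* (↧ₙ η ℕ.* b)) (ℕ.m≤m+n n (11 ℕ.* n)))
  (ℕ→ℚ-cancel-≤ (subst₂ _≤_ (≡-sym lhs) (≡-sym (ℕ→ℚ-* D n)) (main (ℕ→ℚ b) (ℕ→ℚ n) (ℕ→ℚ D) h (1≤p*↧p η η>0) (ℕ→ℚ-nonNegative n) (ℕ→ℚ-nonNegative D))))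
  where
  D : ℕ
  D = ↧ₙ η
  lhs : ℕ→ℚ (12 ℕ.* (D ℕ.* b) ℕ.+ 12 ℕ.* n) ≡ ℕ→ℚ 12 * (ℕ→ℚ D * ℕ→ℚ b) + ℕ→ℚ 12 * ℕ→ℚ n
  lhs = trans (ℕ→ℚ-+ (12 ℕ.* (D ℕ.* b)) (12 ℕ.* n))
    (cong₂ _+_ (trans (ℕ→ℚ-* 12 (D ℕ.* b)) (cong (ℕ→ℚ 12 *_) (ℕ→ℚ-* D b))) (ℕ→ℚ-* 12 n))
  main : ∀ β ν δ → β ≤ ((+ 1) / 12 - η) * ν → 1ℚ ≤ η * δ → NonNegative ν → NonNegative δ →
         ℕ→ℚ 12 * (δ * β) + ℕ→ℚ 12 * ν ≤ δ * ν
  main β ν δ h₁ h₂ ν≥0 δ≥0 = begin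
    ℕ→ℚ 12 * (δ * β) + ℕ→ℚ 12 * ν
      ≤⟨ ℚ.+-mono-≤ (ℚ.*-monoˡ-≤-nonNeg (ℕ→ℚ 12) (ℚ.*-monoˡ-≤-nonNeg δ {{δ≥0}} h₁))
                    (ℚ.*-monoˡ-≤-nonNeg (ℕ→ℚ 12) (subst (_≤ η * δ * ν) (ℚ.*-identityˡ ν) (ℚ.*-monoʳ-≤-nonNeg ν {{ν≥0}} h₂))) ⟩
    ℕ→ℚ 12 * (δ * (((+ 1) / 12 - η) * ν)) + ℕ→ℚ 12 * (η * δ * ν)  ≡⟨ eq η δ ν ⟩
    δ * ν                                                         ∎
    where
    open ℚ.≤-Reasoning
    open +-*-Solver
    eq : ∀ η δ ν → ℕ→ℚ 12 * (δ * (((+ 1) / 12 - η) * ν)) + ℕ→ℚ 12 * (η * δ * ν) ≡ δ * ν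
    eq = solve 3 (λ η δ ν → con (ℕ→ℚ 12) :* (δ :* ((con ((+ 1) / 12) :+ :- η) :* ν)) :+ con (ℕ→ℚ 12) :* (η :* δ :* ν) := δ :* ν) refl

complement-bound : ∀ x n → ℕ→ℚ x ≤ ℕ→ℚ n * ((+ 1) / 2) → 2 ℕ.* x ℕ.≤ n
complement-bound x n h = ℕ→ℚ-cancel-≤ (begin
  ℕ→ℚ (2 ℕ.* x)                    ≡⟨ ℕ→ℚ-* 2 x ⟩
  ℕ→ℚ 2 * ℕ→ℚ x                    ≤⟨ ℚ.*-monoˡ-≤-nonNeg (ℕ→ℚ 2) h ⟩
  ℕ→ℚ 2 * (ℕ→ℚ n * ((+ 1) / 2))    ≡⟨ eq (ℕ→ℚ n) ⟩
  ℕ→ℚ n                            ∎)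
  where
  open ℚ.≤-Reasoning
  open +-*-Solver
  eq : ∀ ν → ℕ→ℚ 2 * (ν * ((+ 1) / 2)) ≡ ν
  eq = solve 1 (λ ν → con (ℕ→ℚ 2) :* (ν :* con ((+ 1) / 2)) := ν) refl

module _ (ξ : ℚ) (ξ>0 : 0ℚ < ξ) where

  -- Then ξ M ≥ 20, so the losses 4 / M in order and 5 / M in degree stay below ξ and 2 ξ; the
  -- factor 20 also secures M ≥ 20, on which `no-good-triangle` relies.
  M : ℕ
  M = 20 ℕ.* ↧ₙ ξ

  M≥20 : 20 ℕ.≤ M
  M≥20 = ℕ.m≤m*n 20 (↧ₙ ξ)

  20≤ξM : ℕ→ℚ 20 ≤ ξ * ℕ→ℚ M
  20≤ξM = begin
    ℕ→ℚ 20                          ≡⟨ ≡-sym (ℚ.*-identityʳ (ℕ→ℚ 20)) ⟩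
    ℕ→ℚ 20 * 1ℚ                     ≤⟨ ℚ.*-monoˡ-≤-nonNeg (ℕ→ℚ 20) (1≤p*↧p ξ ξ>0) ⟩
    ℕ→ℚ 20 * (ξ * ℕ→ℚ (↧ₙ ξ))       ≡⟨ eq (ℕ→ℚ 20) ξ (ℕ→ℚ (↧ₙ ξ)) ⟩
    ξ * (ℕ→ℚ 20 * ℕ→ℚ (↧ₙ ξ))       ≡⟨ cong (ξ *_) (≡-sym (ℕ→ℚ-* 20 (↧ₙ ξ))) ⟩
    ξ * ℕ→ℚ M                       ∎
    where
    open ℚ.≤-Reasoning
    open +-*-Solver
    eq : ∀ a b c → a * (b * c) ≡ b * (a * c)
    eq = solve 3 (λ a b c → a :* (b :* c) := b :* (a :* c)) refl

  M-positive : Positive (ℕ→ℚ M)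
  M-positive = positive (ℕ→ℚ-mono-< {0} (ℕ.≤-trans (ℕ.s≤s ℕ.z≤n) M≥20))

  order-bound : ∀ n x → M ℕ.* n ℕ.≤ M ℕ.* x ℕ.+ 4 ℕ.* n → (1ℚ - ξ) * ℕ→ℚ n ≤ ℕ→ℚ x
  order-bound n x h = main (ℕ→ℚ M) (ℕ→ℚ n) (ℕ→ℚ x) M-positive (ℕ→ℚ-nonNegative n)
    (subst₂ _≤_ (ℕ→ℚ-* M n) (trans (ℕ→ℚ-+ (M ℕ.* x) (4 ℕ.* n)) (cong₂ _+_ (ℕ→ℚ-* M x) (ℕ→ℚ-* 4 n))) (ℕ→ℚ-mono-≤ h))
    (ℚ.≤-trans (ℕ→ℚ-mono-≤ (ℕ.m≤m+n 4 16)) 20≤ξM)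
    where
    main : ∀ μ ν χ → Positive μ → NonNegative ν → μ * ν ≤ μ * χ + ℕ→ℚ 4 * ν → ℕ→ℚ 4 ≤ ξ * μ → (1ℚ - ξ) * ν ≤ χ
    main μ ν χ μ>0 ν≥0 h₁ h₂ = ℚ.*-cancelˡ-≤-pos μ {{μ>0}} (+-cancelʳ-≤ _ _ (ξ * μ * ν) (begin
      μ * ((1ℚ - ξ) * ν) + ξ * μ * ν   ≡⟨ eq μ ν ξ ⟩
      μ * ν                            ≤⟨ h₁ ⟩
      μ * χ + ℕ→ℚ 4 * ν                ≤⟨ ℚ.+-monoʳ-≤ (μ * χ) (ℚ.*-monoʳ-≤-nonNeg ν {{ν≥0}} h₂) ⟩
      μ * χ + ξ * μ * ν                ∎))
      where
      open ℚ.≤-Reasoning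
      open +-*-Solver
      eq : ∀ μ ν ξ → μ * ((1ℚ - ξ) * ν) + ξ * μ * ν ≡ μ * ν
      eq = solve 3 (λ μ ν ξ → μ :* ((con 1ℚ :+ :- ξ) :* ν) :+ ξ :* μ :* ν := μ :* ν) refl

  degree-bound : ∀ n y → 1 ℕ.≤ n → M ℕ.* n ℕ.≤ 2 ℕ.* M ℕ.* y ℕ.+ 10 ℕ.* n → ((+ 1) / 2 - (+ 2) / 1 * ξ) * ℕ→ℚ n < ℕ→ℚ y
  degree-bound n y n≥1 h = main (ℕ→ℚ M) (ℕ→ℚ n) (ℕ→ℚ y) M-positive (positive (ℕ→ℚ-mono-< {0} n≥1))
    (subst₂ _≤_ (ℕ→ℚ-* M n) (trans (ℕ→ℚ-+ (2 ℕ.* M ℕ.* y) (10 ℕ.* n))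
      (cong₂ _+_ (trans (ℕ→ℚ-* (2 ℕ.* M) y) (cong (_* ℕ→ℚ y) (ℕ→ℚ-* 2 M))) (ℕ→ℚ-* 10 n))) (ℕ→ℚ-mono-≤ h))
    (ℚ.<-≤-trans (ℕ→ℚ-mono-< (ℕ.m≤m+n 11 69)) (subst (_≤ ℕ→ℚ 4 * (ξ * ℕ→ℚ M)) (≡-sym (ℕ→ℚ-* 4 20)) (ℚ.*-monoˡ-≤-nonNeg (ℕ→ℚ 4) 20≤ξM)))
    where
    main : ∀ μ ν υ → Positive μ → Positive ν → μ * ν ≤ ℕ→ℚ 2 * μ * υ + ℕ→ℚ 10 * ν → ℕ→ℚ 10 < ℕ→ℚ 4 * (ξ * μ) →
           ((+ 1) / 2 - (+ 2) / 1 * ξ) * ν < υ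
    main μ ν υ μ>0 ν>0 h₁ h₂ = ℚ.*-cancelˡ-<-nonNeg (ℕ→ℚ 2 * μ) {{ℚ.pos⇒nonNeg (ℕ→ℚ 2 * μ) {{ℚ.pos*pos⇒pos (ℕ→ℚ 2) μ {{μ>0}}}}}}
      (+-cancelʳ-< _ _ (ℕ→ℚ 4 * (ξ * μ) * ν) (begin-strict
      ℕ→ℚ 2 * μ * (((+ 1) / 2 - (+ 2) / 1 * ξ) * ν) + ℕ→ℚ 4 * (ξ * μ) * ν   ≡⟨ eq μ ν ξ ⟩
      μ * ν                                          ≤⟨ h₁ ⟩
      ℕ→ℚ 2 * μ * υ + ℕ→ℚ 10 * ν                     <⟨ ℚ.+-monoʳ-< (ℕ→ℚ 2 * μ * υ) (ℚ.*-monoˡ-<-pos ν {{ν>0}} h₂) ⟩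
      ℕ→ℚ 2 * μ * υ + ℕ→ℚ 4 * (ξ * μ) * ν            ∎))
      where
      open ℚ.≤-Reasoning
      open +-*-Solver
      eq : ∀ μ ν ξ → ℕ→ℚ 2 * μ * (((+ 1) / 2 - (+ 2) / 1 * ξ) * ν) + ℕ→ℚ 4 * (ξ * μ) * ν ≡ μ * ν
      eq = solve 3 (λ μ ν ξ → con (ℕ→ℚ 2) :* μ :* ((con ((+ 1) / 2) :+ :- (con ((+ 2) / 1) :* ξ)) :* ν) :+ con (ℕ→ℚ 4) :* (ξ :* μ) :* ν := μ :* ν) refl

  sixth-power-positive : 0ℚ < (+ 1) / 1000000 * (ξ * ξ * ξ * ξ * ξ * ξ)
  sixth-power-positive = ℚ.positive⁻¹ _ {{times ((+ 1) / 1000000) (ξ * ξ * ξ * ξ * ξ * ξ) (ℚ.normalize-pos 1 1000000)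
    (times (ξ * ξ * ξ * ξ * ξ) ξ (times (ξ * ξ * ξ * ξ) ξ (times (ξ * ξ * ξ) ξ (times (ξ * ξ) ξ (times ξ ξ pos pos) pos) pos) pos) pos)}}
    where
    pos : Positive ξ
    pos = positive ξ>0
    times : ∀ p q → Positive p → Positive q → Positive (p * q)
    times p q p>0 q>0 = ℚ.pos*pos⇒pos p {{p>0}} q {{q>0}}

theorem5 : Σ ℚ (λ c → 0ℚ < c × ((ξ : ℚ) → 0ℚ < ξ → ξ < c →
    Σ ℕ (λ n₀ → (n : ℕ) → n ≥ n₀ → (G : Graph n) →
    (ℕ→ℚ n * ((+ 1) / 2) < ℕ→ℚ (bkComp G))
    ⊎ (((+ 1) / 12 - (+ 1) / 1000000 * (ξ * ξ * ξ * ξ * ξ * ξ)) * ℕ→ℚ n < ℕ→ℚ (bk G))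
    ⊎ Σ (Fin n → Bool) (λ S →
    InducedBipartite G S
    × ((1ℚ - ξ) * ℕ→ℚ n ≤ ℕ→ℚ (card S))
    × ((u : Fin n) → T (S u) → ((+ 1) / 2 - (+ 2) / 1 * ξ) * ℕ→ℚ n < ℕ→ℚ (degIn G S u))))))
theorem5 = 1ℚ , ℚ.positive⁻¹ 1ℚ , λ ξ ξ>0 _ → main ξ ξ>0 ((+ 1) / 1000000 * (ξ * ξ * ξ * ξ * ξ * ξ)) (sixth-power-positive ξ ξ>0)
  where
  -- The sixth power is generalised to a positive `η`, whose denominator serves as N and thereby
  -- influences the threshold on n.
  main : ∀ ξ → 0ℚ < ξ → ∀ η → 0ℚ < η → Σ ℕ (λ n₀ → (n : ℕ) → n ≥ n₀ → (G : Graph n) →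
    (ℕ→ℚ n * ((+ 1) / 2) < ℕ→ℚ (bkComp G)) ⊎ (((+ 1) / 12 - η) * ℕ→ℚ n < ℕ→ℚ (bk G)) ⊎ Σ (Fin n → Bool) (λ S →
    InducedBipartite G S × ((1ℚ - ξ) * ℕ→ℚ n ≤ ℕ→ℚ (card S))
    × ((u : Fin n) → T (S u) → ((+ 1) / 2 - (+ 2) / 1 * ξ) * ℕ→ℚ n < ℕ→ℚ (degIn G S u))))
  main ξ ξ>0 η η>0 = proj₁ constants , λ n n≥ G → decide n n≥ G (ℕ→ℚ n * ((+ 1) / 2) ℚ.<? ℕ→ℚ (bkComp G)) (((+ 1) / 12 - η) * ℕ→ℚ n ℚ.<? ℕ→ℚ (bk G))
    where
    constants = bookless⇒nearly-bipartite (M ξ ξ>0) (↧ₙ η) (M≥20 ξ ξ>0)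
    decide : ∀ n → n ≥ proj₁ constants → (G : Graph n) → Dec (ℕ→ℚ n * ((+ 1) / 2) < ℕ→ℚ (bkComp G)) → Dec (((+ 1) / 12 - η) * ℕ→ℚ n < ℕ→ℚ (bk G)) → _
    decide n n≥ G (yes p) _       = inj₁ p
    decide n n≥ G (no _)  (yes q) = inj₂ (inj₁ q)
    decide n n≥ G (no ¬p) (no ¬q) = inj₂ (inj₂ (conclude (proj₂ constants n n≥ G (bk G)
        (small-books G (ℕ.s≤s ℕ.z≤n) (complement-bound (bkComp G) n (ℚ.≮⇒≥ ¬p)) (book-bound (bk G) n η η>0 (ℚ.≮⇒≥ ¬q))))))
      where
      conclude : 1 ℕ.≤ n × NearlyBipartite G (M ξ ξ>0) → Σ (Fin n → Bool) (λ S →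
        InducedBipartite G S × ((1ℚ - ξ) * ℕ→ℚ n ≤ ℕ→ℚ (card S))
        × ((u : Fin n) → T (S u) → ((+ 1) / 2 - (+ 2) / 1 * ξ) * ℕ→ℚ n < ℕ→ℚ (degIn G S u)))
      conclude (n≥1 , S , bip , size , deg) = S , bip , order-bound ξ ξ>0 n (card S) size , λ u t → degree-bound ξ ξ>0 n (degIn G S u) n≥1 (deg u t)
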